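{- Let $n\ge 3$, let $s\ge1$, let $\lambda=\sum_{i\in I}\lambda_i\Lambda_i$ be a dominant integral weight (all $\lambda_i\in\mathbb{Z}_{\ge0}$) of level $s$, i.e. $\sum_{i\in I}\lambda_i=s$, and let $\mu=\sum_{i\in I}\lambda_i\Lambda_{i-1}$ (indices mod $n$). Then the map $$\Phi:\mathcal{M}^{1,s}\otimes\mathcal{M}(\mu)\to\mathcal{M}(\lambda),\qquad m\otimes m'\mapsto m\cdot\tau_1(m'),$$ is a (well-defined) isomorphism of $U_q'(\widehat{\mathfrak{sl}}_n)$-crystals.
   Context: Crystals. $I=\mathbb{Z}/n\mathbb{Z}=\{0,1,\dots,n-1\}$ is the index set of $\widehat{\mathfrak{sl}}_n$ (type $A_{n-1}^{(1)}$), with simple coroots $h_i$, fundamental weights $\Lambda_i$ ($\langle h_i,\Lambda_j\rangle=\delta_{ij}$), and simple roots $\alpha_i=2\Lambda_i-\Lambda_{i-1}-\Lambda_{i+1}$ as $U_q'(\widehat{\mathfrak{sl}}_n)$-weights (that is, modulo the null root $\delta$). A $U_q'(\widehat{\mathfrak{sl}}_n)$-crystal is a set $B$ with maps $e_i,f_i:B\to B\sqcup\{0\}$, $\varepsilon_i,\varphi_i:B\to\mathbb{Z}$ and $\mathrm{wt}:B\to\bigoplus_i\mathbb{Z}\Lambda_i$ satisfying the usual crystal axioms. An isomorphism of crystals is a bijection that preserves $\mathrm{wt},\varepsilon_i,\varphi_i$ and commutes with all $e_i,f_i$ (with $0\mapsto 0$). Tensor product (opposite to Kashiwara's convention). $B_2\otimes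 B_1$ is the set $B_2\times B_1$ with $e_i(b_2\otimes b_1)=e_ib_2\otimes b_1$ if $\varepsilon_i(b_2)>\varphi_i(b_1)$ and $b_2\otimes e_ib_1$ otherwise; $f_i(b_2\otimes b_1)=f_ib_2\otimes b_1$ if $\varepsilon_i(b_2)\ge\varphi_i(b_1)$ and $b_2\otimes f_ib_1$ otherwise; $\varepsilon_i(b_2\otimes b_1)=\max(\varepsilon_i(b_1),\varepsilon_i(b_2)-\langle h_i,\mathrm{wt}(b_1)\rangle)$; $\varphi_i(b_2\otimes b_1)=\max(\varphi_i(b_2),\varphi_i(b_1)+\langle h_i,\mathrm{wt}(b_2)\rangle)$; $\mathrm{wt}(b_2\otimes b_1)=\mathrm{wt}(b_2)+\mathrm{wt}(b_1)$. Nakajima monomials. $\mathcal{M}$ is the set of Laurent monomials $m=\prod_{i\in I,k\in\mathbb{Z}}Y_{i,k}^{y_{i,k}}$ (finitely many nonzero exponents) in commuting variables $Y_{i,k}$. Put $\mathrm{wt}(m)=\sum_{i,k}y_{i,k}\Lambda_i$, $\ \varepsilon_i(m)=-\min_{k\in\mathbb{Z}}\sum_{t\ge k}y_{i,t}$, $\ \varphi_i(m)=\max_{k\in\mathbb{Z}}\sum_{t\le k}y_{i,t}$, $\ k_e(m)=\max\{k\mid \varepsilon_i(m)=-\sum_{t\ge k}y_{i,t}\}$ (used when $\varepsilon_i(m)>0$), $\ k_f(m)=\min\{k\mid\varphi_i(m)=\sum_{t\le k}y_{i,t}\}$ (used when $\varphi_i(m)>0$). With $A_{i,k}=Y_{i,k}Y_{i,k+1}Y_{i-1,k+1}^{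 -1}Y_{i+1,k}^{ -1}$, set $e_i(m)=0$ if $\varepsilon_i(m)=0$ and $e_i(m)=m\,A_{i,k_e(m)-1}$ otherwise; $f_i(m)=0$ if $\varphi_i(m)=0$ and $f_i(m)=m\,A_{i,k_f(m)}^{ -1}$ otherwise. For $j\in\mathbb{Z}$, $\tau_j$ is the shift $Y_{i,k}\mapsto Y_{i,k+j}$ extended multiplicatively. For $s\ge1$, $\mathcal{M}^{1,s}=\{\prod_{i=1}^nY_{i-1,1}^{ -x_i}Y_{i,0}^{x_i}\mid x_i\in\mathbb{Z}_{\ge0},\ \sum_{i=1}^nx_i=s\}$ (first indices mod $n$). For a dominant integral weight $\nu=\sum_i\nu_i\Lambda_i$, $\mathcal{M}(\nu)$ is the closure of the monomial $Y_\nu=\prod_{i\in I}Y_{i,0}^{\nu_i}$ under all operators $e_i,f_i$, $i\in I$ (excluding $0$). All these sets of monomials carry the crystal structure just described. -}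

module Defs where

open import Data.Bool.Base using (true; false; if_then_else_)
open import Data.Empty using (⊥-elim)
open import Data.Integer.Base
  using (ℤ; +_; -[1+_]; +[1+_]; 0ℤ; 1ℤ; _+_; _*_; -_; _-_; _⊔_; ∣_∣; _≤_; _<_; +≤+)
import Data.Integer.Base as ℤ
import Data.Integer.Properties as ℤ
open import Data.Integer.Tactic.RingSolver using (solve-∀)
open import Data.List.Base using (List; []; _∷_; map; filter; applyUpTo; foldr)
open import Data.List.Extrema ℤ.≤-totalOrder using (max; min; xs≤max; ⊥≤max; min≤xs; min≤⊤; argmax-sel; argmin-sel)
open import Data.List.Membership.Propositional using (_∈_)
open import Data.List.Membership.Propositional.Properties
  using (∈-applyUpTo⁺; ∈-applyUpTo⁻; ∈-map⁺; ∈-map⁻; ∈-filter⁺; ∈-filter⁻)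
open import Data.List.Relation.Unary.All using (lookup)
open import Data.Nat.Base as ℕ using (ℕ; suc; zero; z≤n; s≤s)
import Data.Nat.Properties as ℕ
open import Data.Product using (Σ; ∃; _×_; _,_; proj₁; proj₂)
open import Data.Sum.Base using (_⊎_; inj₁; inj₂; [_,_]′)
open import Function.Base using (_∘_; id)
open import Relation.Binary.PropositionalEquality
  using (_≡_; _≢_; _≗_; refl; sym; trans; cong; cong₂; subst; subst₂; module ≡-Reasoning)
open import Relation.Nullary using (¬_; Dec; yes; no; does)
open import Relation.Unary using (Decidable)
open import Data.Fin.Base using (Fin; zero; suc; toℕ)
import Data.Fin.Properties as Fin
open import Data.Maybe.Base as Maybe using (Maybe; just; nothing)
open import Data.Maybe.Relation.Binary.Pointwise as Pointwise using (Pointwise; just; nothing)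
open import Data.Nat.Base using (NonZero)
open import Data.Nat.DivMod
  using (_%_; _mod_; m%n%n≡m%n; [m+n]%n≡m%n; m<n⇒m%n≡m; n%n≡0; %-distribˡ-+)
open import Data.Product.Relation.Binary.Pointwise.NonDependent using (×-setoid)
import Data.Sum.Base as Sum
import Data.Vec.Functional as Vector
open import Function.Bundles using (_⇔_; mk⇔; Equivalence)
open import Function.Structures using (IsBijection)
open import Level using (0ℓ)
open import Relation.Binary.Bundles using (Setoid)
import Relation.Binary.Construct.On as On

sumℤ : List ℤ → ℤ
sumℤ = foldr _+_ 0ℤ

interval : ℕ → List ℤ
interval N = applyUpTo (λ j → + j - + N) (N ℕ.+ suc N)

⟦_⟧ : ∀ {A : Set} → Dec A → ℤ
⟦ d ⟧ = if does d then 1ℤ else 0ℤ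

-- For y vanishing outside of [-N , N]: the sums of y over ℤ, over all t ≤ k and over all t ≥ k
total : (ℤ → ℤ) → ℕ → ℤ
total y N = sumℤ (map y (interval N))

sum≤ sum≥ : (ℤ → ℤ) → ℕ → ℤ → ℤ
sum≤ y N k = sumℤ (map y (filter (λ t → t ℤ.≤? k) (interval N)))
sum≥ y N k = sumℤ (map y (filter (λ t → k ℤ.≤? t) (interval N)))

VanishesBeyond : ℕ → (ℤ → ℤ) → Set
VanishesBeyond N y = ∀ k → N ℕ.< ∣ k ∣ → y k ≡ 0ℤ

1≢0 : 1ℤ ≢ 0ℤ
1≢0 ()

⟦⟧-true : ∀ {A : Set} (d : Dec A) → A → ⟦ d ⟧ ≡ 1ℤ
⟦⟧-true (yes _) a = refl
⟦⟧-true (no ¬a) a = ⊥-elim (¬a a)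

⟦⟧-false : ∀ {A : Set} (d : Dec A) → ¬ A → ⟦ d ⟧ ≡ 0ℤ
⟦⟧-false (yes a) ¬a = ⊥-elim (¬a a)
⟦⟧-false (no _) ¬a = refl

⟦⟧-cong : ∀ {A B : Set} (d : Dec A) (d′ : Dec B) → (A → B) → (B → A) → ⟦ d ⟧ ≡ ⟦ d′ ⟧
⟦⟧-cong (yes a) d′ f g = sym (⟦⟧-true d′ (f a))
⟦⟧-cong (no ¬a) d′ f g = sym (⟦⟧-false d′ (¬a ∘ g))

≤-by : ∀ {a b x y} → x ≤ y → b - a ≡ y - x → a ≤ b
≤-by x≤y eq = ℤ.0≤i-j⇒j≤i (subst (0ℤ ≤_) (sym eq) (ℤ.i≤j⇒0≤j-i x≤y))

≤-by₂ : ∀ {a b x y z w} → x ≤ y → z ≤ w → b - a ≡ (y - x) + (w - z) → a ≤ b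
≤-by₂ x≤y z≤w eq = ℤ.0≤i-j⇒j≤i
  (subst (0ℤ ≤_) (sym eq) (ℤ.+-mono-≤ (ℤ.i≤j⇒0≤j-i x≤y) (ℤ.i≤j⇒0≤j-i z≤w)))

0≤+ : ∀ {n} → 0ℤ ≤ + n
0≤+ = +≤+ z≤n

<→ : ∀ {a b} → a < b → 1ℤ + a ≤ b
<→ = ℤ.i<j⇒suc[i]≤j

→< : ∀ {a b} → 1ℤ + a ≤ b → a < b
→< = ℤ.suc[i]≤j⇒i<j

≤→<+1 : ∀ {a b} → a ≤ b → a < b + 1ℤ
≤→<+1 {a} {b} p = →< (≤-by p (eq a b))
  where eq : ∀ a b → (b + 1ℤ) - (1ℤ + a) ≡ b - a
        eq = solve-∀

<→≤-1 : ∀ {a b} → a < b → a ≤ b - 1ℤ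
<→≤-1 {a} {b} p = ≤-by (<→ p) (eq a b)
  where eq : ∀ a b → (b - 1ℤ) - a ≡ b - (1ℤ + a)
        eq = solve-∀

≤-1→< : ∀ {a b} → a ≤ b - 1ℤ → a < b
≤-1→< {a} {b} p = →< (≤-by p (eq a b))
  where eq : ∀ a b → b - (1ℤ + a) ≡ (b - 1ℤ) - a
        eq = solve-∀

k-1<k : ∀ k → k - 1ℤ < k
k-1<k k = ≤-1→< ℤ.≤-refl

i≤∣i∣ : ∀ i → i ≤ + ∣ i ∣
i≤∣i∣ (+ n) = ℤ.≤-refl
i≤∣i∣ -[1+ n ] = ℤ.-≤+

+<⇒< : ∀ {N} k → + N < k → N ℕ.< ∣ k ∣
+<⇒< (+ n) p = ℤ.drop‿+<+ p

<-⇒< : ∀ {N} k → k < - + N → N ℕ.< ∣ k ∣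
<-⇒< {zero} -[1+ n ] p = s≤s z≤n
<-⇒< {suc N} -[1+ n ] p = s≤s (ℤ.drop‿-<- p)
<-⇒< {zero} (+ n) (ℤ.+<+ ())

∈-interval⁺ : ∀ {N} k → ∣ k ∣ ℕ.≤ N → k ∈ interval N
∈-interval⁺ {N} (+ a) a≤N = subst (_∈ interval N) eq
  (∈-applyUpTo⁺ (λ j → + j - + N) (subst (a ℕ.+ N ℕ.<_) (sym (ℕ.+-suc N N)) (s≤s (ℕ.+-monoˡ-≤ N a≤N))))
  where
  lem : ∀ x y → (x + y) - y ≡ x
  lem = solve-∀
  eq : + (a ℕ.+ N) - + N ≡ + a
  eq = trans (cong (_- + N) (ℤ.pos-+ a N)) (lem (+ a) (+ N))
∈-interval⁺ {N} -[1+ a ] a<N = subst (_∈ interval N) eq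
  (∈-applyUpTo⁺ (λ j → + j - + N) (ℕ.≤-<-trans (ℕ.m∸n≤m N (suc a)) (ℕ.m<m+n N (s≤s z≤n))))
  where
  lem : ∀ x y → (x - y) - x ≡ - y
  lem = solve-∀
  eq : + (N ℕ.∸ suc a) - + N ≡ -[1+ a ]
  eq = trans (cong (_- + N) (trans (sym (ℤ.⊖-≥ a<N)) (sym (ℤ.m-n≡m⊖n N (suc a))))) (lem (+ N) (+ suc a))

sum-filter : ∀ {P : ℤ → Set} (P? : Decidable P) (y : ℤ → ℤ) xs →
             sumℤ (map y (filter P? xs)) ≡ sumℤ (map (λ t → ⟦ P? t ⟧ * y t) xs)
sum-filter P? y [] = refl
sum-filter P? y (x ∷ xs) with P? x
... | yes p = cong₂ _+_ (sym (ℤ.*-identityˡ (y x))) (sum-filter P? y xs)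
... | no ¬p = trans (sum-filter P? y xs) (sym (trans (cong (λ z → z + sumℤ (map (λ t → ⟦ P? t ⟧ * y t) xs)) (ℤ.*-zeroˡ (y x))) (ℤ.+-identityˡ _)))

sum-cong : ∀ {f g : ℤ → ℤ} xs → f ≗ g → sumℤ (map f xs) ≡ sumℤ (map g xs)
sum-cong [] eq = refl
sum-cong (x ∷ xs) eq = cong₂ _+_ (eq x) (sum-cong xs eq)

sum-+ : ∀ (f g : ℤ → ℤ) xs → sumℤ (map (λ t → f t + g t) xs) ≡ sumℤ (map f xs) + sumℤ (map g xs)
sum-+ f g [] = refl
sum-+ f g (x ∷ xs) = trans (cong (λ z → (f x + g x) + z) (sum-+ f g xs)) (lem (f x) (g x) _ _)
  where lem : ∀ a b c d → a + b + (c + d) ≡ a + c + (b + d)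
        lem = solve-∀

sum-0 : ∀ {f : ℤ → ℤ} xs → (∀ t → f t ≡ 0ℤ) → sumℤ (map f xs) ≡ 0ℤ
sum-0 [] eq = refl
sum-0 (x ∷ xs) eq = cong₂ _+_ (eq x) (sum-0 xs eq)

δ* : ℤ → (ℤ → ℤ) → ℤ → ℤ
δ* k y t = ⟦ t ℤ.≟ k ⟧ * y t

δ*-≢ : ∀ {k} y {t} → t ≢ k → δ* k y t ≡ 0ℤ
δ*-≢ {k} y {t} t≢k = trans (cong (_* y t) (⟦⟧-false (t ℤ.≟ k) t≢k)) (ℤ.*-zeroˡ (y t))

δ*-≡ : ∀ k y → δ* k y k ≡ y k
δ*-≡ k y = trans (cong (_* y k) (⟦⟧-true (k ℤ.≟ k) refl)) (ℤ.*-identityˡ (y k))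

sum-δ-miss : ∀ {k} y (f : ℕ → ℤ) L → (∀ j → f j ≢ k) → sumℤ (map (δ* k y) (applyUpTo f L)) ≡ 0ℤ
sum-δ-miss y f zero ne = refl
sum-δ-miss y f (suc L) ne = cong₂ _+_ (δ*-≢ y (ne 0)) (sum-δ-miss y (f ∘ suc) L (ne ∘ suc))

sum-δ-hit : ∀ {k} y (f : ℕ → ℤ) → (∀ {i j} → f i ≡ f j → i ≡ j) → ∀ L → k ∈ applyUpTo f L →
            sumℤ (map (δ* k y) (applyUpTo f L)) ≡ y k
sum-δ-hit {k} y f inj L k∈ with ∈-applyUpTo⁻ f k∈
sum-δ-hit {.(f 0)} y f inj (suc L) k∈ | zero , j<L , refl = trans
  (cong₂ _+_ (δ*-≡ (f 0) y) (sum-δ-miss y (f ∘ suc) L (λ j eq → ℕ.1+n≢0 (inj eq)))) (ℤ.+-identityʳ _)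
sum-δ-hit {.(f (suc i))} y f inj (suc L) k∈ | suc i , s≤s i<L , refl = trans
  (cong₂ _+_ (δ*-≢ y (λ eq → ℕ.1+n≢0 (sym (inj eq))))
    (sum-δ-hit y (f ∘ suc) (ℕ.suc-injective ∘ inj) L (∈-applyUpTo⁺ (f ∘ suc) i<L)))
  (ℤ.+-identityˡ _)

sum-δ : ∀ {y N} → VanishesBeyond N y → ∀ k → sumℤ (map (δ* k y) (interval N)) ≡ y k
sum-δ {y} {N} van k with ∣ k ∣ ℕ.≤? N
... | yes k≤N = sum-δ-hit y (λ j → + j - + N) inj (N ℕ.+ suc N) (∈-interval⁺ k k≤N)
  where
  lem : ∀ a b → a ≡ (a - b) + b
  lem = solve-∀
  inj : ∀ {i j} → + i - + N ≡ + j - + N → i ≡ j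
  inj {i} {j} eq = ℤ.+-injective (trans (lem (+ i) (+ N)) (trans (cong (_+ + N) eq) (sym (lem (+ j) (+ N)))))
... | no k≰N = trans (sum-0 (interval N) zeros) (sym yk≡0)
  where
  yk≡0 : y k ≡ 0ℤ
  yk≡0 = van k (ℕ.≰⇒> k≰N)
  zeros : ∀ t → δ* k y t ≡ 0ℤ
  zeros t with t ℤ.≟ k
  ... | yes refl = trans (ℤ.*-identityˡ (y t)) yk≡0
  ... | no _ = ℤ.*-zeroˡ (y t)

-- H t is the sum of all y s with s ≤ t, and v is the sum of all y s
record Cumulative (y : ℤ → ℤ) (H : ℤ → ℤ) (v : ℤ) : Set where
  field
    lo     : ℕ
    bottom : ∀ k → k < - + lo → H k ≡ 0ℤ
    hi     : ℕ
    top    : ∀ k → + hi ≤ k → H k ≡ v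
    step   : ∀ k → H k ≡ H (k - 1ℤ) + y k

module _ {y N} (van : VanishesBeyond N y) where

  sum≤-step : ∀ k → sum≤ y N k ≡ sum≤ y N (k - 1ℤ) + y k
  sum≤-step k = begin
    sum≤ y N k                                                     ≡⟨ sum-filter (ℤ._≤? k) y W ⟩
    sumℤ (map (λ t → ⟦ t ℤ.≤? k ⟧ * y t) W)                         ≡⟨ sum-cong W split ⟩
    sumℤ (map (λ t → ⟦ t ℤ.≤? (k - 1ℤ) ⟧ * y t + δ* k y t) W)         ≡⟨ sum-+ (λ t → ⟦ t ℤ.≤? (k - 1ℤ) ⟧ * y t) (δ* k y) W ⟩
    sumℤ (map (λ t → ⟦ t ℤ.≤? (k - 1ℤ) ⟧ * y t) W) + sumℤ (map (δ* k y) W)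
                                                                   ≡⟨ cong₂ _+_ (sym (sum-filter (ℤ._≤? (k - 1ℤ)) y W)) (sum-δ van k) ⟩
    sum≤ y N (k - 1ℤ) + y k                                         ∎
    where
    open ≡-Reasoning
    W = interval N
    ind : ∀ t → ⟦ t ℤ.≤? k ⟧ ≡ ⟦ t ℤ.≤? (k - 1ℤ) ⟧ + ⟦ t ℤ.≟ k ⟧
    ind t with t ℤ.≟ k
    ... | yes refl = trans (⟦⟧-true (t ℤ.≤? t) ℤ.≤-refl)
                       (cong (_+ 1ℤ) (sym (⟦⟧-false (t ℤ.≤? (t - 1ℤ)) (ℤ.<⇒≱ (k-1<k t)))))
    ... | no t≢k = trans (⟦⟧-cong (t ℤ.≤? k) (t ℤ.≤? (k - 1ℤ))
                      (λ t≤k → <→≤-1 (ℤ.≤∧≢⇒< t≤k t≢k)) (λ p → ℤ.<⇒≤ (≤-1→< p))) (sym (ℤ.+-identityʳ _))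
    split : ∀ t → ⟦ t ℤ.≤? k ⟧ * y t ≡ ⟦ t ℤ.≤? (k - 1ℤ) ⟧ * y t + δ* k y t
    split t = trans (cong (_* y t) (ind t)) (ℤ.*-distribʳ-+ (y t) ⟦ t ℤ.≤? (k - 1ℤ) ⟧ ⟦ t ℤ.≟ k ⟧)

  sum≤-bottom : ∀ k → k < - + N → sum≤ y N k ≡ 0ℤ
  sum≤-bottom k k<-N = trans (sum-filter (ℤ._≤? k) y (interval N)) (sum-0 (interval N) zeros)
    where
    zeros : ∀ t → ⟦ t ℤ.≤? k ⟧ * y t ≡ 0ℤ
    zeros t with t ℤ.≤? k
    ... | yes t≤k = trans (ℤ.*-identityˡ (y t)) (van t (<-⇒< t (ℤ.≤-<-trans t≤k k<-N)))
    ... | no _ = ℤ.*-zeroˡ (y t)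

  sum≥-top : ∀ k → + N < k → sum≥ y N k ≡ 0ℤ
  sum≥-top k N<k = trans (sum-filter (k ℤ.≤?_) y (interval N)) (sum-0 (interval N) zeros)
    where
    zeros : ∀ t → ⟦ k ℤ.≤? t ⟧ * y t ≡ 0ℤ
    zeros t with k ℤ.≤? t
    ... | yes k≤t = trans (ℤ.*-identityˡ (y t)) (van t (+<⇒< t (ℤ.<-≤-trans N<k k≤t)))
    ... | no _ = ℤ.*-zeroˡ (y t)

  sum≤+sum≥ : ∀ k → sum≤ y N (k - 1ℤ) + sum≥ y N k ≡ total y N
  sum≤+sum≥ k = begin
    sum≤ y N (k - 1ℤ) + sum≥ y N k  ≡⟨ cong₂ _+_ (sum-filter (ℤ._≤? (k - 1ℤ)) y W) (sum-filter (k ℤ.≤?_) y W) ⟩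
    sumℤ (map (λ t → ⟦ t ℤ.≤? (k - 1ℤ) ⟧ * y t) W) + sumℤ (map (λ t → ⟦ k ℤ.≤? t ⟧ * y t) W)
                                    ≡⟨ sum-+ (λ t → ⟦ t ℤ.≤? (k - 1ℤ) ⟧ * y t) (λ t → ⟦ k ℤ.≤? t ⟧ * y t) W ⟨
    sumℤ (map (λ t → ⟦ t ℤ.≤? (k - 1ℤ) ⟧ * y t + ⟦ k ℤ.≤? t ⟧ * y t) W)
                                    ≡⟨ sum-cong W merge ⟩
    total y N                       ∎
    where
    open ≡-Reasoning
    W = interval N
    ind : ∀ t → ⟦ t ℤ.≤? (k - 1ℤ) ⟧ + ⟦ k ℤ.≤? t ⟧ ≡ 1ℤ
    ind t with k ℤ.≤? t
    ... | yes k≤t = cong (_+ 1ℤ) (⟦⟧-false (t ℤ.≤? (k - 1ℤ)) (λ p → ℤ.<⇒≱ (≤-1→< p) k≤t))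
    ... | no k≰t = cong (_+ 0ℤ) (⟦⟧-true (t ℤ.≤? (k - 1ℤ)) (<→≤-1 (ℤ.≰⇒> k≰t)))
    merge : ∀ t → ⟦ t ℤ.≤? (k - 1ℤ) ⟧ * y t + ⟦ k ℤ.≤? t ⟧ * y t ≡ y t
    merge t = trans (sym (ℤ.*-distribʳ-+ (y t) ⟦ t ℤ.≤? (k - 1ℤ) ⟧ ⟦ k ℤ.≤? t ⟧))
                    (trans (cong (_* y t) (ind t)) (ℤ.*-identityˡ (y t)))

  sum≤-top : ∀ k → + N ≤ k → sum≤ y N k ≡ total y N
  sum≤-top k N≤k = trans (sym (ℤ.+-identityʳ _)) (trans
    (cong₂ _+_ (cong (sum≤ y N) (lem k)) (sym (sum≥-top (k + 1ℤ) (≤→<+1 N≤k)))) (sum≤+sum≥ (k + 1ℤ)))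
    where lem : ∀ k → k ≡ (k + 1ℤ) - 1ℤ
          lem = solve-∀

  cumulative : Cumulative y (sum≤ y N) (total y N)
  cumulative = record
    { lo = N ; bottom = sum≤-bottom ; hi = N ; top = sum≤-top ; step = sum≤-step }

  -sum≥ : ∀ k → - sum≥ y N k ≡ sum≤ y N (k - 1ℤ) - total y N
  -sum≥ k = trans (lem (sum≤ y N (k - 1ℤ)) (sum≥ y N k)) (cong (λ z → sum≤ y N (k - 1ℤ) - z) (sum≤+sum≥ k))
    where lem : ∀ a b → - b ≡ a - (a + b)
          lem = solve-∀

module _ {y y′ H H′ v v′} (y≗y′ : y ≗ y′) (c : Cumulative y H v) (c′ : Cumulative y′ H′ v′) where
  private
    module C = Cumulative c
    module C′ = Cumulative c′

    down : ∀ k j → H (k - + j) ≡ H′ (k - + j) → H k ≡ H′ k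
    down k zero eq = subst (λ z → H z ≡ H′ z) (ℤ.+-identityʳ k) eq
    down k (suc j) eq = trans (C.step k) (trans
        (cong₂ _+_ (down (k - 1ℤ) j (subst (λ z → H z ≡ H′ z) (sym lem) eq)) (y≗y′ k))
        (sym (C′.step k)))
      where
      lem′ : ∀ k j → (k - 1ℤ) - j ≡ k - (1ℤ + j)
      lem′ = solve-∀
      lem : (k - 1ℤ) - + j ≡ k - + suc j
      lem = trans (lem′ k (+ j)) (cong (λ z → k - z) (sym (ℤ.pos-+ 1 j)))

  cumulative-unique : H ≗ H′
  cumulative-unique k = down k J (trans (C.bottom _ (small (ℕ.m≤m+n C.lo C′.lo)))
                                        (sym (C′.bottom _ (small (ℕ.m≤n+m C′.lo C.lo)))))
    where
    L = C.lo ℕ.+ C′.lo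
    J = suc (∣ k ∣ ℕ.+ L)
    lem : ∀ k a l m → - m - (1ℤ + (k - (1ℤ + (a + l)))) ≡ (a - k) + (l - m)
    lem = solve-∀
    eqJ : + J ≡ 1ℤ + (+ ∣ k ∣ + + L)
    eqJ = trans (ℤ.pos-+ 1 (∣ k ∣ ℕ.+ L)) (cong (λ z → 1ℤ + z) (ℤ.pos-+ ∣ k ∣ L))
    small : ∀ {m} → m ℕ.≤ L → k - + J < - + m
    small {m} m≤L = →< (≤-by₂ (i≤∣i∣ k) (+≤+ m≤L)
      (trans (cong (λ z → - + m - (1ℤ + (k - z))) eqJ) (lem k (+ ∣ k ∣) (+ L) (+ m))))

  total-unique : v ≡ v′
  total-unique = trans (sym (C.top K (+≤+ (ℕ.m≤m+n C.hi C′.hi))))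
                (trans (cumulative-unique K) (C′.top K (+≤+ (ℕ.m≤n+m C′.hi C.hi))))
    where K = + (C.hi ℕ.+ C′.hi)

cumulative-+ : ∀ {y y′ H H′ v v′} → Cumulative y H v → Cumulative y′ H′ v′ →
               Cumulative (λ t → y t + y′ t) (λ t → H t + H′ t) (v + v′)
cumulative-+ {y} {y′} {H} {H′} c c′ = record
  { lo = C.lo ℕ.+ C′.lo
  ; bottom = λ k k< → cong₂ _+_ (C.bottom k (ℤ.<-≤-trans k< (ℤ.neg-mono-≤ (+≤+ (ℕ.m≤m+n C.lo C′.lo)))))
                                (C′.bottom k (ℤ.<-≤-trans k< (ℤ.neg-mono-≤ (+≤+ (ℕ.m≤n+m C′.lo C.lo)))))
  ; hi = C.hi ℕ.+ C′.hi
  ; top = λ k ≤k → cong₂ _+_ (C.top k (ℤ.≤-trans (+≤+ (ℕ.m≤m+n C.hi C′.hi)) ≤k))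
                             (C′.top k (ℤ.≤-trans (+≤+ (ℕ.m≤n+m C′.hi C.hi)) ≤k))
  ; step = λ k → trans (cong₂ _+_ (C.step k) (C′.step k)) (lem (H (k - 1ℤ)) (y k) (H′ (k - 1ℤ)) (y′ k))
  }
  where
  module C = Cumulative c
  module C′ = Cumulative c′
  lem : ∀ a b c d → a + b + (c + d) ≡ a + c + (b + d)
  lem = solve-∀

cumulative-* : ∀ {y H v} z → Cumulative y H v → Cumulative (λ t → z * y t) (λ t → z * H t) (z * v)
cumulative-* {y} {H} z c = record
  { lo = C.lo ; bottom = λ k k< → trans (cong (z *_) (C.bottom k k<)) (ℤ.*-zeroʳ z)
  ; hi = C.hi ; top = λ k ≤k → cong (z *_) (C.top k ≤k)
  ; step = λ k → trans (cong (z *_) (C.step k)) (ℤ.*-distribˡ-+ z (H (k - 1ℤ)) (y k)) }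
  where module C = Cumulative c

cumulative-0 : Cumulative (λ _ → 0ℤ) (λ _ → 0ℤ) 0ℤ
cumulative-0 = record { lo = 0 ; bottom = λ _ _ → refl ; hi = 0 ; top = λ _ _ → refl ; step = λ _ → refl }

cumulative-δ : ∀ k → Cumulative (λ t → ⟦ k ℤ.≟ t ⟧) (λ t → ⟦ k ℤ.≤? t ⟧) 1ℤ
cumulative-δ k = record
  { lo = ∣ k ∣ ; bottom = λ t t< → ⟦⟧-false (k ℤ.≤? t) (λ k≤t → ℕ.<-irrefl refl (bot k (ℤ.≤-<-trans k≤t t<)))
  ; hi = ∣ k ∣ ; top = λ t ≤t → ⟦⟧-true (k ℤ.≤? t) (ℤ.≤-trans (i≤∣i∣ k) ≤t)
  ; step = st }
  where
  bot : ∀ k → k < - + ∣ k ∣ → ∣ k ∣ ℕ.< ∣ k ∣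
  bot k = <-⇒< k
  st : ∀ t → ⟦ k ℤ.≤? t ⟧ ≡ ⟦ k ℤ.≤? (t - 1ℤ) ⟧ + ⟦ k ℤ.≟ t ⟧
  st t with k ℤ.≟ t
  ... | yes refl = trans (⟦⟧-true (k ℤ.≤? k) ℤ.≤-refl)
                     (cong (_+ 1ℤ) (sym (⟦⟧-false (k ℤ.≤? (k - 1ℤ)) (ℤ.<⇒≱ (k-1<k k)))))
  ... | no k≢t = trans (⟦⟧-cong (k ℤ.≤? t) (k ℤ.≤? (t - 1ℤ))
                    (λ k≤t → <→≤-1 (ℤ.≤∧≢⇒< k≤t k≢t)) (λ p → ℤ.<⇒≤ (≤-1→< p))) (sym (ℤ.+-identityʳ _))

-- The partial sums vanish at one end, so 0 may serve as the default value of max and min;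
-- outside of [-N , N] they take no further values.
max-sum≤ min-sum≥ : (ℤ → ℤ) → ℕ → ℤ
max-sum≤ y N = max 0ℤ (map (sum≤ y N) (interval N))
min-sum≥ y N = min 0ℤ (map (sum≥ y N) (interval N))

-- The endpoints of [-N , N] serve as default values.  They are harmless provided that the
-- extremal value of the partial sums is not 0: then it is attained inside of [-N , N] only
-- (or also beyond one endpoint, in which case it is attained at this endpoint).
first-max last-min : (ℤ → ℤ) → ℕ → ℤ
first-max y N = min (+ N) (filter (λ k → max-sum≤ y N ℤ.≟ sum≤ y N k) (interval N))
last-min y N = max (- + N) (filter (λ k → (- min-sum≥ y N) ℤ.≟ (- sum≥ y N k)) (interval N))

IsMax : (ℤ → ℤ) → ℤ → Set
IsMax H v = (∀ k → H k ≤ v) × ∃ λ k → H k ≡ v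

IsMax-unique : ∀ {H v w} → IsMax H v → IsMax H w → v ≡ w
IsMax-unique (H≤v , k , refl) (H≤w , l , refl) = ℤ.≤-antisym (H≤w k) (H≤v l)

IsFirst IsLast : (ℤ → ℤ) → ℤ → ℤ → Set
IsFirst H v k = H k ≡ v × (∀ l → H l ≡ v → k ≤ l)
IsLast H v k = H k ≡ v × (∀ l → H l ≡ v → l ≤ k)

IsFirst-unique : ∀ {H v k l} → IsFirst H v k → IsFirst H v l → k ≡ l
IsFirst-unique (p , q) (p′ , q′) = ℤ.≤-antisym (q _ p′) (q′ _ p)

IsLast-unique : ∀ {H v k l} → IsLast H v k → IsLast H v l → k ≡ l
IsLast-unique (p , q) (p′ , q′) = ℤ.≤-antisym (q′ _ p) (q _ p′)

IsMax-cong : ∀ {H H′ v v′} → H ≗ H′ → IsMax H v → IsMax H′ v′ → v ≡ v′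
IsMax-cong {v = v} eq p (bound , k , hit) =
  IsMax-unique p ((λ t → subst (_≤ _) (sym (eq t)) (bound t)) , k , trans (eq k) hit)

IsFirst-cong : ∀ {H H′ v v′ k k′} → H ≗ H′ → v ≡ v′ → IsFirst H v k → IsFirst H′ v′ k′ → k ≡ k′
IsFirst-cong eq refl p (hit , least) =
  IsFirst-unique p (trans (eq _) hit , λ l hit′ → least l (trans (sym (eq l)) hit′))

IsLast-cong : ∀ {H H′ v v′ k k′} → H ≗ H′ → v ≡ v′ → IsLast H v k → IsLast H′ v′ k′ → k ≡ k′
IsLast-cong eq refl p (hit , greatest) =
  IsLast-unique p (trans (eq _) hit , λ l hit′ → greatest l (trans (sym (eq l)) hit′))

locate : ∀ N k → k ∈ interval N ⊎ (+ N < k ⊎ k < - + N)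
locate N k with ∣ k ∣ ℕ.≤? N
locate N k | yes p = inj₁ (∈-interval⁺ k p)
locate N (+ a) | no p = inj₂ (inj₁ (ℤ.+<+ (ℕ.≰⇒> p)))
locate zero -[1+ a ] | no p = inj₂ (inj₂ ℤ.-<+)
locate (suc N) -[1+ a ] | no p = inj₂ (inj₂ (ℤ.-<- (ℕ.≤-pred (ℕ.≰⇒> p))))

+N∈ : ∀ N → + N ∈ interval N
+N∈ N = ∈-interval⁺ (+ N) ℕ.≤-refl

-N∈ : ∀ N → - + N ∈ interval N
-N∈ N = ∈-interval⁺ (- + N) (ℕ.≤-reflexive (ℤ.∣-i∣≡∣i∣ (+ N)))

-- Extrema over the list W = interval N of functions on ℤ constant beyond both endpoints
module Extrema
  (N : ℕ) (W : List ℤ) (locate : ∀ k → k ∈ W ⊎ (+ N < k ⊎ k < - + N))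
  (+N∈W : + N ∈ W) (-N∈W : - + N ∈ W) (v : ℤ)
  where

  module Max (H : ℤ → ℤ) (bottom : ∀ k → k < - + N → H k ≡ 0ℤ) (top : ∀ k → + N ≤ k → H k ≡ v) where

    φ : ℤ
    φ = max 0ℤ (map H W)

    inside : ∀ {k} → k ∈ W → H k ≤ φ
    inside k∈ = lookup (xs≤max 0ℤ (map H W)) (∈-map⁺ H k∈)

    bound : ∀ k → H k ≤ φ
    bound k with locate k
    ... | inj₁ k∈ = inside k∈
    ... | inj₂ (inj₁ N<k) = subst (_≤ φ)
            (trans (top (+ N) ℤ.≤-refl) (sym (top k (ℤ.<⇒≤ N<k)))) (inside +N∈W)
    ... | inj₂ (inj₂ k<-N) = subst (_≤ φ) (sym (bottom k k<-N)) (⊥≤max 0ℤ (map H W))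

    attained : ∃ λ k → H k ≡ φ
    attained = [ (λ eq → - + N - 1ℤ , trans (bottom _ (k-1<k (- + N))) (sym eq))
               , (λ ∈xs → let k , _ , eq = ∈-map⁻ H ∈xs in k , sym eq) ]′ (argmax-sel id 0ℤ (map H W))

    isMax : IsMax H φ
    isMax = bound , attained

    P? : Decidable (λ k → φ ≡ H k)
    P? k = φ ℤ.≟ H k

    first : ℤ
    first = min (+ N) (filter P? W)

    module _ (φ≢0 : φ ≢ 0ℤ) where
      least : ∀ l → H l ≡ φ → first ≤ l
      least l eq with locate l
      ... | inj₁ l∈ = lookup (min≤xs (+ N) (filter P? W)) (∈-filter⁺ P? l∈ (sym eq))
      ... | inj₂ (inj₁ N<l) = ℤ.≤-trans (min≤⊤ (+ N) (filter P? W)) (ℤ.<⇒≤ N<l)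
      ... | inj₂ (inj₂ l<-N) = ⊥-elim (φ≢0 (trans (sym eq) (bottom l l<-N)))

      N-hit : first ≡ + N → H first ≡ φ
      N-hit eq = let l , l-hit = attained in
        trans (cong H eq) (trans (top (+ N) ℤ.≤-refl)
          (trans (sym (top l (subst (_≤ l) eq (least l l-hit)))) l-hit))

      isFirst : IsFirst H φ first
      isFirst = [ N-hit , (λ ∈xs → sym (proj₂ (∈-filter⁻ P? {xs = W} ∈xs))) ]′
                  (argmin-sel id (+ N) (filter P? W))
              , least

  module Min (U : ℤ → ℤ) (bottom : ∀ k → k ≤ - + N → U k ≡ v) (top : ∀ k → + N < k → U k ≡ 0ℤ) where

    μ : ℤ
    μ = min 0ℤ (map U W)

    inside : ∀ {k} → k ∈ W → μ ≤ U k
    inside k∈ = lookup (min≤xs 0ℤ (map U W)) (∈-map⁺ U k∈)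

    bound : ∀ k → μ ≤ U k
    bound k with locate k
    ... | inj₁ k∈ = inside k∈
    ... | inj₂ (inj₁ N<k) = subst (μ ≤_) (sym (top k N<k)) (min≤⊤ 0ℤ (map U W))
    ... | inj₂ (inj₂ k<-N) = subst (μ ≤_)
            (trans (bottom (- + N) ℤ.≤-refl) (sym (bottom k (ℤ.<⇒≤ k<-N)))) (inside -N∈W)

    attained : ∃ λ k → U k ≡ μ
    attained = [ (λ eq → + N + 1ℤ , trans (top _ (≤→<+1 ℤ.≤-refl)) (sym eq))
               , (λ ∈xs → let k , _ , eq = ∈-map⁻ U ∈xs in k , sym eq) ]′ (argmin-sel id 0ℤ (map U W))

    isMax : IsMax (λ k → - U k) (- μ)
    isMax = (λ k → ℤ.neg-mono-≤ (bound k)) , proj₁ attained , cong -_ (proj₂ attained)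

    P? : Decidable (λ k → - μ ≡ - U k)
    P? k = (- μ) ℤ.≟ (- U k)

    last : ℤ
    last = max (- + N) (filter P? W)

    module _ (μ≢0 : - μ ≢ 0ℤ) where
      greatest : ∀ l → - U l ≡ - μ → l ≤ last
      greatest l eq with locate l
      ... | inj₁ l∈ = lookup (xs≤max (- + N) (filter P? W)) (∈-filter⁺ P? l∈ (sym eq))
      ... | inj₂ (inj₁ N<l) = ⊥-elim (μ≢0 (trans (sym eq) (cong -_ (top l N<l))))
      ... | inj₂ (inj₂ l<-N) = ℤ.≤-trans (ℤ.<⇒≤ l<-N) (⊥≤max (- + N) (filter P? W))

      -N-hit : last ≡ - + N → - U last ≡ - μ
      -N-hit eq = let l , l-hit = attained in
        cong -_ (trans (cong U eq) (trans (bottom (- + N) ℤ.≤-refl)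
          (trans (sym (bottom l (subst (l ≤_) eq (greatest l (cong -_ l-hit))))) l-hit)))

      isLast : IsLast (λ k → - U k) (- μ) last
      isLast = [ -N-hit , (λ ∈xs → sym (proj₂ (∈-filter⁻ P? {xs = W} ∈xs))) ]′
                 (argmax-sel id (- + N) (filter P? W))
             , greatest

-- Maxima of H versus those of k ↦ H (k - 1) - v
module Shift {H U : ℤ → ℤ} {v : ℤ} (U≡ : ∀ k → - U k ≡ H (k - 1ℤ) - v) {φ ε : ℤ}
  (φ-max : IsMax H φ) (ε-max : IsMax (λ k → - U k) ε) where

  lem : ∀ a → (a + 1ℤ) - 1ℤ ≡ a
  lem = solve-∀
  lem₂ : ∀ a l → (a - 1ℤ) - l ≡ a - (l + 1ℤ)
  lem₂ = solve-∀
  lem₃ : ∀ a t → a ≡ (a - t) + t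
  lem₃ = solve-∀

  -U+1 : ∀ l → - U (l + 1ℤ) ≡ H l - v
  -U+1 l = trans (U≡ (l + 1ℤ)) (cong (λ z → H z - v) (lem l))

  ε≡ : ε ≡ φ - v
  ε≡ = IsMax-unique ε-max
    ( (λ k → subst (_≤ φ - v) (sym (U≡ k)) (ℤ.+-monoˡ-≤ (- v) (proj₁ φ-max (k - 1ℤ))))
    , proj₁ (proj₂ φ-max) + 1ℤ , trans (-U+1 _) (cong (_- v) (proj₂ (proj₂ φ-max))) )

  cancel : ∀ {a b} → a - v ≡ b - v → a ≡ b
  cancel {a} {b} eq = trans (lem₃ a v) (trans (cong (_+ v) eq) (sym (lem₃ b v)))

  isLast-1 : ∀ {k} → IsLast (λ k → - U k) ε k → IsLast H φ (k - 1ℤ)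
  isLast-1 {k} (hit , greatest) =
    cancel (trans (sym (U≡ k)) (trans hit ε≡)) ,
    λ l eq → ≤-by (greatest (l + 1ℤ) (trans (-U+1 l) (trans (cong (_- v) eq) (sym ε≡)))) (lem₂ k l)

module Change {H H′ : ℤ → ℤ} {k : ℤ}
  (H-change : ∀ t → H′ t ≡ H t + (⟦ k ℤ.≤? t ⟧ + ⟦ (k + 1ℤ) ℤ.≤? t ⟧))
  {φ φ′ : ℤ} (φ-max : IsMax H φ) (φ′-max : IsMax H′ φ′) where

  at-k : H′ k ≡ H k + 1ℤ
  at-k = trans (H-change k) (cong (λ z → H k + z) (cong₂ _+_
    (⟦⟧-true (k ℤ.≤? k) ℤ.≤-refl) (⟦⟧-false ((k + 1ℤ) ℤ.≤? k) (ℤ.<⇒≱ (≤→<+1 ℤ.≤-refl)))))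

  before-k : ∀ t → t < k → H′ t ≡ H t
  before-k t t<k = trans (H-change t) (trans (cong (λ z → H t + z) (cong₂ _+_
    (⟦⟧-false (k ℤ.≤? t) (ℤ.<⇒≱ t<k)) (⟦⟧-false ((k + 1ℤ) ℤ.≤? t) (ℤ.<⇒≱ (ℤ.<-trans t<k (≤→<+1 ℤ.≤-refl))))))
    (ℤ.+-identityʳ _))

  after-k : ∀ t → k < t → H′ t ≡ H t + (1ℤ + 1ℤ)
  after-k t k<t = trans (H-change t) (cong (λ z → H t + z) (cong₂ _+_
    (⟦⟧-true (k ℤ.≤? t) (ℤ.<⇒≤ k<t)) (⟦⟧-true ((k + 1ℤ) ℤ.≤? t) (subst (_≤ t) (ℤ.+-comm 1ℤ k) (<→ k<t)))))

  compare : ∀ t → t < k ⊎ (t ≡ k ⊎ k < t)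
  compare t with t ℤ.≟ k | t ℤ.≤? k
  ... | yes eq | _ = inj₂ (inj₁ eq)
  ... | no ne | yes le = inj₁ (ℤ.≤∧≢⇒< le ne)
  ... | no ne | no nle = inj₂ (inj₂ (ℤ.≰⇒> nle))

  +1-cancel : ∀ {a b} → a + 1ℤ ≡ b → a ≡ b - 1ℤ
  +1-cancel {a} refl = lem a
    where lem : ∀ a → a ≡ (a + 1ℤ) - 1ℤ
          lem = solve-∀

  a+2-1 : ∀ a → (a + (1ℤ + 1ℤ)) - 1ℤ ≡ a + 1ℤ
  a+2-1 = solve-∀

  two : ∀ a b → (b - 1ℤ) - (a + 1ℤ) ≡ b - (a + (1ℤ + 1ℤ))
  two = solve-∀

  -- k is the last maximum of H  iff  k is the first maximum of H′
  last⇒first : IsLast (H) (φ) k →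
               φ′ ≡ φ + 1ℤ × IsFirst (H′) (φ′) k
  last⇒first (hit , greatest) = φ-eq , trans at-k (trans (cong (_+ 1ℤ) hit) (sym φ-eq)) , least
    where
    H≤φ = proj₁ φ-max
    bound : ∀ t → H′ t ≤ φ + 1ℤ
    bound t with compare t
    ... | inj₁ t<k = ℤ.≤-trans (ℤ.≤-reflexive (before-k t t<k)) (ℤ.<⇒≤ (≤→<+1 (H≤φ t)))
    ... | inj₂ (inj₁ refl) = ℤ.≤-reflexive (trans at-k (cong (_+ 1ℤ) hit))
    ... | inj₂ (inj₂ k<t) = ≤-by (<→≤-1 H<φ) (trans (cong (λ z → (φ + 1ℤ) - z) (after-k t k<t)) (lem φ (H t)))
      where
      H<φ : H t < φ
      H<φ = ℤ.≤∧≢⇒< (H≤φ t) (λ eq → ℤ.<⇒≱ k<t (greatest t eq))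
      lem : ∀ φ a → (φ + 1ℤ) - (a + (1ℤ + 1ℤ)) ≡ (φ - 1ℤ) - a
      lem = solve-∀
    φ-eq : φ′ ≡ φ + 1ℤ
    φ-eq = IsMax-unique φ′-max (bound , k , trans at-k (cong (_+ 1ℤ) hit))
    least : ∀ l → H′ l ≡ φ′ → k ≤ l
    least l eq with k ℤ.≤? l
    ... | yes k≤l = k≤l
    ... | no k≰l = ⊥-elim (ℤ.<⇒≱ (≤→<+1 (H≤φ l)) (ℤ.≤-reflexive
            (trans (sym φ-eq) (trans (sym eq) (before-k l (ℤ.≰⇒> k≰l))))))

  first⇒last : IsFirst (H′) (φ′) k →
               φ ≡ φ′ - 1ℤ × IsLast (H) (φ) k
  first⇒last (hit , least) = φ-eq , trans (+1-cancel (trans (sym at-k) hit)) (sym φ-eq) , greatest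
    where
    H′≤φ′ = proj₁ φ′-max
    strictly-after : ∀ t → k < t → H t + 1ℤ ≤ φ′ - 1ℤ
    strictly-after t k<t = ≤-by (H′≤φ′ t)
      (trans (two (H t) φ′) (cong (λ z → φ′ - z) (sym (after-k t k<t))))
    bound : ∀ t → H t ≤ φ′ - 1ℤ
    bound t with compare t
    ... | inj₁ t<k = <→≤-1 (subst (_< φ′) (before-k t t<k)
            (ℤ.≤∧≢⇒< (H′≤φ′ t) (λ eq → ℤ.<⇒≱ t<k (least t eq))))
    ... | inj₂ (inj₁ refl) = ℤ.≤-reflexive (+1-cancel (trans (sym at-k) hit))
    ... | inj₂ (inj₂ k<t) = ℤ.≤-trans (ℤ.<⇒≤ (≤→<+1 ℤ.≤-refl)) (strictly-after t k<t)
    φ-eq : φ ≡ φ′ - 1ℤ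
    φ-eq = IsMax-unique φ-max (bound , k , +1-cancel (trans (sym at-k) hit))
    greatest : ∀ l → H l ≡ φ → l ≤ k
    greatest l eq with l ℤ.≤? k
    ... | yes l≤k = l≤k
    ... | no l≰k = ⊥-elim (ℤ.<⇒≱ (≤→<+1 (ℤ.≤-reflexive (sym (trans eq φ-eq)))) (strictly-after l (ℤ.≰⇒> l≰k)))

module _ {y N} (van : VanishesBeyond N y) where

  sum≥-bottom : ∀ k → k ≤ - + N → sum≥ y N k ≡ total y N
  sum≥-bottom k k≤-N = trans (sym (ℤ.+-identityˡ _)) (trans
    (cong (_+ sum≥ y N k) (sym (sum≤-bottom van (k - 1ℤ) (ℤ.<-≤-trans (k-1<k k) k≤-N)))) (sum≤+sum≥ van k))

  private
    module E = Extrema N (interval N) (locate N) (+N∈ N) (-N∈ N) (total y N)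
    module EMax = E.Max (sum≤ y N) (sum≤-bottom van) (sum≤-top van)
    module EMin = E.Min (sum≥ y N) sum≥-bottom (sum≥-top van)

  max-sum≤-isMax : IsMax (sum≤ y N) (max-sum≤ y N)
  max-sum≤-isMax = EMax.isMax

  min-sum≥-isMax : IsMax (λ k → - sum≥ y N k) (- min-sum≥ y N)
  min-sum≥-isMax = EMin.isMax

  first-max-isFirst : max-sum≤ y N ≢ 0ℤ → IsFirst (sum≤ y N) (max-sum≤ y N) (first-max y N)
  first-max-isFirst = EMax.isFirst

  last-min-isLast : - min-sum≥ y N ≢ 0ℤ →
                    IsLast (λ k → - sum≥ y N k) (- min-sum≥ y N) (last-min y N)
  last-min-isLast = EMin.isLast

  private
    module S = Shift {sum≤ y N} {sum≥ y N} {total y N} (-sum≥ van) max-sum≤-isMax min-sum≥-isMax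

  ε≡φ-total : - min-sum≥ y N ≡ max-sum≤ y N - total y N
  ε≡φ-total = S.ε≡

  last-min-1 : - min-sum≥ y N ≢ 0ℤ → IsLast (sum≤ y N) (max-sum≤ y N) (last-min y N - 1ℤ)
  last-min-1 ε≢0 = S.isLast-1 {last-min y N} (last-min-isLast ε≢0)

  0≤max-sum≤ : 0ℤ ≤ max-sum≤ y N
  0≤max-sum≤ = ⊥≤max 0ℤ (map (sum≤ y N) (interval N))

  0≤ε : 0ℤ ≤ - min-sum≥ y N
  0≤ε = ℤ.neg-mono-≤ (min≤⊤ 0ℤ (map (sum≥ y N) (interval N)))

module _ {y y′ N N′} (van : VanishesBeyond N y) (van′ : VanishesBeyond N′ y′) where

  module _ (y≗y′ : y ≗ y′) where
    sum≤-cong : sum≤ y N ≗ sum≤ y′ N′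
    sum≤-cong = cumulative-unique y≗y′ (cumulative van) (cumulative van′)

    total-cong : total y N ≡ total y′ N′
    total-cong = total-unique y≗y′ (cumulative van) (cumulative van′)

    max-sum≤-cong : max-sum≤ y N ≡ max-sum≤ y′ N′
    max-sum≤-cong = IsMax-cong sum≤-cong (max-sum≤-isMax van) (max-sum≤-isMax van′)

    min-sum≥-cong : - min-sum≥ y N ≡ - min-sum≥ y′ N′
    min-sum≥-cong = trans (ε≡φ-total van) (trans (cong₂ _-_ max-sum≤-cong total-cong) (sym (ε≡φ-total van′)))

    first-max-cong : max-sum≤ y N ≢ 0ℤ → first-max y N ≡ first-max y′ N′
    first-max-cong φ≢0 = IsFirst-cong sum≤-cong max-sum≤-cong
      (first-max-isFirst van φ≢0) (first-max-isFirst van′ (φ≢0 ∘ trans max-sum≤-cong))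

    last-min-cong : - min-sum≥ y N ≢ 0ℤ → last-min y N - 1ℤ ≡ last-min y′ N′ - 1ℤ
    last-min-cong ε≢0 = IsLast-cong sum≤-cong max-sum≤-cong
      (last-min-1 van ε≢0) (last-min-1 van′ (ε≢0 ∘ trans min-sum≥-cong))

  module _ {k} (change : ∀ t → y′ t ≡ y t + (⟦ k ℤ.≟ t ⟧ + ⟦ (k + 1ℤ) ℤ.≟ t ⟧)) where

    sum≤-change : ∀ t → sum≤ y′ N′ t ≡ sum≤ y N t + (⟦ k ℤ.≤? t ⟧ + ⟦ (k + 1ℤ) ℤ.≤? t ⟧)
    sum≤-change = cumulative-unique change (cumulative van′)
      (cumulative-+ (cumulative van) (cumulative-+ (cumulative-δ k) (cumulative-δ (k + 1ℤ))))

    total-change : total y′ N′ ≡ total y N + (1ℤ + 1ℤ)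
    total-change = total-unique change (cumulative van′)
      (cumulative-+ (cumulative van) (cumulative-+ (cumulative-δ k) (cumulative-δ (k + 1ℤ))))

    private
      module Ch = Change {sum≤ y N} {sum≤ y′ N′} {k} sum≤-change (max-sum≤-isMax van) (max-sum≤-isMax van′)

    last⇒first : IsLast (sum≤ y N) (max-sum≤ y N) k →
                 max-sum≤ y′ N′ ≡ max-sum≤ y N + 1ℤ × IsFirst (sum≤ y′ N′) (max-sum≤ y′ N′) k
    last⇒first = Ch.last⇒first

    first⇒last : IsFirst (sum≤ y′ N′) (max-sum≤ y′ N′) k →
                 max-sum≤ y N ≡ max-sum≤ y′ N′ - 1ℤ × IsLast (sum≤ y N) (max-sum≤ y N) k
    first⇒last = Ch.first⇒last

sumᶻ : ∀ {k} → (Fin k → ℤ) → ℤ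
sumᶻ = Vector.foldr _+_ 0ℤ

sumᴺ : ∀ {k} → (Fin k → ℕ) → ℕ
sumᴺ = Vector.foldr ℕ._+_ 0

sumᶻ-pick : ∀ {k} (c : Fin k → ℤ) j → (∀ i → i ≢ j → c i ≡ 0ℤ) → sumᶻ c ≡ c j
sumᶻ-pick c zero off = trans (cong (λ z → c zero + z) (zeros (c ∘ suc) (λ i → off (suc i) (λ ())))) (ℤ.+-identityʳ _)
  where
  zeros : ∀ {k} (c : Fin k → ℤ) → (∀ i → c i ≡ 0ℤ) → sumᶻ c ≡ 0ℤ
  zeros {zero} c eq = refl
  zeros {suc k} c eq = cong₂ _+_ (eq zero) (zeros (c ∘ suc) (eq ∘ suc))
sumᶻ-pick c (suc j) off = trans (cong₂ _+_ (off zero (λ ())) (sumᶻ-pick (c ∘ suc) j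
  (λ i i≢j → off (suc i) (i≢j ∘ Fin.suc-injective)))) (ℤ.+-identityˡ _)

sumᶻ-+ : ∀ {k} (c d : Fin k → ℤ) → sumᶻ (λ i → c i + d i) ≡ sumᶻ c + sumᶻ d
sumᶻ-+ {zero} c d = refl
sumᶻ-+ {suc k} c d = trans (cong (λ z → c zero + d zero + z) (sumᶻ-+ (c ∘ suc) (d ∘ suc))) (lem (c zero) (d zero) _ _)
  where
  lem : ∀ a b c d → a + b + (c + d) ≡ a + c + (b + d)
  lem = solve-∀

sumᶻ-cong : ∀ {k} {c d : Fin k → ℤ} → c ≗ d → sumᶻ c ≡ sumᶻ d
sumᶻ-cong {zero} eq = refl
sumᶻ-cong {suc k} eq = cong₂ _+_ (eq zero) (sumᶻ-cong (eq ∘ suc))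

pos-sum : ∀ {k} (c : Fin k → ℕ) → + sumᴺ c ≡ sumᶻ (+_ ∘ c)
pos-sum {zero} c = refl
pos-sum {suc k} c = trans (ℤ.pos-+ (c zero) (sumᴺ (c ∘ suc))) (cong (λ z → + c zero + z) (pos-sum (c ∘ suc)))

module Affine (n : ℕ) (3≤n : 3 ℕ.≤ n) where

  I : Set
  I = Fin n

  instance
    n≢0 : NonZero n
    n≢0 = ℕ.>-nonZero (ℕ.≤-trans (s≤s z≤n) 3≤n)

  infix 9 _⁺ _⁻

  _⁺ _⁻ : I → I
  i ⁺ = suc (toℕ i) mod n
  i ⁻ = (toℕ i ℕ.+ ℕ.pred n) mod n

  private
    toℕ-mod : ∀ a → toℕ (a mod n) ≡ a % n
    toℕ-mod a = Fin.toℕ-fromℕ< _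

    idem : ∀ a b → (a % n ℕ.+ b) % n ≡ (a ℕ.+ b) % n
    idem a b = trans (%-distribˡ-+ (a % n) b n)
      (trans (cong (λ z → (z ℕ.+ b % n) % n) (m%n%n≡m%n a n)) (sym (%-distribˡ-+ a b n)))

    back : ∀ (i : I) → (toℕ i ℕ.+ n) % n ≡ toℕ i
    back i = trans ([m+n]%n≡m%n (toℕ i) n) (m<n⇒m%n≡m (Fin.toℕ<n i))

  ⁺⁻ : ∀ i → i ⁺ ⁻ ≡ i
  ⁺⁻ i = Fin.toℕ-injective (begin
    toℕ (i ⁺ ⁻)                                   ≡⟨ toℕ-mod (toℕ (i ⁺) ℕ.+ ℕ.pred n) ⟩
    (toℕ (i ⁺) ℕ.+ ℕ.pred n) % n                   ≡⟨ cong (λ z → (z ℕ.+ ℕ.pred n) % n) (toℕ-mod (suc (toℕ i))) ⟩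
    (suc (toℕ i) % n ℕ.+ ℕ.pred n) % n             ≡⟨ idem (suc (toℕ i)) (ℕ.pred n) ⟩
    (suc (toℕ i) ℕ.+ ℕ.pred n) % n                 ≡⟨ cong (_% n) (sym (ℕ.+-suc (toℕ i) (ℕ.pred n))) ⟩
    (toℕ i ℕ.+ suc (ℕ.pred n)) % n                 ≡⟨ cong (λ z → (toℕ i ℕ.+ z) % n) (ℕ.suc-pred n) ⟩
    (toℕ i ℕ.+ n) % n                              ≡⟨ back i ⟩
    toℕ i                                         ∎)
    where open ≡-Reasoning

  ⁻⁺ : ∀ i → i ⁻ ⁺ ≡ i
  ⁻⁺ i = Fin.toℕ-injective (begin
    toℕ (i ⁻ ⁺)                                   ≡⟨ toℕ-mod (suc (toℕ (i ⁻))) ⟩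
    suc (toℕ (i ⁻)) % n                           ≡⟨ cong (λ z → suc z % n) (toℕ-mod (toℕ i ℕ.+ ℕ.pred n)) ⟩
    (1 ℕ.+ (toℕ i ℕ.+ ℕ.pred n) % n) % n           ≡⟨ cong (_% n) (ℕ.+-comm 1 _) ⟩
    ((toℕ i ℕ.+ ℕ.pred n) % n ℕ.+ 1) % n           ≡⟨ idem (toℕ i ℕ.+ ℕ.pred n) 1 ⟩
    (toℕ i ℕ.+ ℕ.pred n ℕ.+ 1) % n                 ≡⟨ cong (_% n) (ℕ.+-comm _ 1) ⟩
    (suc (toℕ i ℕ.+ ℕ.pred n)) % n                 ≡⟨ cong (_% n) (sym (ℕ.+-suc (toℕ i) (ℕ.pred n))) ⟩
    (toℕ i ℕ.+ suc (ℕ.pred n)) % n                 ≡⟨ cong (λ z → (toℕ i ℕ.+ z) % n) (ℕ.suc-pred n) ⟩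
    (toℕ i ℕ.+ n) % n                              ≡⟨ back i ⟩
    toℕ i                                         ∎)
    where open ≡-Reasoning

  ⁺-≢ : ∀ i → i ⁺ ≢ i
  ⁺-≢ i eq with suc (toℕ i) ℕ.<? n
  ... | yes lt = ℕ.1+n≢n (trans (sym (trans (toℕ-mod _) (m<n⇒m%n≡m lt))) (cong toℕ eq))
  ... | no nlt = ℕ.<-irrefl (trans (sym (n%n≡0 n)) (trans (cong (_% n) (sym last))
                   (trans (sym (toℕ-mod (suc (toℕ i)))) (cong toℕ eq))))
                   (ℕ.<-≤-trans (s≤s z≤n) (ℕ.≤-pred (subst (2 ℕ.<_) (sym last) 3≤n)))
    where
    last : suc (toℕ i) ≡ n
    last = ℕ.≤-antisym (Fin.toℕ<n i) (ℕ.≮⇒≥ nlt)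

  ⁻-≢ : ∀ i → i ⁻ ≢ i
  ⁻-≢ i eq = ⁺-≢ i (trans (cong _⁺ (sym eq)) (⁻⁺ i))

  -- Coefficients on the fundamental weights; weights are taken modulo the null root.
  Weight : Set
  Weight = I → ℤ

  ⟨h_,_⟩ : I → Weight → ℤ
  ⟨h i , w ⟩ = w i

  α : I → Weight
  α i j = + 2 * ⟦ i Fin.≟ j ⟧ - ⟦ i ⁻ Fin.≟ j ⟧ - ⟦ i ⁺ Fin.≟ j ⟧

  record Crystal : Set₁ where
    field
      setoid : Setoid 0ℓ 0ℓ

    open Setoid setoid public
      renaming (refl to ≈-refl; sym to ≈-sym; trans to ≈-trans)
      using (Carrier; _≈_)

    infix 4 _≈₀_

    -- on B ⊔ {0}, with 0 rendered as nothing
    _≈₀_ : Maybe Carrier → Maybe Carrier → Set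
    _≈₀_ = Pointwise _≈_

    field
      e f : I → Carrier → Maybe Carrier
      ε φ : I → Carrier → ℤ
      wt  : Carrier → Weight

      e-cong  : ∀ i {b c} → b ≈ c → e i b ≈₀ e i c
      f-cong  : ∀ i {b c} → b ≈ c → f i b ≈₀ f i c
      ε-cong  : ∀ i {b c} → b ≈ c → ε i b ≡ ε i c
      φ-cong  : ∀ i {b c} → b ≈ c → φ i b ≡ φ i c
      wt-cong : ∀ {b c} → b ≈ c → wt b ≗ wt c

      φ≡ε+h : ∀ i b → φ i b ≡ ε i b + ⟨h i , wt b ⟩
      wt-e  : ∀ i {b c} → e i b ≈₀ just c → ∀ j → wt c j ≡ wt b j + α i j
      ε-e   : ∀ i {b c} → e i b ≈₀ just c → ε i c ≡ ε i b - 1ℤ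
      φ-e   : ∀ i {b c} → e i b ≈₀ just c → φ i c ≡ φ i b + 1ℤ
      e⇔f   : ∀ i {b c} → e i b ≈₀ just c ⇔ f i c ≈₀ just b

    private
      +α : ∀ a b c → a ≡ b + c → b ≡ a - c
      +α .(b + c) b c refl = lem b c
        where lem : ∀ b c → b ≡ b + c - c
              lem = solve-∀

      -1+1 : ∀ {a b} → a ≡ b - 1ℤ → b ≡ a + 1ℤ
      -1+1 {.(b - 1ℤ)} {b} refl = lem b
        where lem : ∀ b → b ≡ b - 1ℤ + 1ℤ
              lem = solve-∀

    wt-f : ∀ i {b c} → f i b ≈₀ just c → ∀ j → wt c j ≡ wt b j - α i j
    wt-f i {b} {c} fb j = +α (wt b j) (wt c j) (α i j) (wt-e i (Equivalence.from (e⇔f i) fb) j)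

    ε-f : ∀ i {b c} → f i b ≈₀ just c → ε i c ≡ ε i b + 1ℤ
    ε-f i fb = -1+1 (ε-e i (Equivalence.from (e⇔f i) fb))

    φ-f : ∀ i {b c} → f i b ≈₀ just c → φ i c ≡ φ i b - 1ℤ
    φ-f i {b} {c} fb = +α (φ i b) (φ i c) 1ℤ (φ-e i (Equivalence.from (e⇔f i) fb))

    h≡φ-ε : ∀ i b → ⟨h i , wt b ⟩ ≡ φ i b - ε i b
    h≡φ-ε i b = trans (lem (ε i b) (wt b i)) (cong (_- ε i b) (sym (φ≡ε+h i b)))
      where lem : ∀ a b → b ≡ (a + b) - a
            lem = solve-∀

    h-e : ∀ i {b c} → e i b ≈₀ just c → ⟨h i , wt c ⟩ ≡ ⟨h i , wt b ⟩ + + 2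
    h-e i {b} {c} eb = trans (h≡φ-ε i c) (trans (cong₂ _-_ (φ-e i eb) (ε-e i eb))
      (trans (lem (φ i b) (ε i b)) (cong (λ z → z + + 2) (sym (h≡φ-ε i b)))))
      where lem : ∀ a b → (a + 1ℤ) - (b - 1ℤ) ≡ (a - b) + + 2
            lem = solve-∀

  record IsIsomorphism (B C : Crystal) (F : Crystal.Carrier B → Crystal.Carrier C) : Set where
    private
      module B = Crystal B
      module C = Crystal C
    field
      isBijection : IsBijection B._≈_ C._≈_ F
      wt-preserved : ∀ b → C.wt (F b) ≗ B.wt b
      ε-preserved  : ∀ i b → C.ε i (F b) ≡ B.ε i b
      φ-preserved  : ∀ i b → C.φ i (F b) ≡ B.φ i b
      e-commutes   : ∀ i b → C.e i (F b) C.≈₀ Maybe.map F (B.e i b)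
      f-commutes   : ∀ i b → C.f i (F b) C.≈₀ Maybe.map F (B.f i b)

  infixr 5 _⊗_

  _⊗_ : Crystal → Crystal → Crystal
  B₂ ⊗ B₁ = record
    { setoid = ×-setoid B₂.setoid B₁.setoid
    ; e = e ; f = f ; ε = ε ; φ = φ ; wt = wt
    ; e-cong = e-cong ; f-cong = f-cong ; ε-cong = ε-cong ; φ-cong = φ-cong ; wt-cong = wt-cong
    ; φ≡ε+h = φ≡ε+h ; wt-e = wt-e ; ε-e = ε-e
    ; φ-e = φ-e
    ; e⇔f = λ i → mk⇔ (λ eb → f-intro i (Sum.map (e₂⇒f₂ i) (e₁⇒f₁ i) (e-elim i eb)))
                       (λ fb → e-intro i (Sum.map (f₂⇒e₂ i) (f₁⇒e₁ i) (f-elim i fb)))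
    }
    module Tensor where
    module B₁ = Crystal B₁
    module B₂ = Crystal B₂

    Carrier : Set
    Carrier = B₂.Carrier × B₁.Carrier

    e f : I → Carrier → Maybe Carrier
    e i (b₂ , b₁) = if does (B₁.φ i b₁ ℤ.<? B₂.ε i b₂)
      then Maybe.map (_, b₁) (B₂.e i b₂) else Maybe.map (b₂ ,_) (B₁.e i b₁)
    f i (b₂ , b₁) = if does (B₁.φ i b₁ ℤ.≤? B₂.ε i b₂)
      then Maybe.map (_, b₁) (B₂.f i b₂) else Maybe.map (b₂ ,_) (B₁.f i b₁)

    ε φ : I → Carrier → ℤ
    ε i (b₂ , b₁) = B₁.ε i b₁ ⊔ (B₂.ε i b₂ - ⟨h i , B₁.wt b₁ ⟩)
    φ i (b₂ , b₁) = B₂.φ i b₂ ⊔ (B₁.φ i b₁ + ⟨h i , B₂.wt b₂ ⟩)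

    wt : Carrier → Weight
    wt (b₂ , b₁) j = B₂.wt b₂ j + B₁.wt b₁ j

    _≈_ : Carrier → Carrier → Set
    _≈_ = Setoid._≈_ (×-setoid B₂.setoid B₁.setoid)

    _≈₀_ : Maybe Carrier → Maybe Carrier → Set
    _≈₀_ = Pointwise _≈_

    map-cong : ∀ {A B : Set} {R : A → A → Set} {S : B → B → Set} {g h : A → B} {x y} →
               (∀ {a b} → R a b → S (g a) (h b)) → Pointwise R x y → Pointwise S (Maybe.map g x) (Maybe.map h y)
    map-cong gh (just r) = just (gh r)
    map-cong gh nothing = nothing

    e-cong : ∀ i {b c} → b ≈ c → e i b ≈₀ e i c
    e-cong i {b₂ , b₁} {c₂ , c₁} (p₂ , p₁) rewrite B₁.φ-cong i p₁ | B₂.ε-cong i p₂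
      with B₁.φ i c₁ ℤ.<? B₂.ε i c₂
    ... | yes _ = map-cong (_, p₁) (B₂.e-cong i p₂)
    ... | no _ = map-cong (p₂ ,_) (B₁.e-cong i p₁)

    f-cong : ∀ i {b c} → b ≈ c → f i b ≈₀ f i c
    f-cong i {b₂ , b₁} {c₂ , c₁} (p₂ , p₁) rewrite B₁.φ-cong i p₁ | B₂.ε-cong i p₂
      with B₁.φ i c₁ ℤ.≤? B₂.ε i c₂
    ... | yes _ = map-cong (_, p₁) (B₂.f-cong i p₂)
    ... | no _ = map-cong (p₂ ,_) (B₁.f-cong i p₁)

    ε-cong : ∀ i {b c} → b ≈ c → ε i b ≡ ε i c
    ε-cong i (p₂ , p₁) = cong₂ _⊔_ (B₁.ε-cong i p₁) (cong₂ _-_ (B₂.ε-cong i p₂) (B₁.wt-cong p₁ i))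

    φ-cong : ∀ i {b c} → b ≈ c → φ i b ≡ φ i c
    φ-cong i (p₂ , p₁) = cong₂ _⊔_ (B₂.φ-cong i p₂) (cong₂ _+_ (B₁.φ-cong i p₁) (B₂.wt-cong p₂ i))

    wt-cong : ∀ {b c} → b ≈ c → wt b ≗ wt c
    wt-cong (p₂ , p₁) j = cong₂ _+_ (B₂.wt-cong p₂ j) (B₁.wt-cong p₁ j)

    φ≡ε+h : ∀ i b → φ i b ≡ ε i b + ⟨h i , wt b ⟩
    φ≡ε+h i (b₂ , b₁) = begin
      B₂.φ i b₂ ⊔ (B₁.φ i b₁ + w₂)                   ≡⟨ cong₂ _⊔_ (B₂.φ≡ε+h i b₂) (cong (_+ w₂) (B₁.φ≡ε+h i b₁)) ⟩
      (ε₂ + w₂) ⊔ (ε₁ + w₁ + w₂)                     ≡⟨ ℤ.⊔-comm (ε₂ + w₂) (ε₁ + w₁ + w₂) ⟩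
      (ε₁ + w₁ + w₂) ⊔ (ε₂ + w₂)                     ≡⟨ cong₂ _⊔_ (lem₁ ε₁ w₁ w₂) (lem₂ ε₂ w₁ w₂) ⟩
      (ε₁ + (w₂ + w₁)) ⊔ ((ε₂ - w₁) + (w₂ + w₁))       ≡⟨ ℤ.mono-≤-distrib-⊔ (ℤ.+-monoˡ-≤ (w₂ + w₁)) ε₁ (ε₂ - w₁) ⟨
      (ε₁ ⊔ (ε₂ - w₁)) + (w₂ + w₁)                    ∎
      where
      open ≡-Reasoning
      ε₁ = B₁.ε i b₁
      ε₂ = B₂.ε i b₂
      w₁ = B₁.wt b₁ i
      w₂ = B₂.wt b₂ i
      lem₁ : ∀ a b c → a + b + c ≡ a + (c + b)
      lem₁ = solve-∀
      lem₂ : ∀ a b c → a + c ≡ (a - b) + (c + b)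
      lem₂ = solve-∀

    E₁ E₂ F₁ F₂ : I → Carrier → Carrier → Set
    E₂ i (b₂ , b₁) (c₂ , c₁) = B₁.φ i b₁ < B₂.ε i b₂ × B₂.e i b₂ B₂.≈₀ just c₂ × b₁ B₁.≈ c₁
    E₁ i (b₂ , b₁) (c₂ , c₁) = ¬ B₁.φ i b₁ < B₂.ε i b₂ × b₂ B₂.≈ c₂ × B₁.e i b₁ B₁.≈₀ just c₁
    F₂ i (b₂ , b₁) (c₂ , c₁) = B₁.φ i b₁ ≤ B₂.ε i b₂ × B₂.f i b₂ B₂.≈₀ just c₂ × b₁ B₁.≈ c₁
    F₁ i (b₂ , b₁) (c₂ , c₁) = ¬ B₁.φ i b₁ ≤ B₂.ε i b₂ × b₂ B₂.≈ c₂ × B₁.f i b₁ B₁.≈₀ just c₁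

    left : ∀ {b₁ c₂ c₁ x} → Maybe.map (_, b₁) x ≈₀ just (c₂ , c₁) → x B₂.≈₀ just c₂ × b₁ B₁.≈ c₁
    left {x = just _} (just (p , q)) = just p , q

    right : ∀ {b₂ c₂ c₁ x} → Maybe.map (b₂ ,_) x ≈₀ just (c₂ , c₁) → b₂ B₂.≈ c₂ × x B₁.≈₀ just c₁
    right {x = just _} (just (p , q)) = p , just q

    e-elim : ∀ i {b c} → e i b ≈₀ just c → E₂ i b c ⊎ E₁ i b c
    e-elim i {b₂ , b₁} eb with B₁.φ i b₁ ℤ.<? B₂.ε i b₂
    ... | yes lt = inj₁ (lt , left eb)
    ... | no nlt = inj₂ (nlt , right eb)

    f-elim : ∀ i {b c} → f i b ≈₀ just c → F₂ i b c ⊎ F₁ i b c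
    f-elim i {b₂ , b₁} fb with B₁.φ i b₁ ℤ.≤? B₂.ε i b₂
    ... | yes le = inj₁ (le , left fb)
    ... | no nle = inj₂ (nle , right fb)

    e-intro : ∀ i {b c} → E₂ i b c ⊎ E₁ i b c → e i b ≈₀ just c
    e-intro i {b₂ , b₁} E with B₁.φ i b₁ ℤ.<? B₂.ε i b₂
    e-intro i (inj₁ (_ , p , q)) | yes lt = map-cong {R = B₂._≈_} (_, q) p
    e-intro i (inj₂ (nlt , _)) | yes lt = ⊥-elim (nlt lt)
    e-intro i (inj₁ (lt , _)) | no nlt = ⊥-elim (nlt lt)
    e-intro i (inj₂ (_ , p , q)) | no nlt = map-cong {R = B₁._≈_} (p ,_) q

    f-intro : ∀ i {b c} → F₂ i b c ⊎ F₁ i b c → f i b ≈₀ just c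
    f-intro i {b₂ , b₁} E with B₁.φ i b₁ ℤ.≤? B₂.ε i b₂
    f-intro i (inj₁ (_ , p , q)) | yes le = map-cong {R = B₂._≈_} (_, q) p
    f-intro i (inj₂ (nle , _)) | yes le = ⊥-elim (nle le)
    f-intro i (inj₁ (le , _)) | no nle = ⊥-elim (nle le)
    f-intro i (inj₂ (_ , p , q)) | no nle = map-cong {R = B₁._≈_} (p ,_) q

    e₂⇒f₂ : ∀ i {b c} → E₂ i b c → F₂ i c b
    e₂⇒f₂ i (lt , eb , q) =
      subst₂ _≤_ (B₁.φ-cong i q) (sym (B₂.ε-e i eb)) (<→≤-1 lt) , Equivalence.to (B₂.e⇔f i) eb , B₁.≈-sym q

    e₁⇒f₁ : ∀ i {b c} → E₁ i b c → F₁ i c b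
    e₁⇒f₁ i (nlt , p , eb) =
      (λ le → nlt (ℤ.<-≤-trans (≤→<+1 ℤ.≤-refl) (subst₂ _≤_ (B₁.φ-e i eb) (sym (B₂.ε-cong i p)) le))) ,
      B₂.≈-sym p , Equivalence.to (B₁.e⇔f i) eb

    f₂⇒e₂ : ∀ i {b c} → F₂ i c b → E₂ i b c
    f₂⇒e₂ i (le , fb , q) =
      subst₂ _<_ (B₁.φ-cong i q) (sym (B₂.ε-f i fb)) (≤→<+1 le) , Equivalence.from (B₂.e⇔f i) fb , B₁.≈-sym q

    f₁⇒e₁ : ∀ i {b c} → F₁ i c b → E₁ i b c
    f₁⇒e₁ i {b₂ , b₁} {c₂ , c₁} (nle , p , fb) =
      (λ lt → ℤ.<⇒≱ (ℤ.≰⇒> nle) (subst₂ _≤_ (lem (B₁.φ-f i fb)) (sym (B₂.ε-cong i p)) (<→ lt))) ,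
      B₂.≈-sym p , Equivalence.from (B₁.e⇔f i) fb
      where
      lem₁ : ∀ a → 1ℤ + (a - 1ℤ) ≡ a
      lem₁ = solve-∀
      lem : ∀ {x y} → x ≡ y - 1ℤ → 1ℤ + x ≡ y
      lem {y = y} refl = lem₁ y

    wt-e : ∀ i {b c} → e i b ≈₀ just c → ∀ j → wt c j ≡ wt b j + α i j
    wt-e i {b₂ , b₁} {c₂ , c₁} eb j with e-elim i eb
    ... | inj₁ (_ , p , q) = trans (cong₂ _+_ (B₂.wt-e i p j) (sym (B₁.wt-cong q j))) (lem (B₂.wt b₂ j) (α i j) (B₁.wt b₁ j))
      where lem : ∀ a b c → a + b + c ≡ a + c + b
            lem = solve-∀
    ... | inj₂ (_ , p , q) = trans (cong₂ _+_ (sym (B₂.wt-cong p j)) (B₁.wt-e i q j)) (sym (ℤ.+-assoc (B₂.wt b₂ j) (B₁.wt b₁ j) (α i j)))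

    ε-e : ∀ i {b c} → e i b ≈₀ just c → ε i c ≡ ε i b - 1ℤ
    ε-e i {b₂ , b₁} {c₂ , c₁} eb with e-elim i eb
    ... | inj₁ (lt , p , q) = begin
      B₁.ε i c₁ ⊔ (B₂.ε i c₂ - B₁.wt c₁ i)   ≡⟨ cong₂ _⊔_ (sym (B₁.ε-cong i q)) (cong₂ _-_ (B₂.ε-e i p) (sym (B₁.wt-cong q i))) ⟩
      ε₁ ⊔ (ε₂ - 1ℤ - w₁)                    ≡⟨ ℤ.i≤j⇒i⊔j≡j (≤-by lt′ (lem₁ ε₁ w₁ ε₂)) ⟩
      ε₂ - 1ℤ - w₁                           ≡⟨ lem₂ ε₂ w₁ ⟩
      ε₂ - w₁ - 1ℤ                           ≡⟨ cong (_- 1ℤ) (ℤ.i≤j⇒i⊔j≡j {ε₁} {ε₂ - w₁} (ℤ.<⇒≤ (→< {ε₁} {ε₂ - w₁} (≤-by lt′ (lem₃ ε₁ w₁ ε₂))))) ⟨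
      (ε₁ ⊔ (ε₂ - w₁)) - 1ℤ                   ∎
      where
      open ≡-Reasoning
      ε₁ = B₁.ε i b₁
      ε₂ = B₂.ε i b₂
      w₁ = B₁.wt b₁ i
      lt′ : 1ℤ + (ε₁ + w₁) ≤ ε₂
      lt′ = <→ (subst (_< ε₂) (B₁.φ≡ε+h i b₁) lt)
      lem₁ : ∀ a w b → (b - 1ℤ - w) - a ≡ b - (1ℤ + (a + w))
      lem₁ = solve-∀
      lem₂ : ∀ b w → b - 1ℤ - w ≡ b - w - 1ℤ
      lem₂ = solve-∀
      lem₃ : ∀ a w b → (b - w) - (1ℤ + a) ≡ b - (1ℤ + (a + w))
      lem₃ = solve-∀
    ... | inj₂ (nlt , p , q) = begin
      B₁.ε i c₁ ⊔ (B₂.ε i c₂ - B₁.wt c₁ i)   ≡⟨ cong₂ _⊔_ (B₁.ε-e i q) (cong₂ _-_ (sym (B₂.ε-cong i p)) (B₁.h-e i q)) ⟩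
      (ε₁ - 1ℤ) ⊔ (ε₂ - (w₁ + + 2))           ≡⟨ ℤ.i≥j⇒i⊔j≡i (≤-by₂ ≥′ (0≤+ {1}) (lem₁ ε₁ w₁ ε₂)) ⟩
      ε₁ - 1ℤ                                ≡⟨ cong (_- 1ℤ) (ℤ.i≥j⇒i⊔j≡i {ε₁} {ε₂ - w₁} (≤-by ≥′ (lem₂ ε₁ w₁ ε₂))) ⟨
      (ε₁ ⊔ (ε₂ - w₁)) - 1ℤ                   ∎
      where
      open ≡-Reasoning
      ε₁ = B₁.ε i b₁
      ε₂ = B₂.ε i b₂
      w₁ = B₁.wt b₁ i
      ≥′ : ε₂ ≤ ε₁ + w₁
      ≥′ = subst (ε₂ ≤_) (B₁.φ≡ε+h i b₁) (ℤ.≮⇒≥ nlt)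
      lem₁ : ∀ a w b → (a - 1ℤ) - (b - (w + + 2)) ≡ ((a + w) - b) + (1ℤ - 0ℤ)
      lem₁ = solve-∀
      lem₂ : ∀ a w b → a - (b - w) ≡ (a + w) - b
      lem₂ = solve-∀

    h-e : ∀ i {b c} → e i b ≈₀ just c → wt c i ≡ wt b i + + 2
    h-e i {b₂ , b₁} eb with e-elim i eb
    ... | inj₁ (_ , p , q) = trans (cong₂ _+_ (B₂.h-e i p) (sym (B₁.wt-cong q i))) (lem (B₂.wt b₂ i) (B₁.wt b₁ i))
      where lem : ∀ a c → a + + 2 + c ≡ a + c + + 2
            lem = solve-∀
    ... | inj₂ (_ , p , q) = trans (cong₂ _+_ (sym (B₂.wt-cong p i)) (B₁.h-e i q)) (sym (ℤ.+-assoc (B₂.wt b₂ i) (B₁.wt b₁ i) (+ 2)))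

    φ-e : ∀ i {b c} → e i b ≈₀ just c → φ i c ≡ φ i b + 1ℤ
    φ-e i {b} {c} eb = trans (φ≡ε+h i c) (trans (cong₂ _+_ (ε-e i eb) (h-e i eb))
      (trans (lem (ε i b) (wt b i)) (cong (_+ 1ℤ) (sym (φ≡ε+h i b)))))
      where lem : ∀ a b → (a - 1ℤ) + (b + + 2) ≡ (a + b) + 1ℤ
            lem = solve-∀

  record Monomial : Set where
    field
      exponent : I → ℤ → ℤ
      bound    : ℕ
      vanishes : ∀ i → VanishesBeyond bound (exponent i)

  open Monomial public

  infix 4 _≈_

  record _≈_ (m m′ : Monomial) : Set where
    constructor equal
    field
      at : ∀ i k → exponent m i k ≡ exponent m′ i k

  open _≈_ public

  monomials : Setoid 0ℓ 0ℓ
  monomials = record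
    { Carrier = Monomial ; _≈_ = _≈_
    ; isEquivalence = record
        { refl = equal (λ _ _ → refl)
        ; sym = λ p → equal (λ i k → sym (at p i k))
        ; trans = λ p q → equal (λ i k → trans (at p i k) (at q i k)) } }

  infixl 7 _·_
  infix 8 _⁻¹

  𝟏 : Monomial
  𝟏 = record { exponent = λ _ _ → 0ℤ ; bound = 0 ; vanishes = λ _ _ _ → refl }

  _·_ : Monomial → Monomial → Monomial
  m · m′ = record
    { exponent = λ i k → exponent m i k + exponent m′ i k
    ; bound = bound m ℕ.⊔ bound m′
    ; vanishes = λ i k lt → cong₂ _+_
        (vanishes m i k (ℕ.≤-<-trans (ℕ.m≤m⊔n (bound m) (bound m′)) lt))
        (vanishes m′ i k (ℕ.≤-<-trans (ℕ.m≤n⊔m (bound m) (bound m′)) lt)) }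

  _⁻¹ : Monomial → Monomial
  m ⁻¹ = record
    { exponent = λ i k → - exponent m i k
    ; bound = bound m
    ; vanishes = λ i k lt → cong -_ (vanishes m i k lt) }

  ∏ : ∀ {l} → (Fin l → Monomial) → Monomial
  ∏ = Vector.foldr _·_ 𝟏

  -- Y i k z is the power Y_{i,k}^z
  Y : I → ℤ → ℤ → Monomial
  Y i k z = record
    { exponent = λ j t → z * (⟦ i Fin.≟ j ⟧ * ⟦ k ℤ.≟ t ⟧)
    ; bound = ∣ k ∣
    ; vanishes = λ j t lt → trans (cong (λ x → z * (⟦ i Fin.≟ j ⟧ * x))
        (⟦⟧-false (k ℤ.≟ t) (λ k≡t → ℕ.<-irrefl (cong ∣_∣ k≡t) lt))) (lem z ⟦ i Fin.≟ j ⟧) }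
    where lem : ∀ z a → z * (a * 0ℤ) ≡ 0ℤ
          lem = solve-∀

  A : I → ℤ → Monomial
  A i k = Y i k 1ℤ · Y i (k + 1ℤ) 1ℤ · Y (i ⁻) (k + 1ℤ) (- 1ℤ) · Y (i ⁺) k (- 1ℤ)

  τ : ℤ → Monomial → Monomial
  τ j m = record
    { exponent = λ i k → exponent m i (k - j)
    ; bound = bound m ℕ.+ ∣ j ∣
    ; vanishes = λ i k lt → vanishes m i (k - j)
        (ℕ.+-cancelʳ-< (∣ j ∣) (bound m) (∣ k - j ∣) (ℕ.<-≤-trans lt (triangle k))) }
    where
    triangle : ∀ k → ∣ k ∣ ℕ.≤ ∣ k - j ∣ ℕ.+ ∣ j ∣
    triangle k = subst (λ z → ∣ z ∣ ℕ.≤ ∣ k - j ∣ ℕ.+ ∣ j ∣) (lem k j) (ℤ.∣i+j∣≤∣i∣+∣j∣ (k - j) j)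
      where lem : ∀ k j → (k - j) + j ≡ k
            lem = solve-∀

  wt : Monomial → Weight
  wt m i = total (exponent m i) (bound m)

  ε φ kₑ k_f : I → Monomial → ℤ
  ε i m   = - min-sum≥ (exponent m i) (bound m)
  φ i m   = max-sum≤ (exponent m i) (bound m)
  kₑ i m  = last-min (exponent m i) (bound m)
  k_f i m = first-max (exponent m i) (bound m)

  e f : I → Monomial → Maybe Monomial
  e i m = if does (ε i m ℤ.≟ 0ℤ) then nothing else just (m · A i (kₑ i m - 1ℤ))
  f i m = if does (φ i m ℤ.≟ 0ℤ) then nothing else just (m · A i (k_f i m) ⁻¹)

  infix 4 _≈₀_

  _≈₀_ : Maybe Monomial → Maybe Monomial → Set
  _≈₀_ = Pointwise _≈_

  module MonomialLaws where

    cum : ∀ m j → Cumulative (exponent m j) (sum≤ (exponent m j) (bound m)) (wt m j)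
    cum m j = cumulative (vanishes m j)

    wt-· : ∀ m m′ j → wt (m · m′) j ≡ wt m j + wt m′ j
    wt-· m m′ j = total-unique (λ _ → refl) (cum (m · m′) j) (cumulative-+ (cum m j) (cum m′ j))

    wt-Y : ∀ i k z j → wt (Y i k z) j ≡ z * ⟦ i Fin.≟ j ⟧
    wt-Y i k z j = trans
      (total-unique (λ _ → refl) (cum (Y i k z) j) (cumulative-* z (cumulative-* ⟦ i Fin.≟ j ⟧ (cumulative-δ k))))
      (cong (z *_) (ℤ.*-identityʳ ⟦ i Fin.≟ j ⟧))

    wt-A : ∀ i k → wt (A i k) ≗ α i
    wt-A i k j = begin
      wt (A i k) j
        ≡⟨ wt-· (Y i k 1ℤ · Y i (k + 1ℤ) 1ℤ · Y (i ⁻) (k + 1ℤ) (- 1ℤ)) (Y (i ⁺) k (- 1ℤ)) j ⟩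
      wt (Y i k 1ℤ · Y i (k + 1ℤ) 1ℤ · Y (i ⁻) (k + 1ℤ) (- 1ℤ)) j + wt (Y (i ⁺) k (- 1ℤ)) j
        ≡⟨ cong (_+ wt (Y (i ⁺) k (- 1ℤ)) j) (wt-· (Y i k 1ℤ · Y i (k + 1ℤ) 1ℤ) (Y (i ⁻) (k + 1ℤ) (- 1ℤ)) j) ⟩
      wt (Y i k 1ℤ · Y i (k + 1ℤ) 1ℤ) j + wt (Y (i ⁻) (k + 1ℤ) (- 1ℤ)) j + wt (Y (i ⁺) k (- 1ℤ)) j
        ≡⟨ cong (λ z → z + wt (Y (i ⁻) (k + 1ℤ) (- 1ℤ)) j + wt (Y (i ⁺) k (- 1ℤ)) j) (wt-· (Y i k 1ℤ) (Y i (k + 1ℤ) 1ℤ) j) ⟩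
      wt (Y i k 1ℤ) j + wt (Y i (k + 1ℤ) 1ℤ) j + wt (Y (i ⁻) (k + 1ℤ) (- 1ℤ)) j + wt (Y (i ⁺) k (- 1ℤ)) j
        ≡⟨ cong₂ _+_ (cong₂ _+_ (cong₂ _+_ (wt-Y i k 1ℤ j) (wt-Y i (k + 1ℤ) 1ℤ j)) (wt-Y (i ⁻) (k + 1ℤ) (- 1ℤ) j)) (wt-Y (i ⁺) k (- 1ℤ) j) ⟩
      1ℤ * ⟦ i Fin.≟ j ⟧ + 1ℤ * ⟦ i Fin.≟ j ⟧ + - 1ℤ * ⟦ i ⁻ Fin.≟ j ⟧ + - 1ℤ * ⟦ i ⁺ Fin.≟ j ⟧
        ≡⟨ lem ⟦ i Fin.≟ j ⟧ ⟦ i ⁻ Fin.≟ j ⟧ ⟦ i ⁺ Fin.≟ j ⟧ ⟩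
      α i j ∎
      where
      open ≡-Reasoning
      lem : ∀ a b c → 1ℤ * a + 1ℤ * a + - 1ℤ * b + - 1ℤ * c ≡ + 2 * a - b - c
      lem = solve-∀

    exponent-A : ∀ i k t → exponent (A i k) i t ≡ ⟦ k ℤ.≟ t ⟧ + ⟦ (k + 1ℤ) ℤ.≟ t ⟧
    exponent-A i k t = trans
      (cong₂ _+_ (cong₂ _+_ (cong (λ x → 1ℤ * (x * ⟦ k ℤ.≟ t ⟧) + 1ℤ * (x * ⟦ (k + 1ℤ) ℤ.≟ t ⟧)) (⟦⟧-true (i Fin.≟ i) refl))
        (cong (λ x → - 1ℤ * (x * ⟦ (k + 1ℤ) ℤ.≟ t ⟧)) (⟦⟧-false (i ⁻ Fin.≟ i) (⁻-≢ i))))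
        (cong (λ x → - 1ℤ * (x * ⟦ k ℤ.≟ t ⟧)) (⟦⟧-false (i ⁺ Fin.≟ i) (⁺-≢ i))))
      (lem ⟦ k ℤ.≟ t ⟧ ⟦ (k + 1ℤ) ℤ.≟ t ⟧)
      where
      lem : ∀ a b → 1ℤ * (1ℤ * a) + 1ℤ * (1ℤ * b) + - 1ℤ * (0ℤ * b) + - 1ℤ * (0ℤ * a) ≡ a + b
      lem = solve-∀

    ·-cong : ∀ {m m′} i {k k′} → m ≈ m′ → k ≡ k′ → m · A i k ≈ m′ · A i k′
    ·-cong i {k} p refl = equal (λ j t → cong (λ x → x + exponent (A i k) j t) (at p j t))

    ·⁻¹-cong : ∀ {m m′} i {k k′} → m ≈ m′ → k ≡ k′ → m · A i k ⁻¹ ≈ m′ · A i k′ ⁻¹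
    ·⁻¹-cong i {k} p refl = equal (λ j t → cong (λ x → x - exponent (A i k) j t) (at p j t))

    move : ∀ {m m′} i k → m · A i k ≈ m′ → m′ · A i k ⁻¹ ≈ m
    move {m} i k p = equal (λ j t → trans (cong (λ x → x - exponent (A i k) j t) (sym (at p j t)))
                                          (lem (exponent m j t) (exponent (A i k) j t)))
      where lem : ∀ a b → a + b - b ≡ a
            lem = solve-∀

    move⁻ : ∀ {m m′} i k → m′ · A i k ⁻¹ ≈ m → m · A i k ≈ m′
    move⁻ {m} {m′} i k p = equal (λ j t → trans (cong (λ x → x + exponent (A i k) j t) (sym (at p j t)))
                                                (lem (exponent m′ j t) (exponent (A i k) j t)))
      where lem : ∀ a b → a - b + b ≡ a
            lem = solve-∀

    ε-cong : ∀ i {m m′} → m ≈ m′ → ε i m ≡ ε i m′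
    ε-cong i {m} {m′} p = min-sum≥-cong (vanishes m i) (vanishes m′ i) (at p i)

    φ-cong : ∀ i {m m′} → m ≈ m′ → φ i m ≡ φ i m′
    φ-cong i {m} {m′} p = max-sum≤-cong (vanishes m i) (vanishes m′ i) (at p i)

    wt-cong : ∀ {m m′} → m ≈ m′ → wt m ≗ wt m′
    wt-cong {m} {m′} p i = total-cong (vanishes m i) (vanishes m′ i) (at p i)

    ε≡φ-wt : ∀ i m → ε i m ≡ φ i m - wt m i
    ε≡φ-wt i m = ε≡φ-total (vanishes m i)

    guard-elim : ∀ {P : Set} (d : Dec P) {x y} → (if does d then nothing else just x) ≈₀ just y → ¬ P × x ≈ y
    guard-elim (no ¬p) (just q) = ¬p , q

    guard-intro : ∀ {P : Set} (d : Dec P) {x y} → ¬ P → x ≈ y → (if does d then nothing else just x) ≈₀ just y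
    guard-intro (yes p) ¬p q = ⊥-elim (¬p p)
    guard-intro (no _) ¬p q = just q

    guard-cong : ∀ {a b : ℤ} {x y} → a ≡ b → (a ≢ 0ℤ → x ≈ y) →
      (if does (a ℤ.≟ 0ℤ) then nothing else just x) ≈₀ (if does (b ℤ.≟ 0ℤ) then nothing else just y)
    guard-cong {a} refl q with a ℤ.≟ 0ℤ
    ... | yes _ = nothing
    ... | no a≢0 = just (q a≢0)

    e-elim : ∀ i {m m′} → e i m ≈₀ just m′ → ε i m ≢ 0ℤ × m · A i (kₑ i m - 1ℤ) ≈ m′
    e-elim i {m} = guard-elim (ε i m ℤ.≟ 0ℤ)

    e-intro : ∀ i {m m′} → ε i m ≢ 0ℤ → m · A i (kₑ i m - 1ℤ) ≈ m′ → e i m ≈₀ just m′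
    e-intro i {m} = guard-intro (ε i m ℤ.≟ 0ℤ)

    f-elim : ∀ i {m m′} → f i m ≈₀ just m′ → φ i m ≢ 0ℤ × m · A i (k_f i m) ⁻¹ ≈ m′
    f-elim i {m} = guard-elim (φ i m ℤ.≟ 0ℤ)

    f-intro : ∀ i {m m′} → φ i m ≢ 0ℤ → m · A i (k_f i m) ⁻¹ ≈ m′ → f i m ≈₀ just m′
    f-intro i {m} = guard-intro (φ i m ℤ.≟ 0ℤ)

    e-cong : ∀ i {m m′} → m ≈ m′ → e i m ≈₀ e i m′
    e-cong i {m} {m′} p = guard-cong {ε i m} {ε i m′} (ε-cong i p)
      (λ ε≢0 → ·-cong i p (last-min-cong (vanishes m i) (vanishes m′ i) (at p i) ε≢0))

    f-cong : ∀ i {m m′} → m ≈ m′ → f i m ≈₀ f i m′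
    f-cong i {m} {m′} p = guard-cong {φ i m} {φ i m′} (φ-cong i p)
      (λ φ≢0 → ·⁻¹-cong i p (first-max-cong (vanishes m i) (vanishes m′ i) (at p i) φ≢0))

    +1≢0 : ∀ {a b} → 0ℤ ≤ a → b ≡ a + 1ℤ → b ≢ 0ℤ
    +1≢0 0≤a b≡ b≡0 = ℤ.<⇒≢ (≤→<+1 0≤a) (trans (sym b≡0) b≡)

    module _ i {m m′ k} (p : m · A i k ≈ m′) where

      change : ∀ t → exponent m′ i t ≡ exponent m i t + (⟦ k ℤ.≟ t ⟧ + ⟦ (k + 1ℤ) ℤ.≟ t ⟧)
      change t = trans (sym (at p i t)) (cong (λ x → exponent m i t + x) (exponent-A i k t))

      private
        H H′ : ℤ → ℤ
        H = sum≤ (exponent m i) (bound m)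
        H′ = sum≤ (exponent m′ i) (bound m′)

      up : IsLast H (φ i m) k → φ i m′ ≡ φ i m + 1ℤ × IsFirst H′ (φ i m′) k
      up = last⇒first (vanishes m i) (vanishes m′ i) {k} change

      down : IsFirst H′ (φ i m′) k → φ i m ≡ φ i m′ - 1ℤ × IsLast H (φ i m) k
      down = first⇒last (vanishes m i) (vanishes m′ i) {k} change

      wt-up : wt m′ i ≡ wt m i + + 2
      wt-up = total-change (vanishes m i) (vanishes m′ i) {k} change

      ε-up : φ i m′ ≡ φ i m + 1ℤ → ε i m′ ≡ ε i m - 1ℤ
      ε-up φ≡ = trans (ε≡φ-wt i m′) (trans (cong₂ _-_ φ≡ wt-up)
        (trans (lem (φ i m) (wt m i)) (cong (_- 1ℤ) (sym (ε≡φ-wt i m)))))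
        where lem : ∀ a b → (a + 1ℤ) - (b + + 2) ≡ (a - b) - 1ℤ
              lem = solve-∀

    e-last : ∀ i m → ε i m ≢ 0ℤ → IsLast (sum≤ (exponent m i) (bound m)) (φ i m) (kₑ i m - 1ℤ)
    e-last i m = last-min-1 (vanishes m i)

    f-first : ∀ i m → φ i m ≢ 0ℤ → IsFirst (sum≤ (exponent m i) (bound m)) (φ i m) (k_f i m)
    f-first i m = first-max-isFirst (vanishes m i)

    φ-e : ∀ i {m m′} → e i m ≈₀ just m′ → φ i m′ ≡ φ i m + 1ℤ
    φ-e i {m} {m′} em = proj₁ (up i {m} {m′} {kₑ i m - 1ℤ} (proj₂ (e-elim i {m} {m′} em))
                                 (e-last i m (proj₁ (e-elim i {m} {m′} em))))

    ε-e : ∀ i {m m′} → e i m ≈₀ just m′ → ε i m′ ≡ ε i m - 1ℤ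
    ε-e i {m} {m′} em = ε-up i {m} {m′} {kₑ i m - 1ℤ} (proj₂ (e-elim i {m} {m′} em)) (φ-e i {m} {m′} em)

    wt-e : ∀ i {m m′} → e i m ≈₀ just m′ → ∀ j → wt m′ j ≡ wt m j + α i j
    wt-e i {m} {m′} em j = trans
      (sym (wt-cong {m · A i (kₑ i m - 1ℤ)} {m′} (proj₂ (e-elim i {m} {m′} em)) j))
      (trans (wt-· m (A i (kₑ i m - 1ℤ)) j) (cong (λ x → wt m j + x) (wt-A i (kₑ i m - 1ℤ) j)))

    e⇒f′ : ∀ i m m′ k → m · A i k ≈ m′ → IsLast (sum≤ (exponent m i) (bound m)) (φ i m) k → f i m′ ≈₀ just m
    e⇒f′ i m m′ k p isLast = f-intro i {m′} {m} φ≢0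
        (subst (λ l → m′ · A i l ⁻¹ ≈ m) (IsFirst-unique (proj₂ shifted) (f-first i m′ φ≢0)) (move {m} {m′} i k p))
      where
      shifted : φ i m′ ≡ φ i m + 1ℤ × IsFirst (sum≤ (exponent m′ i) (bound m′)) (φ i m′) k
      shifted = up i {m} {m′} {k} p isLast
      φ≢0 : φ i m′ ≢ 0ℤ
      φ≢0 = +1≢0 {φ i m} {φ i m′} (0≤max-sum≤ (vanishes m i)) (proj₁ shifted)

    e⇒f : ∀ i {m m′} → e i m ≈₀ just m′ → f i m′ ≈₀ just m
    e⇒f i {m} {m′} em = e⇒f′ i m m′ (kₑ i m - 1ℤ) (proj₂ (e-elim i {m} {m′} em))
                             (e-last i m (proj₁ (e-elim i {m} {m′} em)))

    -1+1 : ∀ {a b} → a ≡ b - 1ℤ → b ≡ a + 1ℤ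
    -1+1 {.(b - 1ℤ)} {b} refl = lem b
      where lem : ∀ b → b ≡ b - 1ℤ + 1ℤ
            lem = solve-∀

    f⇒e′ : ∀ i m m′ k → m · A i k ≈ m′ → IsFirst (sum≤ (exponent m′ i) (bound m′)) (φ i m′) k → e i m ≈₀ just m′
    f⇒e′ i m m′ k p isFirst = e-intro i {m} {m′} ε≢0
        (subst (λ l → m · A i l ≈ m′) (IsLast-unique (proj₂ shifted) (e-last i m ε≢0)) p)
      where
      shifted : φ i m ≡ φ i m′ - 1ℤ × IsLast (sum≤ (exponent m i) (bound m)) (φ i m) k
      shifted = down i {m} {m′} {k} p isFirst
      ε≢0 : ε i m ≢ 0ℤ
      ε≢0 = +1≢0 {ε i m′} {ε i m} (0≤ε (vanishes m′ i))
        (-1+1 {ε i m′} {ε i m} (ε-up i {m} {m′} {k} p (-1+1 {φ i m} {φ i m′} (proj₁ shifted))))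

    f⇒e : ∀ i {m m′} → f i m′ ≈₀ just m → e i m ≈₀ just m′
    f⇒e i {m} {m′} fm = f⇒e′ i m m′ (k_f i m′) (move⁻ {m} {m′} i (k_f i m′) (proj₂ (f-elim i {m′} {m} fm)))
                             (f-first i m′ (proj₁ (f-elim i {m′} {m} fm)))

    φ≡ε+wt : ∀ i m → φ i m ≡ ε i m + wt m i
    φ≡ε+wt i m = trans (lem (φ i m) (wt m i)) (cong (_+ wt m i) (sym (ε≡φ-wt i m)))
      where lem : ∀ a b → a ≡ a - b + b
            lem = solve-∀

  𝓜 : Crystal
  𝓜 = record
    { setoid = monomials ; e = e ; f = f ; ε = ε ; φ = φ ; wt = wt
    ; e-cong = e-cong ; f-cong = f-cong ; ε-cong = ε-cong ; φ-cong = φ-cong ; wt-cong = wt-cong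
    ; φ≡ε+h = φ≡ε+wt
    ; wt-e = λ i {m} {m′} → wt-e i {m} {m′}
    ; ε-e = λ i {m} {m′} → ε-e i {m} {m′}
    ; φ-e = λ i {m} {m′} → φ-e i {m} {m′}
    ; e⇔f = λ i {m} {m′} → mk⇔ (e⇒f i {m} {m′}) (f⇒e i {m} {m′}) }
    where open MonomialLaws

  module _ (B : Crystal) where
    private module B = Crystal B

    record IsClosed (P : B.Carrier → Set) : Set where
      field
        e-closed : ∀ i {b c} → P b → B.e i b ≡ just c → P c
        f-closed : ∀ i {b c} → P b → B.f i b ≡ just c → P c

    module _ (P : B.Carrier → Set) (closed : IsClosed P) where
      open IsClosed closed

      corestrict : (x : Maybe B.Carrier) → (∀ {c} → x ≡ just c → P c) → Maybe (Σ B.Carrier P)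
      corestrict (just c) h = just (c , h refl)
      corestrict nothing h = nothing

      private
        _≈ₚ_ : Maybe (Σ B.Carrier P) → Maybe (Σ B.Carrier P) → Set
        _≈ₚ_ = Pointwise (λ b c → proj₁ b B.≈ proj₁ c)

        corestrict-cong : ∀ {x y} (h : ∀ {c} → x ≡ just c → P c) (k : ∀ {c} → y ≡ just c → P c) →
                          x B.≈₀ y → corestrict x h ≈ₚ corestrict y k
        corestrict-cong h k (just p) = just p
        corestrict-cong h k nothing = nothing

        corestrict⁻ : ∀ x (h : ∀ {c} → x ≡ just c → P c) {c} →
                      corestrict x h ≈ₚ just c → x B.≈₀ just (proj₁ c)
        corestrict⁻ (just _) h (just p) = just p

        corestrict⁺ : ∀ {x} (h : ∀ {c} → x ≡ just c → P c) {c} →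
                      x B.≈₀ just (proj₁ c) → corestrict x h ≈ₚ just c
        corestrict⁺ h (just p) = just p

        e⁻ : ∀ i b {c} → corestrict (B.e i (proj₁ b)) (e-closed i (proj₂ b)) ≈ₚ just c → B.e i (proj₁ b) B.≈₀ just (proj₁ c)
        e⁻ i b = corestrict⁻ (B.e i (proj₁ b)) (e-closed i (proj₂ b))

        f⁻ : ∀ i b {c} → corestrict (B.f i (proj₁ b)) (f-closed i (proj₂ b)) ≈ₚ just c → B.f i (proj₁ b) B.≈₀ just (proj₁ c)
        f⁻ i b = corestrict⁻ (B.f i (proj₁ b)) (f-closed i (proj₂ b))

      subcrystal : Crystal
      subcrystal = record
        { setoid = On.setoid B.setoid (proj₁ {B = P})
        ; e = λ i (b , p) → corestrict (B.e i b) (e-closed i p)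
        ; f = λ i (b , p) → corestrict (B.f i b) (f-closed i p)
        ; ε = λ i → B.ε i ∘ proj₁ ; φ = λ i → B.φ i ∘ proj₁ ; wt = B.wt ∘ proj₁
        ; e-cong = λ i {b} {c} p → corestrict-cong (e-closed i (proj₂ b)) (e-closed i (proj₂ c)) (B.e-cong i p)
        ; f-cong = λ i {b} {c} p → corestrict-cong (f-closed i (proj₂ b)) (f-closed i (proj₂ c)) (B.f-cong i p)
        ; ε-cong = λ i → B.ε-cong i ; φ-cong = λ i → B.φ-cong i ; wt-cong = B.wt-cong
        ; φ≡ε+h = λ i b → B.φ≡ε+h i (proj₁ b)
        ; wt-e = λ i {b} eb → B.wt-e i (e⁻ i b eb)
        ; ε-e = λ i {b} eb → B.ε-e i (e⁻ i b eb)
        ; φ-e = λ i {b} eb → B.φ-e i (e⁻ i b eb)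
        ; e⇔f = λ i {b} {c} → mk⇔
            (λ eb → corestrict⁺ (f-closed i (proj₂ c)) (Equivalence.to (B.e⇔f i) (e⁻ i b eb)))
            (λ fb → corestrict⁺ (e-closed i (proj₂ b)) (Equivalence.from (B.e⇔f i) (f⁻ i c fb))) }

  -- ν stands for Σ ν_i Λ_i.
  DominantWeight : Set
  DominantWeight = I → ℕ

  level : DominantWeight → ℕ
  level = sumᴺ

  Y^_ : DominantWeight → Monomial
  Y^ ν = ∏ (λ i → Y i 0ℤ (+ ν i))

  data ∈𝓜[_] (ν : DominantWeight) : Monomial → Set where
    highest  : ∀ {m} → m ≈ Y^ ν → ∈𝓜[ ν ] m
    e-closed : ∀ i {m m′} → ∈𝓜[ ν ] m → e i m ≈₀ just m′ → ∈𝓜[ ν ] m′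
    f-closed : ∀ i {m m′} → ∈𝓜[ ν ] m → f i m ≈₀ just m′ → ∈𝓜[ ν ] m′

  𝓜[_] : DominantWeight → Crystal
  𝓜[ ν ] = subcrystal 𝓜 ∈𝓜[ ν ] record
    { e-closed = λ i p eq → e-closed i p (Pointwise.reflexive (λ { refl → equal (λ _ _ → refl) }) eq)
    ; f-closed = λ i p eq → f-closed i p (Pointwise.reflexive (λ { refl → equal (λ _ _ → refl) }) eq) }

  -- The index of x_i is taken modulo n, so x_n is x 0.
  Yˣ : (I → ℕ) → Monomial
  Yˣ x = ∏ (λ i → Y (i ⁻) 1ℤ (- (+ x i)) · Y i 0ℤ (+ x i))

  ∈𝓜¹[_] : ℕ → Monomial → Set
  ∈𝓜¹[ s ] m = ∃ λ (x : I → ℕ) → sumᴺ x ≡ s × m ≈ Yˣ x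

  module OneRowLaws where

    exponent-∏ : ∀ {l} (g : Fin l → Monomial) j t → exponent (∏ g) j t ≡ sumᶻ (λ i → exponent (g i) j t)
    exponent-∏ {zero} g j t = refl
    exponent-∏ {suc l} g j t = cong (λ z → exponent (g zero) j t + z) (exponent-∏ (g ∘ suc) j t)

    exponent-Yˣ : ∀ x j t → exponent (Yˣ x) j t ≡ - (+ x (j ⁺)) * ⟦ 1ℤ ℤ.≟ t ⟧ + + x j * ⟦ 0ℤ ℤ.≟ t ⟧
    exponent-Yˣ x j t = trans (exponent-∏ (λ i → Y (i ⁻) 1ℤ (- (+ x i)) · Y i 0ℤ (+ x i)) j t)
      (trans (sumᶻ-+ u v) (cong₂ _+_
        (trans (sumᶻ-pick u (j ⁺) (λ i i≢ → trans (cong (λ z → - (+ x i) * (z * d)) (⟦⟧-false (i ⁻ Fin.≟ j)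
                  (λ i⁻≡j → i≢ (trans (sym (⁻⁺ i)) (cong _⁺ i⁻≡j))))) (lem₀ (- (+ x i)) d)))
          (trans (cong (λ z → - (+ x (j ⁺)) * (z * d)) (⟦⟧-true (j ⁺ ⁻ Fin.≟ j) (⁺⁻ j))) (lem₁ (- (+ x (j ⁺))) d)))
        (trans (sumᶻ-pick v j (λ i i≢ → trans (cong (λ z → + x i * (z * d′)) (⟦⟧-false (i Fin.≟ j) i≢)) (lem₀ (+ x i) d′)))
          (trans (cong (λ z → + x j * (z * d′)) (⟦⟧-true (j Fin.≟ j) refl)) (lem₁ (+ x j) d′)))))
      where
      d = ⟦ 1ℤ ℤ.≟ t ⟧
      d′ = ⟦ 0ℤ ℤ.≟ t ⟧
      u v : I → ℤ
      u i = - (+ x i) * (⟦ i ⁻ Fin.≟ j ⟧ * d)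
      v i = + x i * (⟦ i Fin.≟ j ⟧ * d′)
      lem₀ : ∀ a b → a * (0ℤ * b) ≡ 0ℤ
      lem₀ = solve-∀
      lem₁ : ∀ a b → a * (1ℤ * b) ≡ a * b
      lem₁ = solve-∀

    H : ℕ → ℕ → ℤ → ℤ
    H a b t = - (+ b) * ⟦ 1ℤ ℤ.≤? t ⟧ + + a * ⟦ 0ℤ ℤ.≤? t ⟧

    lem-neg : ∀ a b → - b * 0ℤ + a * 0ℤ ≡ 0ℤ
    lem-neg = solve-∀
    lem-zero : ∀ a b → - b * 0ℤ + a * 1ℤ ≡ a
    lem-zero = solve-∀
    lem-pos : ∀ a b → - b * 1ℤ + a * 1ℤ ≡ a - b
    lem-pos = solve-∀

    data View (a b : ℕ) (t : ℤ) : Set where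
      negative : t < 0ℤ → H a b t ≡ 0ℤ → View a b t
      at-zero  : t ≡ 0ℤ → H a b t ≡ + a → View a b t
      positive : 0ℤ < t → H a b t ≡ + a - + b → View a b t

    view : ∀ a b t → View a b t
    view a b +[1+ t ] = positive (ℤ.+<+ (s≤s z≤n)) (lem-pos (+ a) (+ b))
    view a b (+ zero) = at-zero refl (lem-zero (+ a) (+ b))
    view a b -[1+ t ] = negative ℤ.-<+ (lem-neg (+ a) (+ b))

    H-max : ∀ a b → IsMax (H a b) (+ a)
    H-max a b = bounded , 0ℤ , lem-zero (+ a) (+ b)
      where
      bounded : ∀ t → H a b t ≤ + a
      bounded t with view a b t
      ... | negative _ eq = subst (_≤ + a) (sym eq) 0≤+
      ... | at-zero _ eq = ℤ.≤-reflexive eq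
      ... | positive _ eq = subst (_≤ + a) (sym eq) (≤-by (0≤+ {b}) (lem (+ a) (+ b)))
        where lem : ∀ a b → a - (a - b) ≡ b - 0ℤ
              lem = solve-∀

    H-first : ∀ a b → + a ≢ 0ℤ → IsFirst (H a b) (+ a) 0ℤ
    H-first a b a≢0 = lem-zero (+ a) (+ b) , least
      where
      least : ∀ t → H a b t ≡ + a → 0ℤ ≤ t
      least t hit with view a b t
      ... | negative _ eq = ⊥-elim (a≢0 (trans (sym hit) eq))
      ... | at-zero t≡0 _ = ℤ.≤-reflexive (sym t≡0)
      ... | positive 0<t _ = ℤ.<⇒≤ 0<t

    H-last : ∀ a b → + b ≢ 0ℤ → IsLast (H a b) (+ a) 0ℤ
    H-last a b b≢0 = lem-zero (+ a) (+ b) , greatest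
      where
      lem : ∀ a b → b ≡ a - (a - b)
      lem = solve-∀
      greatest : ∀ t → H a b t ≡ + a → t ≤ 0ℤ
      greatest t hit with view a b t
      ... | negative t<0 _ = ℤ.<⇒≤ t<0
      ... | at-zero t≡0 _ = ℤ.≤-reflexive t≡0
      ... | positive _ eq = ⊥-elim (b≢0 (trans (lem (+ a) (+ b))
              (trans (cong (λ z → + a - z) (trans (sym eq) hit)) (ℤ.+-inverseʳ (+ a)))))

    module OneRow m x (m≈ : m ≈ Yˣ x) (i : I) where

      y≗ : ∀ t → exponent m i t ≡ - (+ x (i ⁺)) * ⟦ 1ℤ ℤ.≟ t ⟧ + + x i * ⟦ 0ℤ ℤ.≟ t ⟧
      y≗ t = trans (at m≈ i t) (exponent-Yˣ x i t)

      cumH : Cumulative (λ t → - (+ x (i ⁺)) * ⟦ 1ℤ ℤ.≟ t ⟧ + + x i * ⟦ 0ℤ ℤ.≟ t ⟧)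
                        (H (x i) (x (i ⁺))) (- (+ x (i ⁺)) * 1ℤ + + x i * 1ℤ)
      cumH = cumulative-+ (cumulative-* (- (+ x (i ⁺))) (cumulative-δ 1ℤ)) (cumulative-* (+ x i) (cumulative-δ 0ℤ))

      sum≤≗H : ∀ t → sum≤ (exponent m i) (bound m) t ≡ H (x i) (x (i ⁺)) t
      sum≤≗H = cumulative-unique y≗ (MonomialLaws.cum m i) cumH

      wt≡ : wt m i ≡ + x i - + x (i ⁺)
      wt≡ = trans (total-unique y≗ (MonomialLaws.cum m i) cumH) (lem-pos (+ x i) (+ x (i ⁺)))

      φ≡ : φ i m ≡ + x i
      φ≡ = IsMax-cong sum≤≗H (max-sum≤-isMax (vanishes m i)) (H-max (x i) (x (i ⁺)))

      ε≡ : ε i m ≡ + x (i ⁺)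
      ε≡ = trans (MonomialLaws.ε≡φ-wt i m) (trans (cong₂ _-_ φ≡ wt≡) (lem (+ x i) (+ x (i ⁺))))
        where lem : ∀ a b → a - (a - b) ≡ b
              lem = solve-∀

      kₑ-1≡0 : ε i m ≢ 0ℤ → kₑ i m - 1ℤ ≡ 0ℤ
      kₑ-1≡0 ε≢0 = IsLast-cong sum≤≗H φ≡ (MonomialLaws.e-last i m ε≢0)
        (H-last (x i) (x (i ⁺)) (λ z → ε≢0 (trans ε≡ z)))

      k_f≡0 : φ i m ≢ 0ℤ → k_f i m ≡ 0ℤ
      k_f≡0 φ≢0 = IsFirst-cong sum≤≗H φ≡ (MonomialLaws.f-first i m φ≢0)
        (H-first (x i) (x (i ⁺)) (λ z → φ≢0 (trans φ≡ z)))

    transfer : ∀ (x : I → ℕ) a b → + x b ≢ 0ℤ →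
      ∃ λ (x′ : I → ℕ) → sumᴺ x′ ≡ sumᴺ x × (∀ j → + x′ j ≡ + x j + (⟦ a Fin.≟ j ⟧ + - ⟦ b Fin.≟ j ⟧))
    transfer x a b xb≢0 = x′ , ℤ.+-injective total≡ , x′≡
      where
      x′ : I → ℕ
      x′ j = ∣ + x j + (⟦ a Fin.≟ j ⟧ + - ⟦ b Fin.≟ j ⟧) ∣

      nonneg : ∀ p q r → 0ℤ ≤ q → r ≤ p → 0ℤ ≤ p + (q + - r)
      nonneg p q r 0≤q r≤p = ≤-by₂ r≤p 0≤q (lem p q r)
        where lem : ∀ p q r → p + (q + - r) - 0ℤ ≡ (p - r) + (q - 0ℤ)
              lem = solve-∀

      0≤⟦⟧ : ∀ {A : Set} (d : Dec A) → 0ℤ ≤ ⟦ d ⟧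
      0≤⟦⟧ (yes _) = 0≤+
      0≤⟦⟧ (no _) = 0≤+

      ⟦b⟧≤ : ∀ j → ⟦ b Fin.≟ j ⟧ ≤ + x j
      ⟦b⟧≤ j with b Fin.≟ j
      ... | yes refl = <→ (ℤ.≤∧≢⇒< 0≤+ (λ z → xb≢0 (sym z)))
      ... | no _ = 0≤+

      x′≡ : ∀ j → + x′ j ≡ + x j + (⟦ a Fin.≟ j ⟧ + - ⟦ b Fin.≟ j ⟧)
      x′≡ j = ℤ.0≤i⇒+∣i∣≡i (nonneg (+ x j) ⟦ a Fin.≟ j ⟧ ⟦ b Fin.≟ j ⟧ (0≤⟦⟧ (a Fin.≟ j)) (⟦b⟧≤ j))

      A₁ B₁ : I → ℤ
      A₁ j = ⟦ a Fin.≟ j ⟧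
      B₁ j = - ⟦ b Fin.≟ j ⟧

      total≡ : + sumᴺ x′ ≡ + sumᴺ x
      total≡ = begin
        + sumᴺ x′                                    ≡⟨ pos-sum x′ ⟩
        sumᶻ (+_ ∘ x′)                               ≡⟨ sumᶻ-cong x′≡ ⟩
        sumᶻ (λ j → + x j + (A₁ j + B₁ j))            ≡⟨ sumᶻ-+ (+_ ∘ x) (λ j → A₁ j + B₁ j) ⟩
        sumᶻ (+_ ∘ x) + sumᶻ (λ j → A₁ j + B₁ j)      ≡⟨ cong₂ _+_ (sym (pos-sum x)) (sumᶻ-+ A₁ B₁) ⟩
        + sumᴺ x + (sumᶻ A₁ + sumᶻ B₁)                ≡⟨ cong (λ z → + sumᴺ x + z) (cong₂ _+_
             (trans (sumᶻ-pick A₁ a (λ i i≢a → ⟦⟧-false (a Fin.≟ i) (i≢a ∘ sym))) (⟦⟧-true (a Fin.≟ a) refl))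
             (trans (sumᶻ-pick B₁ b (λ i i≢b → cong -_ (⟦⟧-false (b Fin.≟ i) (i≢b ∘ sym)))) (cong -_ (⟦⟧-true (b Fin.≟ b) refl)))) ⟩
        + sumᴺ x + 0ℤ                                ≡⟨ ℤ.+-identityʳ (+ sumᴺ x) ⟩
        + sumᴺ x                                     ∎
        where open ≡-Reasoning

    -- A i 0 moves one unit from x (i ⁺) to x i.
    Yˣ-A : ∀ x x′ i → (∀ j → + x′ j ≡ + x j + (⟦ i Fin.≟ j ⟧ + - ⟦ i ⁺ Fin.≟ j ⟧)) → Yˣ x · A i 0ℤ ≈ Yˣ x′
    Yˣ-A x x′ i x′≡ = equal λ j t → begin
      exponent (Yˣ x) j t + exponent (A i 0ℤ) j t
        ≡⟨ cong (_+ exponent (A i 0ℤ) j t) (exponent-Yˣ x j t) ⟩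
      - (+ x (j ⁺)) * ⟦ 1ℤ ℤ.≟ t ⟧ + + x j * ⟦ 0ℤ ℤ.≟ t ⟧ + exponent (A i 0ℤ) j t
        ≡⟨ lem (+ x (j ⁺)) (+ x j) ⟦ 1ℤ ℤ.≟ t ⟧ ⟦ 0ℤ ℤ.≟ t ⟧ ⟦ i Fin.≟ j ⟧ ⟦ i ⁻ Fin.≟ j ⟧ ⟦ i ⁺ Fin.≟ j ⟧ ⟩
      - (+ x (j ⁺) + (⟦ i ⁻ Fin.≟ j ⟧ + - ⟦ i Fin.≟ j ⟧)) * ⟦ 1ℤ ℤ.≟ t ⟧
        + (+ x j + (⟦ i Fin.≟ j ⟧ + - ⟦ i ⁺ Fin.≟ j ⟧)) * ⟦ 0ℤ ℤ.≟ t ⟧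
        ≡⟨ cong₂ (λ p q → - p * ⟦ 1ℤ ℤ.≟ t ⟧ + q * ⟦ 0ℤ ℤ.≟ t ⟧)
             (trans (cong (λ z → + x (j ⁺) + z) (cong₂ (λ p q → p + - q) (shift j) (shift⁺ j))) (sym (x′≡ (j ⁺))))
             (sym (x′≡ j)) ⟩
      - (+ x′ (j ⁺)) * ⟦ 1ℤ ℤ.≟ t ⟧ + + x′ j * ⟦ 0ℤ ℤ.≟ t ⟧
        ≡⟨ exponent-Yˣ x′ j t ⟨
      exponent (Yˣ x′) j t ∎
      where
      open ≡-Reasoning
      shift : ∀ j → ⟦ i ⁻ Fin.≟ j ⟧ ≡ ⟦ i Fin.≟ j ⁺ ⟧
      shift j = ⟦⟧-cong (i ⁻ Fin.≟ j) (i Fin.≟ j ⁺)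
        (λ p → trans (sym (⁻⁺ i)) (cong _⁺ p)) (λ p → trans (cong _⁻ p) (⁺⁻ j))
      shift⁺ : ∀ j → ⟦ i Fin.≟ j ⟧ ≡ ⟦ i ⁺ Fin.≟ j ⁺ ⟧
      shift⁺ j = ⟦⟧-cong (i Fin.≟ j) (i ⁺ Fin.≟ j ⁺) (cong _⁺)
        (λ p → trans (sym (⁺⁻ i)) (trans (cong _⁻ p) (⁺⁻ j)))
      lem : ∀ b a o z p q r →
        - b * o + a * z + (1ℤ * (p * z) + 1ℤ * (p * o) + - 1ℤ * (q * o) + - 1ℤ * (r * z))
        ≡ - (b + (q + - p)) * o + (a + (p + - r)) * z
      lem = solve-∀

    closed-e : ∀ s i {m m′} → ∈𝓜¹[ s ] m → e i m ≈₀ just m′ → ∈𝓜¹[ s ] m′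
    closed-e s i {m} {m′} (x , sum≡ , m≈) em =
      proj₁ moved , trans (proj₁ (proj₂ moved)) sum≡ ,
      S.trans (S.sym m·A≈m′) (S.trans (MonomialLaws.·-cong i m≈ (L.kₑ-1≡0 ε≢0)) (Yˣ-A x (proj₁ moved) i (proj₂ (proj₂ moved))))
      where
      module S = Setoid monomials
      module L = OneRow m x m≈ i
      ε≢0 : ε i m ≢ 0ℤ
      ε≢0 = proj₁ (MonomialLaws.e-elim i {m} {m′} em)
      m·A≈m′ : m · A i (kₑ i m - 1ℤ) ≈ m′
      m·A≈m′ = proj₂ (MonomialLaws.e-elim i {m} {m′} em)
      moved = transfer x i (i ⁺) (λ z → ε≢0 (trans L.ε≡ z))

    closed-f : ∀ s i {m m′} → ∈𝓜¹[ s ] m → f i m ≈₀ just m′ → ∈𝓜¹[ s ] m′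
    closed-f s i {m} {m′} (x , sum≡ , m≈) fm =
      proj₁ moved , trans (proj₁ (proj₂ moved)) sum≡ ,
      S.trans (S.sym m·A≈m′) (S.trans (MonomialLaws.·⁻¹-cong i m≈ (L.k_f≡0 φ≢0))
        (MonomialLaws.move i 0ℤ (Yˣ-A (proj₁ moved) x i x≡)))
      where
      module S = Setoid monomials
      module L = OneRow m x m≈ i
      φ≢0 : φ i m ≢ 0ℤ
      φ≢0 = proj₁ (MonomialLaws.f-elim i {m} {m′} fm)
      m·A≈m′ : m · A i (k_f i m) ⁻¹ ≈ m′
      m·A≈m′ = proj₂ (MonomialLaws.f-elim i {m} {m′} fm)
      moved = transfer x (i ⁺) i (λ z → φ≢0 (trans L.φ≡ z))
      x≡ : ∀ j → + x j ≡ + proj₁ moved j + (⟦ i Fin.≟ j ⟧ + - ⟦ i ⁺ Fin.≟ j ⟧)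
      x≡ j = trans (lem (+ x j) ⟦ i Fin.≟ j ⟧ ⟦ i ⁺ Fin.≟ j ⟧)
                   (cong (_+ (⟦ i Fin.≟ j ⟧ + - ⟦ i ⁺ Fin.≟ j ⟧)) (sym (proj₂ (proj₂ moved) j)))
        where lem : ∀ x p q → x ≡ (x + (q + - p)) + (p + - q)
              lem = solve-∀

  𝓜¹[_] : ℕ → Crystal
  𝓜¹[ s ] = subcrystal 𝓜 ∈𝓜¹[ s ] record
    { e-closed = λ i p eq → OneRowLaws.closed-e s i p (Pointwise.reflexive (λ { refl → equal (λ _ _ → refl) }) eq)
    ; f-closed = λ i p eq → OneRowLaws.closed-f s i p (Pointwise.reflexive (λ { refl → equal (λ _ _ → refl) }) eq) }

  -- For ν = Σ ν_i Λ_i this is Σ ν_i Λ_{i-1}: the coefficient on Λ_j is ν_{j+1}.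
  rotate : DominantWeight → DominantWeight
  rotate ν j = ν (j ⁺)

  module _ (s : ℕ) (μ ν : DominantWeight)
    (well-defined : ∀ {m m′} → ∈𝓜¹[ s ] m → ∈𝓜[ μ ] m′ → ∈𝓜[ ν ] (m · τ 1ℤ m′)) where

    Φ : Crystal.Carrier (𝓜¹[ s ] ⊗ 𝓜[ μ ]) → Crystal.Carrier 𝓜[ ν ]
    Φ ((m , m∈) , (m′ , m′∈)) = m · τ 1ℤ m′ , well-defined m∈ m′∈

{-# OPTIONS --safe #-}
module Submission where

-- An element of 𝓜[ ν ] is Yˣ x₀ · τ 1ℤ (Yˣ x₁) · τ (+ 2) (Yˣ x₂) · …, where every x_k has the
-- same level as ν and x_k is the ground state (ν shifted by k) for large k.  Such a product
-- is peeled off one factor at a time: Path ν is generated by Y^ ν and by products of an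
-- element of 𝓜¹ with τ 1ℤ of an element of Path (rotate ν).  The exponents of an element m′
-- of Path at index 0 are nonnegative and those at negative indices vanish, so for m = Yˣ x the
-- partial sums of m · τ 1ℤ m′ attain their maximum at 0 or at 1 plus a maximum for m′; this is
-- the tensor product rule.  Hence Path is closed under e and f.  Conversely, each m in Path
-- equals Y^ ν times finitely many A⁻¹, each e i removes one of them, and all ε i m vanish
-- only if m ≈ Y^ ν; so m is reached from Y^ ν by the f i, and Path ν is 𝓜[ ν ].

open import Defs
open import Data.Bool.Base using (if_then_else_)
open import Data.Empty using (⊥-elim)
open import Data.Fin.Base using (Fin; zero; suc; toℕ)
open import Data.Fin.Permutation using (permutation)
import Data.Fin.Properties as Fin
open import Data.Integer.Base using (ℤ; +_; -[1+_]; 0ℤ; 1ℤ; _+_; _*_; -_; _-_; _⊔_; ∣_∣)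
import Data.Integer.Base as ℤ
import Data.Integer.Properties as ℤ
open import Data.Integer.Tactic.RingSolver using (solve-∀)
open import Data.Maybe.Base using (just; nothing; map)
open import Data.Maybe.Relation.Binary.Pointwise using (Pointwise; just; nothing)
open import Data.Nat.Base as ℕ using (ℕ; _≤_; zero; suc; z≤n; s≤s)
open import Data.Nat.DivMod using (_%_; _mod_; m<n⇒m%n≡m; n%n≡0)
import Data.Nat.Properties as ℕ
open import Data.Product using (Σ; Σ-syntax; ∃; _×_; _,_; proj₁; proj₂)
open import Data.Sum.Base using (_⊎_; inj₁; inj₂; [_,_]′)
open import Function.Base using (_∘_)
open import Relation.Binary.Bundles using (Setoid)
open import Relation.Binary.PropositionalEquality
  using (_≡_; _≢_; _≗_; refl; sym; trans; cong; cong₂; subst; subst₂; module ≡-Reasoning)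
open import Relation.Nullary using (¬_; Dec; yes; no; does)
open import Relation.Nullary.Decidable using (toSum)
open import Algebra.Properties.AbelianGroup ℤ.+-0-abelianGroup using (∙-cancelˡ)
open import Algebra.Properties.CommutativeMonoid.Sum ℕ.+-0-commutativeMonoid
  using (sum-permute; sum-cong-≗; ∑-distrib-+)

-- Cumulative functions, finite sums and decrements

cumulative-shift : ∀ {y H v} → Cumulative y H v → Cumulative (λ t → y (t - 1ℤ)) (λ t → H (t - 1ℤ)) v
cumulative-shift c = record
  { lo = C.lo ; bottom = λ k k< → C.bottom (k - 1ℤ) (ℤ.<-trans (k-1<k k) k<)
  ; hi = suc C.hi ; top = λ k ≤k → C.top (k - 1ℤ) (<→≤-1 (ℤ.<-≤-trans (ℤ.+<+ ℕ.≤-refl) ≤k))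
  ; step = λ k → C.step (k - 1ℤ) }
  where module C = Cumulative c

-- `bottom` speaks only of indices below `- + lo`; from any negative index finitely many steps lead
-- down there, each adding a zero.
cumulative-vanishes : ∀ {y H v} → Cumulative y H v → (∀ k → k ℤ.< 0ℤ → y k ≡ 0ℤ) → ∀ k → k ℤ.< 0ℤ → H k ≡ 0ℤ
cumulative-vanishes {y} {H} c y≡0 = λ where
    -[1+ a ] _ → descend C.lo a (ℕ.m≤n+m C.lo a)
    (+ a) (ℤ.+<+ ())
  where
  module C = Cumulative c
  -a<-l : ∀ {a l} → l ≤ a → -[1+ a ] ℤ.< - + l
  -a<-l {l = zero} _ = ℤ.-<+
  -a<-l {l = suc l} l<a = ℤ.-<- l<a
  descend : ∀ j a → C.lo ≤ a ℕ.+ j → H -[1+ a ] ≡ 0ℤ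
  descend zero a lo≤ = C.bottom -[1+ a ] (-a<-l (subst (C.lo ≤_) (ℕ.+-identityʳ a) lo≤))
  descend (suc j) a lo≤ = trans (C.step -[1+ a ]) (cong₂ _+_
    (subst (λ z → H -[1+ z ] ≡ 0ℤ) (cong suc (sym (ℕ.+-identityʳ a)))
      (descend j (suc a) (subst (C.lo ≤_) (ℕ.+-suc a j) lo≤)))
    (y≡0 -[1+ a ] ℤ.-<+))

sumᴺ-mono-≤ : ∀ {k} {c d : Fin k → ℕ} → (∀ i → c i ≤ d i) → sumᴺ c ≤ sumᴺ d
sumᴺ-mono-≤ {zero} c≤d = z≤n
sumᴺ-mono-≤ {suc k} c≤d = ℕ.+-mono-≤ (c≤d zero) (sumᴺ-mono-≤ (c≤d ∘ suc))

sumᴺ-mono-< : ∀ {k} {c d : Fin k → ℕ} → (∀ i → c i ≤ d i) → ∀ i → c i ℕ.< d i → sumᴺ c ℕ.< sumᴺ d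
sumᴺ-mono-< c≤d zero c<d = ℕ.+-mono-<-≤ c<d (sumᴺ-mono-≤ (c≤d ∘ suc))
sumᴺ-mono-< c≤d (suc i) c<d = ℕ.+-mono-≤-< (c≤d zero) (sumᴺ-mono-< (c≤d ∘ suc) i c<d)

≤-sumᴺ-≡ : ∀ {k} {c d : Fin k → ℕ} → (∀ i → c i ≤ d i) → sumᴺ c ≡ sumᴺ d → c ≗ d
≤-sumᴺ-≡ c≤d eq i = ℕ.≤∧≮⇒≡ (c≤d i) (λ c<d → ℕ.<⇒≢ (sumᴺ-mono-< c≤d i c<d) eq)

element≤sumᴺ : ∀ {k} (c : Fin k → ℕ) i → c i ≤ sumᴺ c
element≤sumᴺ c zero = ℕ.m≤m+n (c zero) _
element≤sumᴺ c (suc i) = ℕ.≤-trans (element≤sumᴺ (c ∘ suc) i) (ℕ.m≤n+m _ (c zero))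

sumᶻ-snoc : ∀ (h : ℕ → ℤ) k → sumᶻ {suc k} (h ∘ toℕ) ≡ sumᶻ {k} (h ∘ toℕ) + h k
sumᶻ-snoc h zero = ℤ.+-comm (h 0) 0ℤ
sumᶻ-snoc h (suc k) = trans (cong (λ z → h 0 + z) (sumᶻ-snoc (h ∘ suc) k)) (sym (ℤ.+-assoc (h 0) _ _))

module _ {k : ℕ} (c : Fin k → ℕ) (i : Fin k) where

  decrement : Fin k → ℕ
  decrement j = if does (i Fin.≟ j) then ℕ.pred (c j) else c j

  decrement-≤ : ∀ j → decrement j ≤ c j
  decrement-≤ j with i Fin.≟ j
  ... | no _ = ℕ.≤-refl
  ... | yes _ = ℕ.pred[n]≤n

  -- Strictness at `i` leaves room for the decrement. This preserves the condition on `c′` in a path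
  -- when `e i` lowers `c i`.
  ≤-decrement : ∀ {b : Fin k → ℕ} → (∀ j → b j ≤ c j) → b i ℕ.< c i → ∀ j → b j ≤ decrement j
  ≤-decrement b≤c bi<ci j with i Fin.≟ j
  ... | no _ = b≤c j
  ... | yes refl = ℕ.<⇒≤pred bi<ci

  pos-decrement : 0 ℕ.< c i → ∀ j → + decrement j ≡ + c j - ⟦ i Fin.≟ j ⟧
  pos-decrement 0<ci j with i Fin.≟ j
  ... | no _ = sym (ℤ.+-identityʳ (+ c j))
  ... | yes refl with c i | 0<ci
  ...   | suc _ | _ = refl

  decrement-< : 0 ℕ.< c i → decrement i ℕ.< c i
  decrement-< 0<ci with i Fin.≟ i
  ... | no i≢i = ⊥-elim (i≢i refl)
  ... | yes _ = ℕ.≤-reflexive (ℕ.suc-pred (c i) {{ℕ.>-nonZero 0<ci}})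

-- Maxima of the partial sums of a product

-- S is the cumulative function of one i-row of m · τ 1ℤ m′, where m = Yˣ x with a = x i and
-- b = x (i ⁺), and U is the cumulative function of the i-row of m′.
module TensorMaximum (n : ℕ) (3≤n : 3 ≤ n) (a b : ℕ) {U : ℤ → ℤ} {φ : ℤ}
  (U-below : ∀ t → t ℤ.< 0ℤ → U t ≡ 0ℤ) (0≤U0 : 0ℤ ℤ.≤ U 0ℤ) (U-max : IsMax U φ) where

  open Affine.OneRowLaws n 3≤n using (H; view; negative; at-zero; positive)

  S : ℤ → ℤ
  S t = H a b t + U (t - 1ℤ)

  data Region (t : ℤ) : Set where
    before : t ℤ.< 0ℤ → S t ≡ 0ℤ → Region t
    origin : t ≡ 0ℤ → S t ≡ + a → Region t
    after  : 0ℤ ℤ.< t → S t ≡ + a - + b + U (t - 1ℤ) → Region t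

  region : ∀ t → Region t
  region t with view a b t
  ... | negative t<0 eq = before t<0 (cong₂ _+_ eq (U-below (t - 1ℤ) (ℤ.<-trans (k-1<k t) t<0)))
  ... | at-zero refl eq = origin refl (trans (cong₂ _+_ eq (U-below (0ℤ - 1ℤ) ℤ.-<+)) (ℤ.+-identityʳ (+ a)))
  ... | positive 0<t eq = after 0<t (cong (λ z → z + U (t - 1ℤ)) eq)

  0≤φ : 0ℤ ℤ.≤ φ
  0≤φ = ℤ.≤-trans 0≤U0 (proj₁ U-max 0ℤ)

  -- A maximum at a negative index has value 0, and then `0≤U0` makes index 0 a maximum as well.
  attained : ∃ λ k → 0ℤ ℤ.≤ k × U k ≡ φ
  attained with proj₂ U-max
  ... | + k , eq = + k , 0≤+ , eq
  ... | -[1+ k ] , eq = 0ℤ , ℤ.≤-refl , ℤ.≤-antisym (proj₁ U-max 0ℤ)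
    (subst (ℤ._≤ U 0ℤ) (trans (sym (U-below -[1+ k ] ℤ.-<+)) eq) 0≤U0)

  S-origin : S 0ℤ ≡ + a
  S-origin with region 0ℤ
  ... | before (ℤ.+<+ ()) _
  ... | origin _ eq = eq
  ... | after (ℤ.+<+ ()) _

  S-after : ∀ k → 0ℤ ℤ.≤ k → S (k + 1ℤ) ≡ + a - + b + U k
  S-after k 0≤k with region (k + 1ℤ)
  ... | before k+1<0 _ = ⊥-elim (ℤ.<⇒≱ k+1<0 (ℤ.<⇒≤ (≤→<+1 0≤k)))
  ... | origin k+1≡0 _ = ⊥-elim (ℤ.<⇒≢ (≤→<+1 0≤k) (sym k+1≡0))
  ... | after _ eq = trans eq (cong (λ z → + a - + b + U z) (lem k))
    where lem : ∀ k → k + 1ℤ - 1ℤ ≡ k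
          lem = solve-∀

  module _ (φ≤b : φ ℤ.≤ + b) where

    max-0 : IsMax S (+ a)
    max-0 = bounded , 0ℤ , S-origin
      where
      lem : ∀ a b u v → a - (a - b + u) ≡ (b - v) + (v - u)
      lem = solve-∀
      bounded : ∀ t → S t ℤ.≤ + a
      bounded t with region t
      ... | before _ eq = subst (ℤ._≤ + a) (sym eq) 0≤+
      ... | origin _ eq = ℤ.≤-reflexive eq
      ... | after _ eq = subst (ℤ._≤ + a) (sym eq)
              (≤-by₂ φ≤b (proj₁ U-max (t - 1ℤ)) (lem (+ a) (+ b) (U (t - 1ℤ)) φ))

    first-0 : + a ≢ 0ℤ → IsFirst S (+ a) 0ℤ
    first-0 a≢0 = S-origin , least
      where
      least : ∀ t → S t ≡ + a → 0ℤ ℤ.≤ t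
      least t hit with region t
      ... | before _ eq = ⊥-elim (a≢0 (trans (sym hit) eq))
      ... | origin t≡0 _ = ℤ.≤-reflexive (sym t≡0)
      ... | after 0<t _ = ℤ.<⇒≤ 0<t

  -- A tie at a positive index would force `U (t - 1ℤ) ≡ + b`, which exceeds the maximum of `U`. If
  -- `φ` were equal to `+ b`, such a tie would occur.
  last-0 : φ ℤ.< + b → IsLast S (+ a) 0ℤ
  last-0 φ<b = S-origin , greatest
    where
    lem : ∀ a b → b ≡ a - (a - b)
    lem = solve-∀
    lem′ : ∀ a b u → a - (a - b + u) ≡ b - u
    lem′ = solve-∀
    greatest : ∀ t → S t ≡ + a → t ℤ.≤ 0ℤ
    greatest t hit with region t
    ... | before t<0 _ = ℤ.<⇒≤ t<0
    ... | origin t≡0 _ = ℤ.≤-reflexive t≡0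
    ... | after _ eq = ⊥-elim (ℤ.<⇒≱ φ<b (ℤ.≤-trans (ℤ.i-j≤0⇒i≤j b-u≤0) (proj₁ U-max (t - 1ℤ))))
      where
      b-u≤0 : + b - U (t - 1ℤ) ℤ.≤ 0ℤ
      b-u≤0 = ℤ.≤-reflexive (trans (sym (lem′ (+ a) (+ b) (U (t - 1ℤ))))
        (trans (cong (λ z → + a - z) (trans (sym eq) hit)) (ℤ.+-inverseʳ (+ a))))

  module _ (b≤φ : + b ℤ.≤ φ) where

    a≤v : + a ℤ.≤ + a - + b + φ
    a≤v = ≤-by b≤φ (lem (+ a) (+ b) φ)
      where lem : ∀ a b v → a - b + v - a ≡ v - b
            lem = solve-∀

    max-1+ : IsMax S (+ a - + b + φ)
    max-1+ = bounded , proj₁ attained + 1ℤ ,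
           trans (S-after (proj₁ attained) (proj₁ (proj₂ attained))) (cong (λ z → + a - + b + z) (proj₂ (proj₂ attained)))
      where
      bounded : ∀ t → S t ℤ.≤ + a - + b + φ
      bounded t with region t
      ... | before _ eq = subst (ℤ._≤ _) (sym eq) (ℤ.≤-trans 0≤+ a≤v)
      ... | origin _ eq = subst (ℤ._≤ _) (sym eq) a≤v
      ... | after _ eq = subst (ℤ._≤ _) (sym eq) (ℤ.+-monoʳ-≤ (+ a - + b) (proj₁ U-max (t - 1ℤ)))

    -- When `+ b ≡ φ` the origin attains the maximum too, which does not disturb a last maximum but
    -- would disturb a first one; hence the strict inequality in `first-1+`. This is the asymmetry
    -- between the tensor product rules for `e` and `f`.
    last-1+ : ∀ {k} → IsLast U φ k → IsLast S (+ a - + b + φ) (k + 1ℤ)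
    last-1+ {k} (hit , greatest) = trans (S-after k 0≤k) (cong (λ z → + a - + b + z) hit) , greatest′
      where
      0≤k : 0ℤ ℤ.≤ k
      0≤k = ℤ.≤-trans (proj₁ (proj₂ attained)) (greatest _ (proj₂ (proj₂ attained)))
      greatest′ : ∀ t → S t ≡ + a - + b + φ → t ℤ.≤ k + 1ℤ
      greatest′ t hit′ with region t
      ... | before t<0 _ = ℤ.≤-trans (ℤ.<⇒≤ t<0) (ℤ.≤-trans 0≤k (ℤ.<⇒≤ (≤→<+1 ℤ.≤-refl)))
      ... | origin refl _ = ℤ.≤-trans 0≤k (ℤ.<⇒≤ (≤→<+1 ℤ.≤-refl))
      ... | after _ eq = ≤-by (greatest (t - 1ℤ) (∙-cancelˡ (+ a - + b) _ _ (trans (sym eq) hit′))) (lem k t)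
        where lem : ∀ k t → k + 1ℤ - t ≡ k - (t - 1ℤ)
              lem = solve-∀

  first-1+ : + b ℤ.< φ → ∀ {k} → IsFirst U φ k → IsFirst S (+ a - + b + φ) (k + 1ℤ)
  first-1+ b<φ {k} (hit , least) = trans (S-after k 0≤k) (cong (λ z → + a - + b + z) hit) , least′
    where
    0<φ : 0ℤ ℤ.< φ
    0<φ = ℤ.≤-<-trans 0≤+ b<φ
    a<v : + a ℤ.< + a - + b + φ
    a<v = →< (≤-by (<→ b<φ) (lem (+ a) (+ b) φ))
      where lem : ∀ a b v → a - b + v - (1ℤ + a) ≡ v - (1ℤ + b)
            lem = solve-∀
    0≤k : 0ℤ ℤ.≤ k
    0≤k = ℤ.≮⇒≥ (λ k<0 → ℤ.<⇒≢ 0<φ (trans (sym (U-below k k<0)) hit))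
    least′ : ∀ t → S t ≡ + a - + b + φ → k + 1ℤ ℤ.≤ t
    least′ t hit′ with region t
    ... | before _ eq = ⊥-elim (ℤ.<⇒≢ (ℤ.≤-<-trans 0≤+ a<v) (trans (sym eq) hit′))
    ... | origin _ eq = ⊥-elim (ℤ.<⇒≢ a<v (trans (sym eq) hit′))
    ... | after _ eq = ≤-by (least (t - 1ℤ) (∙-cancelˡ (+ a - + b) _ _ (trans (sym eq) hit′))) (lem k t)
      where lem : ∀ k t → t - (k + 1ℤ) ≡ t - 1ℤ - k
            lem = solve-∀

module Decomposition (n : ℕ) (3≤n : 3 ≤ n) where

  open Affine n 3≤n
  open OneRowLaws using (module OneRow; exponent-∏; exponent-Yˣ; H; H-max; transfer; Yˣ-A; closed-e; closed-f)
  open MonomialLaws using (cum)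

  module M = Setoid monomials

  -- Monomials supported from index 0, and the shift

  record SupportedFrom0 (m : Monomial) : Set where
    field
      below    : ∀ i k → k ℤ.< 0ℤ → exponent m i k ≡ 0ℤ
      0≤origin : ∀ i → 0ℤ ℤ.≤ exponent m i 0ℤ

    sum≤-below : ∀ i k → k ℤ.< 0ℤ → sum≤ (exponent m i) (bound m) k ≡ 0ℤ
    sum≤-below i = cumulative-vanishes (cum m i) (below i)

    sum≤-origin : ∀ i → sum≤ (exponent m i) (bound m) 0ℤ ≡ exponent m i 0ℤ
    sum≤-origin i = trans (Cumulative.step (cum m i) 0ℤ)
      (trans (cong (_+ exponent m i 0ℤ) (sum≤-below i (0ℤ - 1ℤ) ℤ.-<+)) (ℤ.+-identityˡ _))

    origin≤φ : ∀ i → exponent m i 0ℤ ℤ.≤ φ i m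
    origin≤φ i = subst (ℤ._≤ φ i m) (sum≤-origin i) (proj₁ (max-sum≤-isMax (vanishes m i)) 0ℤ)

  ·τ-cong : ∀ {m₁ m₂ m₁′ m₂′} → m₁ ≈ m₂ → m₁′ ≈ m₂′ → m₁ · τ 1ℤ m₁′ ≈ m₂ · τ 1ℤ m₂′
  ·τ-cong p q = equal λ i k → cong₂ _+_ (at p i k) (at q i (k - 1ℤ))

  -- `τ 1ℤ` carries `A i k` to `A i (k + 1ℤ)`, so an operator acting at `k` inside the second factor
  -- acts at `k + 1ℤ` on the product.
  exponent-A-shift : ∀ i k j t → exponent (A i (k + 1ℤ)) j t ≡ exponent (A i k) j (t - 1ℤ)
  exponent-A-shift i k j t =
    cong₂ (λ u v → 1ℤ * (⟦ i Fin.≟ j ⟧ * u) + 1ℤ * (⟦ i Fin.≟ j ⟧ * v)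
                   + - 1ℤ * (⟦ i ⁻ Fin.≟ j ⟧ * v) + - 1ℤ * (⟦ i ⁺ Fin.≟ j ⟧ * u)) (shift k) (shift (k + 1ℤ))
    where
    shift : ∀ k → ⟦ (k + 1ℤ) ℤ.≟ t ⟧ ≡ ⟦ k ℤ.≟ (t - 1ℤ) ⟧
    shift k = ⟦⟧-cong ((k + 1ℤ) ℤ.≟ t) (k ℤ.≟ (t - 1ℤ))
      (λ { refl → sym (cancel⁻ k) }) (λ { refl → cancel⁺ t })
      where
      cancel⁻ : ∀ k → k + 1ℤ - 1ℤ ≡ k
      cancel⁻ = solve-∀
      cancel⁺ : ∀ t → t - 1ℤ + 1ℤ ≡ t
      cancel⁺ = solve-∀

  -- The results are compared only where the guard is nonzero, since only there do `kₑ` and `k_f`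
  -- have a meaning.
  guard-map : ∀ {a b : ℤ} {x y : Monomial} {g : Monomial → Monomial} →
    (a ≡ 0ℤ → b ≡ 0ℤ) → (b ≡ 0ℤ → a ≡ 0ℤ) → (a ≢ 0ℤ → x ≈ g y) →
    (if does (a ℤ.≟ 0ℤ) then nothing else just x) ≈₀ map g (if does (b ℤ.≟ 0ℤ) then nothing else just y)
  guard-map {a} {b} a⇒b b⇒a x≈gy with a ℤ.≟ 0ℤ | b ℤ.≟ 0ℤ
  ... | yes _   | yes _   = nothing
  ... | yes a≡0 | no b≢0  = ⊥-elim (b≢0 (a⇒b a≡0))
  ... | no a≢0  | yes b≡0 = ⊥-elim (a≢0 (b⇒a b≡0))
  ... | no a≢0  | no _    = just (x≈gy a≢0)

  -- The tensor product rule

  module TensorRule {m : Monomial} {x : I → ℕ} {m′ : Monomial} (m≈ : m ≈ Yˣ x) (m′-from0 : SupportedFrom0 m′) (i : I) where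

    private
      P : Monomial
      P = m · τ 1ℤ m′

    open SupportedFrom0 m′-from0
    open OneRow m x m≈ i using (sum≤≗H; φ≡; ε≡; wt≡; kₑ-1≡0; k_f≡0)

    open TensorMaximum n 3≤n (x i) (x (i ⁺)) {sum≤ (exponent m′ i) (bound m′)} {φ i m′}
      (sum≤-below i) (subst (0ℤ ℤ.≤_) (sym (sum≤-origin i)) (0≤origin i)) (max-sum≤-isMax (vanishes m′ i))
      using (S; 0≤φ; max-0; first-0; last-0; max-1+; first-1+; last-1+)

    private
      cumP : Cumulative (λ t → exponent m i t + exponent m′ i (t - 1ℤ))
               (λ t → sum≤ (exponent m i) (bound m) t + sum≤ (exponent m′ i) (bound m′) (t - 1ℤ)) (wt m i + wt m′ i)
      cumP = cumulative-+ (cum m i) (cumulative-shift (cum m′ i))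

      sum≤≗S : sum≤ (exponent P i) (bound P) ≗ S
      sum≤≗S t = trans (cumulative-unique (λ _ → refl) (cum P i) cumP t)
        (cong (λ z → z + sum≤ (exponent m′ i) (bound m′) (t - 1ℤ)) (sum≤≗H t))

      P-max : IsMax (sum≤ (exponent P i) (bound P)) (φ i P)
      P-max = max-sum≤-isMax (vanishes P i)

      0≤ε′ : 0ℤ ℤ.≤ ε i m′
      0≤ε′ = 0≤ε (vanishes m′ i)

      wt′≡ : wt m′ i ≡ φ i m′ - ε i m′
      wt′≡ = Crystal.h≡φ-ε 𝓜 i m′

    wt-·τ : wt P i ≡ wt m i + wt m′ i
    wt-·τ = total-unique (λ _ → refl) (cum P i) cumP

    φ-left : φ i m′ ℤ.≤ ε i m → φ i P ≡ φ i m
    φ-left le = trans (IsMax-cong sum≤≗S P-max (max-0 (subst (φ i m′ ℤ.≤_) ε≡ le))) (sym φ≡)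

    φ-right : ε i m ℤ.≤ φ i m′ → φ i P ≡ φ i m′ + wt m i
    φ-right le = trans (IsMax-cong sum≤≗S P-max (max-1+ (subst (ℤ._≤ φ i m′) ε≡ le)))
      (trans (cong (_+ φ i m′) (sym wt≡)) (ℤ.+-comm (wt m i) (φ i m′)))

    -- Only maxima of partial sums from below are analysed; here and in `ε-right`, `ε` is obtained
    -- as `φ` minus the weight.
    ε-left : φ i m′ ℤ.≤ ε i m → ε i P ≡ ε i m - φ i m′ + ε i m′
    ε-left le = trans (MonomialLaws.ε≡φ-wt i P) (trans (cong₂ _-_ (φ-left le) wt-·τ)
      (trans (cong₂ (λ u v → φ i m - (u + v)) (Crystal.h≡φ-ε 𝓜 i m) wt′≡) (lem (φ i m) (ε i m) (φ i m′) (ε i m′))))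
      where lem : ∀ p q r s → p - (p - q + (r - s)) ≡ q - r + s
            lem = solve-∀

    ε-right : ε i m ℤ.≤ φ i m′ → ε i P ≡ ε i m′
    ε-right le = trans (MonomialLaws.ε≡φ-wt i P) (trans (cong₂ _-_ (φ-right le) wt-·τ)
      (trans (cong (λ v → φ i m′ + wt m i - (wt m i + v)) wt′≡) (lem (wt m i) (φ i m′) (ε i m′))))
      where lem : ∀ w r s → r + w - (w + (r - s)) ≡ s
            lem = solve-∀

    -- Since `wt m i` is `φ i m - ε i m`, comparing `φ i m′` with `ε i m` decides which argument of
    -- `⊔` is the larger.
    φ-·τ : φ i P ≡ φ i m ⊔ (φ i m′ + wt m i)
    φ-·τ with ℤ.≤-total (φ i m′) (ε i m)
    ... | inj₁ le = trans (φ-left le) (sym (ℤ.i≥j⇒i⊔j≡i (≤-by le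
            (trans (cong (λ v → φ i m - (φ i m′ + v)) (Crystal.h≡φ-ε 𝓜 i m)) (lem (φ i m) (ε i m) (φ i m′))))))
      where lem : ∀ p q r → p - (r + (p - q)) ≡ q - r
            lem = solve-∀
    ... | inj₂ le = trans (φ-right le) (sym (ℤ.i≤j⇒i⊔j≡j (≤-by le
            (trans (cong (λ v → φ i m′ + v - φ i m) (Crystal.h≡φ-ε 𝓜 i m)) (lem (φ i m) (ε i m) (φ i m′))))))
      where lem : ∀ p q r → r + (p - q) - p ≡ r - q
            lem = solve-∀

    ε-·τ : ε i P ≡ ε i m′ ⊔ (ε i m - wt m′ i)
    ε-·τ with ℤ.≤-total (φ i m′) (ε i m)
    ... | inj₁ le = trans (ε-left le) (sym (trans (ℤ.i≤j⇒i⊔j≡j (≤-by le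
            (trans (cong (λ v → ε i m - v - ε i m′) wt′≡) (lem (ε i m) (φ i m′) (ε i m′)))))
            (trans (cong (λ v → ε i m - v) wt′≡) (lem′ (ε i m) (φ i m′) (ε i m′)))))
      where lem : ∀ q r s → q - (r - s) - s ≡ q - r
            lem = solve-∀
            lem′ : ∀ q r s → q - (r - s) ≡ q - r + s
            lem′ = solve-∀
    ... | inj₂ le = trans (ε-right le) (sym (ℤ.i≥j⇒i⊔j≡i (≤-by le
            (trans (cong (λ v → ε i m′ - (ε i m - v)) wt′≡) (lem (ε i m) (φ i m′) (ε i m′))))))
      where lem : ∀ q r s → s - (q - (r - s)) ≡ r - q
            lem = solve-∀

    e-left : φ i m′ ℤ.< ε i m → e i P ≈₀ map (_· τ 1ℤ m′) (e i m)
    e-left lt = guard-map {ε i P} {ε i m} {P · A i (kₑ i P - 1ℤ)} {m · A i (kₑ i m - 1ℤ)} {_· τ 1ℤ m′}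
      (λ ε≡0 → ⊥-elim (εP≢0 ε≡0)) (λ ε≡0 → ⊥-elim (εm≢0 ε≡0))
      (λ _ → equal λ j t → trans
        (cong (λ k → exponent P j t + exponent (A i k) j t) (trans kP≡0 (sym (kₑ-1≡0 εm≢0))))
        (comm (exponent m j t) (exponent m′ j (t - 1ℤ)) (exponent (A i (kₑ i m - 1ℤ)) j t)))
      where
      comm : ∀ u v w → u + v + w ≡ u + w + v
      comm = solve-∀
      -- `ε-left` writes `ε i P` as a positive difference plus the nonnegative `ε i m′`.
      0<εP : 0ℤ ℤ.< ε i P
      0<εP = subst (0ℤ ℤ.<_) (sym (ε-left (ℤ.<⇒≤ lt))) (→< (≤-by₂ (<→ lt) 0≤ε′ (lem (ε i m) (φ i m′) (ε i m′))))
        where lem : ∀ q r s → q - r + s - (1ℤ + 0ℤ) ≡ q - (1ℤ + r) + (s - 0ℤ)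
              lem = solve-∀
      εP≢0 : ε i P ≢ 0ℤ
      εP≢0 eq = ℤ.<⇒≢ 0<εP (sym eq)
      εm≢0 : ε i m ≢ 0ℤ
      εm≢0 eq = ℤ.<⇒≢ (ℤ.≤-<-trans 0≤φ lt) (sym eq)
      kP≡0 : kₑ i P - 1ℤ ≡ 0ℤ
      kP≡0 = IsLast-cong sum≤≗S (trans (φ-left (ℤ.<⇒≤ lt)) φ≡) (MonomialLaws.e-last i P εP≢0)
        (last-0 (subst (φ i m′ ℤ.<_) ε≡ lt))

    e-right : ε i m ℤ.≤ φ i m′ → e i P ≈₀ map (λ z → m · τ 1ℤ z) (e i m′)
    e-right le = guard-map {ε i P} {ε i m′} {P · A i (kₑ i P - 1ℤ)} {m′ · A i (kₑ i m′ - 1ℤ)} {λ z → m · τ 1ℤ z}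
      (trans (sym (ε-right le))) (trans (ε-right le))
      (λ εP≢0 → equal λ j t → trans
        (cong (λ k → exponent P j t + exponent (A i k) j t) (kP≡ εP≢0))
        (trans (cong (λ z → exponent P j t + z) (exponent-A-shift i (kₑ i m′ - 1ℤ) j t))
               (ℤ.+-assoc (exponent m j t) (exponent m′ j (t - 1ℤ)) _)))
      where
      kP≡ : ε i P ≢ 0ℤ → kₑ i P - 1ℤ ≡ kₑ i m′ - 1ℤ + 1ℤ
      kP≡ εP≢0 = IsLast-cong sum≤≗S (IsMax-cong sum≤≗S P-max (max-1+ le′)) (MonomialLaws.e-last i P εP≢0)
        (last-1+ le′ (MonomialLaws.e-last i m′ (εP≢0 ∘ trans (ε-right le))))
        where
        le′ : + x (i ⁺) ℤ.≤ φ i m′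
        le′ = subst (ℤ._≤ φ i m′) ε≡ le

    f-left : φ i m′ ℤ.≤ ε i m → f i P ≈₀ map (_· τ 1ℤ m′) (f i m)
    f-left le = guard-map {φ i P} {φ i m} {P · A i (k_f i P) ⁻¹} {m · A i (k_f i m) ⁻¹} {_· τ 1ℤ m′}
      (trans (sym (φ-left le))) (trans (φ-left le))
      (λ φP≢0 → equal λ j t → trans
        (cong (λ k → exponent P j t - exponent (A i k) j t) (trans (kP≡0 φP≢0) (sym (k_f≡0 (φP≢0 ∘ trans (φ-left le))))))
        (lem (exponent m j t) (exponent m′ j (t - 1ℤ)) (exponent (A i (k_f i m)) j t)))
      where
      lem : ∀ u v w → u + v - w ≡ u - w + v
      lem = solve-∀
      kP≡0 : φ i P ≢ 0ℤ → k_f i P ≡ 0ℤ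
      kP≡0 φP≢0 = IsFirst-cong sum≤≗S (trans (φ-left le) φ≡) (MonomialLaws.f-first i P φP≢0)
        (first-0 (subst (φ i m′ ℤ.≤_) ε≡ le) (λ z → φP≢0 (trans (φ-left le) (trans φ≡ z))))

    f-right : ε i m ℤ.< φ i m′ → f i P ≈₀ map (λ z → m · τ 1ℤ z) (f i m′)
    f-right lt = guard-map {φ i P} {φ i m′} {P · A i (k_f i P) ⁻¹} {m′ · A i (k_f i m′) ⁻¹} {λ z → m · τ 1ℤ z}
      (λ φ≡0 → ⊥-elim (φP≢0 φ≡0)) (λ φ≡0 → ⊥-elim (φ′≢0 φ≡0))
      (λ _ → equal λ j t → trans
        (cong (λ k → exponent P j t - exponent (A i k) j t) kP≡)
        (trans (cong (λ z → exponent P j t - z) (exponent-A-shift i (k_f i m′) j t))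
               (ℤ.+-assoc (exponent m j t) (exponent m′ j (t - 1ℤ)) _)))
      where
      lt′ : + x (i ⁺) ℤ.< φ i m′
      lt′ = subst (ℤ._< φ i m′) ε≡ lt
      φ′≢0 : φ i m′ ≢ 0ℤ
      φ′≢0 eq = ℤ.<⇒≢ (ℤ.≤-<-trans 0≤+ lt′) (sym eq)
      φP≢0 : φ i P ≢ 0ℤ
      φP≢0 eq = ℤ.<⇒≢ (→< (≤-by₂ (<→ lt′) (0≤+ {x i}) (lem (+ x i) (+ x (i ⁺)) (φ i m′))))
        (trans (sym eq) (IsMax-cong sum≤≗S P-max (max-1+ (ℤ.<⇒≤ lt′))))
        where lem : ∀ a b r → a - b + r - (1ℤ + 0ℤ) ≡ r - (1ℤ + b) + (a - 0ℤ)
              lem = solve-∀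
      kP≡ : k_f i P ≡ k_f i m′ + 1ℤ
      kP≡ = IsFirst-cong sum≤≗S (IsMax-cong sum≤≗S P-max (max-1+ (ℤ.<⇒≤ lt′))) (MonomialLaws.f-first i P φP≢0)
        (first-1+ lt′ (MonomialLaws.f-first i m′ φ′≢0))

  -- Dominant monomials

  exponent-Y^ : ∀ ν j t → exponent (Y^ ν) j t ≡ + ν j * ⟦ 0ℤ ℤ.≟ t ⟧
  exponent-Y^ ν j t = trans (exponent-∏ (λ i → Y i 0ℤ (+ ν i)) j t)
    (trans (sumᶻ-pick _ j (λ i i≢j → trans (cong (λ z → + ν i * (z * d)) (⟦⟧-false (i Fin.≟ j) i≢j)) (lem₀ (+ ν i) d)))
      (trans (cong (λ z → + ν j * (z * d)) (⟦⟧-true (j Fin.≟ j) refl)) (lem₁ (+ ν j) d)))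
    where
    d = ⟦ 0ℤ ℤ.≟ t ⟧
    lem₀ : ∀ a b → a * (0ℤ * b) ≡ 0ℤ
    lem₀ = solve-∀
    lem₁ : ∀ a b → a * (1ℤ * b) ≡ a * b
    lem₁ = solve-∀

  ⟦0≟t-1⟧ : ∀ t → ⟦ 0ℤ ℤ.≟ (t - 1ℤ) ⟧ ≡ ⟦ 1ℤ ℤ.≟ t ⟧
  ⟦0≟t-1⟧ t = ⟦⟧-cong (0ℤ ℤ.≟ (t - 1ℤ)) (1ℤ ℤ.≟ t)
    (λ eq → sym (ℤ.i-j≡0⇒i≡j t 1ℤ (sym eq))) (λ { refl → refl })

  -- The exponents of `Yˣ ν` at index 1 are cancelled by the shifted `Y^ rotate ν`. Thus `Y^ ν` can
  -- be treated as a product like the other elements; iteration gives the ground-state path.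
  Y^-split : ∀ ν → Y^ ν ≈ Yˣ ν · τ 1ℤ (Y^ rotate ν)
  Y^-split ν = equal λ j t → trans (exponent-Y^ ν j t) (sym (trans
    (cong₂ _+_ (exponent-Yˣ ν j t)
      (trans (exponent-Y^ (rotate ν) j (t - 1ℤ)) (cong (+ ν (j ⁺) *_) (⟦0≟t-1⟧ t))))
    (lem (+ ν (j ⁺)) ⟦ 1ℤ ℤ.≟ t ⟧ (+ ν j * ⟦ 0ℤ ℤ.≟ t ⟧))))
    where lem : ∀ a b c → - a * b + c + a * b ≡ c
          lem = solve-∀

  Yˣ-cong : ∀ {x x′} → x ≗ x′ → Yˣ x ≈ Yˣ x′
  Yˣ-cong {x} {x′} p = equal λ j t → trans (exponent-Yˣ x j t)
    (trans (cong₂ (λ u v → - (+ u) * ⟦ 1ℤ ℤ.≟ t ⟧ + + v * ⟦ 0ℤ ℤ.≟ t ⟧) (p (j ⁺)) (p j)) (sym (exponent-Yˣ x′ j t)))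

  -- A row of `Y^ ν` is written as a row of some `Yˣ` with exponent 0 at index 1, so that `H-max`
  -- applies.
  module Highest {m : Monomial} {ν : DominantWeight} (m≈ : m ≈ Y^ ν) (i : I) where

    private
      y≗ : exponent m i ≗ λ t → - (+ 0) * ⟦ 1ℤ ℤ.≟ t ⟧ + + ν i * ⟦ 0ℤ ℤ.≟ t ⟧
      y≗ t = trans (at m≈ i t) (trans (exponent-Y^ ν i t) (lem ⟦ 1ℤ ℤ.≟ t ⟧ (+ ν i * ⟦ 0ℤ ℤ.≟ t ⟧)))
        where lem : ∀ b c → c ≡ - (+ 0) * b + c
              lem = solve-∀

      cumH : Cumulative (λ t → - (+ 0) * ⟦ 1ℤ ℤ.≟ t ⟧ + + ν i * ⟦ 0ℤ ℤ.≟ t ⟧) (H (ν i) 0) (- (+ 0) * 1ℤ + + ν i * 1ℤ)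
      cumH = cumulative-+ (cumulative-* (- (+ 0)) (cumulative-δ 1ℤ)) (cumulative-* (+ ν i) (cumulative-δ 0ℤ))

    φ≡ : φ i m ≡ + ν i
    φ≡ = IsMax-cong (cumulative-unique y≗ (cum m i) cumH) (max-sum≤-isMax (vanishes m i)) (H-max (ν i) 0)

    wt≡ : wt m i ≡ + ν i
    wt≡ = trans (total-unique y≗ (cum m i) cumH) (lem (+ ν i))
      where lem : ∀ a → - (+ 0) * 1ℤ + a * 1ℤ ≡ a
            lem = solve-∀

    ε≡0 : ε i m ≡ 0ℤ
    ε≡0 = trans (MonomialLaws.ε≡φ-wt i m) (trans (cong₂ _-_ φ≡ wt≡) (ℤ.+-inverseʳ (+ ν i)))

  -- Potentials on the cycle

  sumᴺ-rotate⁻ : ∀ c → sumᴺ (λ i → c (i ⁻)) ≡ sumᴺ c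
  sumᴺ-rotate⁻ c = sym (sum-permute c (permutation _⁻ _⁺ ⁺⁻ ⁻⁺))

  -- `c i` sums `g` from 0 to `i`. The recursion is then immediate except at the wrap from `n - 1`
  -- to 0, where the sum over the whole cycle must vanish.
  antiderivative : (g : I → ℤ) → sumᶻ g ≡ 0ℤ → ∃ λ (c : I → ℤ) → ∀ i → c i ≡ c (i ⁻) + g i
  antiderivative g Σg≡0 = c , λ i → subst (λ k → c k ≡ c (i ⁻) + g k) (⁻⁺ i) (c-⁺ (i ⁻))
    where
    h : ℕ → ℤ
    h k = g (k mod n)

    h-toℕ : ∀ i → h (toℕ i) ≡ g i
    h-toℕ i = cong g (Fin.toℕ-injective (trans (Fin.toℕ-fromℕ< _) (m<n⇒m%n≡m (Fin.toℕ<n i))))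

    partial : ℕ → ℤ
    partial k = sumᶻ {k} (h ∘ toℕ)

    c : I → ℤ
    c i = partial (suc (toℕ i))

    partial-⁺ : ∀ i → partial (toℕ (i ⁺)) ≡ c i
    partial-⁺ i with suc (toℕ i) ℕ.<? n
    ... | yes i+1<n = cong partial (trans (Fin.toℕ-fromℕ< _) (m<n⇒m%n≡m i+1<n))
    ... | no i+1≮n = trans (cong partial (trans (Fin.toℕ-fromℕ< _) (trans (cong (_% n) i+1≡n) (n%n≡0 n))))
                       (sym (trans (cong partial i+1≡n) (trans (sumᶻ-cong h-toℕ) Σg≡0)))
      where
      i+1≡n : suc (toℕ i) ≡ n
      i+1≡n = ℕ.≤-antisym (Fin.toℕ<n i) (ℕ.≮⇒≥ i+1≮n)

    c-⁺ : ∀ i → c (i ⁺) ≡ c i + g (i ⁺)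
    c-⁺ i = trans (sumᶻ-snoc h (toℕ (i ⁺))) (cong₂ _+_ (partial-⁺ i) (h-toℕ (i ⁺)))

  -- The difference `ν i - x i` has an antiderivative because the levels agree. Adding a large
  -- constant keeps it a solution and makes it at least `b`.
  potential : ∀ (x ν : I → ℕ) → sumᴺ x ≡ sumᴺ ν → (b : I → ℕ) →
    ∃ λ (c : I → ℕ) → (∀ i → x i ℕ.+ c i ≡ ν i ℕ.+ c (i ⁻)) × (∀ i → b i ≤ c i)
  potential x ν Σx≡Σν b = c ,
    (λ i → ℤ.+-injective (eq i)) , (λ i → ℤ.drop‿+≤+ (subst (+ b i ℤ.≤_) (sym (c≡ i)) (b≤ i)))
    where
    g : I → ℤ
    g i = + ν i + - (+ x i)

    Σ-neg : ∀ {k} (c : Fin k → ℤ) → sumᶻ (λ i → - c i) ≡ - sumᶻ c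
    Σ-neg {zero} c = refl
    Σ-neg {suc k} c = trans (cong (λ z → - c zero + z) (Σ-neg (c ∘ suc))) (sym (ℤ.neg-distrib-+ (c zero) _))

    Σg≡0 : sumᶻ g ≡ 0ℤ
    Σg≡0 = trans (sumᶻ-+ (+_ ∘ ν) (λ i → - (+ x i))) (trans
      (cong₂ _+_ (sym (pos-sum ν)) (trans (Σ-neg (+_ ∘ x)) (cong -_ (trans (sym (pos-sum x)) (cong +_ Σx≡Σν)))))
      (ℤ.+-inverseʳ (+ sumᴺ ν)))

    d : I → ℤ
    d = proj₁ (antiderivative g Σg≡0)

    u v : I → ℕ
    u i = ∣ d i ∣
    -- `sumᴺ v` will be the constant added: it is at least `∣ d i ∣ + b i` for every `i`.
    v i = u i ℕ.+ b i

    b≤ : ∀ i → + b i ℤ.≤ d i + + sumᴺ v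
    b≤ i = ≤-by₂ (i≤∣i∣ (- d i)) (ℤ.+≤+ (element≤sumᴺ v i))
      (trans (lem (d i) (+ sumᴺ v) (+ u i) (+ b i))
        (cong (λ z → + z - - d i + (+ sumᴺ v - + v i)) (sym (ℤ.∣-i∣≡∣i∣ (d i)))))
      where lem : ∀ d s u b → d + s - b ≡ u - - d + (s - (u + b))
            lem = solve-∀

    c : I → ℕ
    c i = ∣ d i + + sumᴺ v ∣

    c≡ : ∀ i → + c i ≡ d i + + sumᴺ v
    c≡ i = ℤ.0≤i⇒+∣i∣≡i (ℤ.≤-trans 0≤+ (b≤ i))

    eq : ∀ i → + x i + + c i ≡ + ν i + + c (i ⁻)
    eq i = trans (cong (λ z → + x i + z) (trans (c≡ i) (cong (_+ + sumᴺ v) (proj₂ (antiderivative g Σg≡0) i))))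
      (trans (lem (+ x i) (d (i ⁻)) (+ ν i) (+ sumᴺ v)) (cong (λ z → + ν i + z) (sym (c≡ (i ⁻)))))
      where lem : ∀ x d ν s → x + (d + (ν + - x) + s) ≡ ν + (d + s)
            lem = solve-∀

  -- Paths

  -- c i is the number of factors A i 0ℤ ⁻¹ in m / Y^ ν, and N is the number of all factors
  -- A⁻¹ in it.  The exponents c are determined by m only up to adding a constant; the
  -- condition on c′ leaves enough of them for e i to remove one.
  data Path : DominantWeight → (I → ℕ) → ℕ → Monomial → Set where
    ground : ∀ {ν m} → m ≈ Y^ ν → Path ν (λ _ → 0) 0 m
    step   : ∀ {ν c c′ N m m′} x → m ≈ Yˣ x · τ 1ℤ m′ →
             (∀ i → x i ℕ.+ c i ≡ ν i ℕ.+ c (i ⁻)) → (∀ i → c′ (i ⁻) ≤ c i) →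
             Path (rotate ν) c′ N m′ → Path ν c (sumᴺ c ℕ.+ N) m

  module _ {m : Monomial} {x : I → ℕ} {m′ : Monomial} (m≈ : m ≈ Yˣ x · τ 1ℤ m′) (m′-from0 : SupportedFrom0 m′) where
    open SupportedFrom0 m′-from0

    origin-·τ : ∀ i → exponent m i 0ℤ ≡ + x i
    origin-·τ i = trans (at m≈ i 0ℤ)
      (trans (cong₂ _+_ (exponent-Yˣ x i 0ℤ) (below i (0ℤ - 1ℤ) ℤ.-<+)) (lem (+ x (i ⁺)) (+ x i)))
      where lem : ∀ a b → - a * 0ℤ + b * 1ℤ + 0ℤ ≡ b
            lem = solve-∀

    from0-·τ : SupportedFrom0 m
    from0-·τ = record
      { below = λ { i -[1+ k ] _ → trans (at m≈ i _)
                      (cong₂ _+_ (trans (exponent-Yˣ x i -[1+ k ]) (lem (+ x (i ⁺)) (+ x i)))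
                        (below i (-[1+ k ] - 1ℤ) ℤ.-<+))
                  ; i (+ k) (ℤ.+<+ ()) }
      ; 0≤origin = λ i → subst (0ℤ ℤ.≤_) (sym (origin-·τ i)) 0≤+ }
      where lem : ∀ a b → - a * 0ℤ + b * 0ℤ ≡ 0ℤ
            lem = solve-∀

  Y^-from0 : ∀ ν → SupportedFrom0 (Y^ ν)
  Y^-from0 ν = record
    { below = λ { i -[1+ k ] _ → trans (exponent-Y^ ν i -[1+ k ]) (ℤ.*-zeroʳ (+ ν i))
                ; i (+ k) (ℤ.+<+ ()) }
    ; 0≤origin = λ i → subst (0ℤ ℤ.≤_) (sym (trans (exponent-Y^ ν i 0ℤ) (ℤ.*-identityʳ (+ ν i)))) 0≤+ }

  Y^-split-≈ : ∀ {m ν} → m ≈ Y^ ν → m ≈ Yˣ ν · τ 1ℤ (Y^ rotate ν)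
  Y^-split-≈ {m} {ν} m≈ = M.trans {m} {Y^ ν} {Yˣ ν · τ 1ℤ (Y^ rotate ν)} m≈ (Y^-split ν)

  path-from0 : ∀ {ν c N m} → Path ν c N m → SupportedFrom0 m
  path-from0 {ν} {m = m} (ground m≈) = from0-·τ {m} {ν} {Y^ rotate ν} (Y^-split-≈ {m} {ν} m≈) (Y^-from0 (rotate ν))
  path-from0 {m = m} (step {m′ = m′} x m≈ _ _ p) = from0-·τ {m} {x} {m′} m≈ (path-from0 p)

  -- The exponent at index 0 is `x i`, since the second factor is shifted to indices at least 1.
  -- This form of the equation for `x` avoids a case distinction on the path.
  path-origin : ∀ {ν c N m} → Path ν c N m → ∀ i → exponent m i 0ℤ + + c i ≡ + ν i + + c (i ⁻)
  path-origin {ν} {m = m} (ground m≈) i =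
    cong (_+ 0ℤ) (origin-·τ {m} {ν} {Y^ rotate ν} (Y^-split-≈ {m} {ν} m≈) (Y^-from0 (rotate ν)) i)
  path-origin {c = c} {m = m} (step {m′ = m′} x m≈ xc _ p) i =
    trans (cong (_+ + c i) (origin-·τ {m} {x} {m′} m≈ (path-from0 p) i)) (cong +_ (xc i))

  -- Operators on paths

  map-image : ∀ {g : Monomial → Monomial} {y z m} → y ≈₀ map g z → y ≈₀ just m → ∃ λ w → z ≈₀ just w × m ≈ g w
  map-image {z = just w} (just y≈gw) (just y≈m) = w , just M.refl , M.trans (M.sym y≈m) y≈gw

  module _ {m : Monomial} {x : I → ℕ} {m′ : Monomial} (m≈ : m ≈ Yˣ x · τ 1ℤ m′) (m′-from0 : SupportedFrom0 m′)
    (i : I) {m₂ : Monomial} where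
    open TensorRule {Yˣ x} {x} {m′} (M.refl {Yˣ x}) m′-from0 i

    private
      P : Monomial
      P = Yˣ x · τ 1ℤ m′

      ≈₀-respˡ : ∀ {y z} → y ≈₀ z → y ≈₀ just m₂ → z ≈₀ just m₂
      ≈₀-respˡ (just p) (just q) = just (M.trans (M.sym p) q)

      e-P : e i m ≈₀ just m₂ → e i P ≈₀ just m₂
      e-P = ≈₀-respˡ {e i m} {e i P} (MonomialLaws.e-cong i {m} {P} m≈)

      f-P : f i m ≈₀ just m₂ → f i P ≈₀ just m₂
      f-P = ≈₀-respˡ {f i m} {f i P} (MonomialLaws.f-cong i {m} {P} m≈)

    -- The inequality is kept because `EOnFirst` derives from it that some `A i 0ℤ ⁻¹` can be
    -- removed. In `f-·τ⁻` the inequality kept rules out the second case for a `ground` path.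
    e-·τ⁻ : e i m ≈₀ just m₂ →
      (φ i m′ ℤ.< ε i (Yˣ x) × ∃ λ w → e i (Yˣ x) ≈₀ just w × m₂ ≈ w · τ 1ℤ m′) ⊎
      (∃ λ w → e i m′ ≈₀ just w × m₂ ≈ Yˣ x · τ 1ℤ w)
    e-·τ⁻ em =
      [ (λ φ<ε → inj₁ (φ<ε , map-image {_· τ 1ℤ m′} {e i P} {e i (Yˣ x)} (e-left φ<ε) (e-P em)))
      , (λ φ≮ε → inj₂ (map-image {λ z → Yˣ x · τ 1ℤ z} {e i P} {e i m′} (e-right (ℤ.≮⇒≥ φ≮ε)) (e-P em)))
      ]′ (toSum (φ i m′ ℤ.<? ε i (Yˣ x)))

    f-·τ⁻ : f i m ≈₀ just m₂ →
      (∃ λ w → f i (Yˣ x) ≈₀ just w × m₂ ≈ w · τ 1ℤ m′) ⊎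
      (ε i (Yˣ x) ℤ.< φ i m′ × ∃ λ w → f i m′ ≈₀ just w × m₂ ≈ Yˣ x · τ 1ℤ w)
    f-·τ⁻ fm =
      [ (λ φ≤ε → inj₁ (map-image {_· τ 1ℤ m′} {f i P} {f i (Yˣ x)} (f-left φ≤ε) (f-P fm)))
      , (λ φ≰ε → let ε<φ = ℤ.≰⇒> φ≰ε in
          inj₂ (ε<φ , map-image {λ z → Yˣ x · τ 1ℤ z} {f i P} {f i m′} (f-right ε<φ) (f-P fm)))
      ]′ (toSum (φ i m′ ℤ.≤? ε i (Yˣ x)))

  ∃Path : DominantWeight → Monomial → Set
  ∃Path ν m = ∃ λ c → ∃ λ N → Path ν c N m

  -- `potential` supplies `c`, with the condition on `c′` as its lower bound.
  path-cons : ∀ {s ν m m′ m₂} → level ν ≡ s → ∈𝓜¹[ s ] m → ∃Path (rotate ν) m′ → m₂ ≈ m · τ 1ℤ m′ → ∃Path ν m₂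
  path-cons {ν = ν} {m = m} {m′ = m′} refl (x , Σx≡s , m≈) (c′ , N , p) m₂≈ =
    let c , xc , c′≤c = potential x ν Σx≡s (λ i → c′ (i ⁻))
    in c , sumᴺ c ℕ.+ N , step {m′ = m′} x (M.trans m₂≈ (·τ-cong {m} {Yˣ x} {m′} m≈ (M.refl {m′}))) xc c′≤c p

  -- Summed over the cycle, `c` and its rotation contribute equally and cancel.
  step-level : ∀ (x ν c : I → ℕ) → (∀ i → x i ℕ.+ c i ≡ ν i ℕ.+ c (i ⁻)) → sumᴺ x ≡ sumᴺ ν
  step-level x ν c xc = ℕ.+-cancelʳ-≡ (sumᴺ c) (sumᴺ x) (sumᴺ ν) (begin
    sumᴺ x ℕ.+ sumᴺ c                    ≡⟨ ∑-distrib-+ x c ⟨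
    sumᴺ (λ i → x i ℕ.+ c i)             ≡⟨ sum-cong-≗ xc ⟩
    sumᴺ (λ i → ν i ℕ.+ c (i ⁻))         ≡⟨ ∑-distrib-+ ν (λ i → c (i ⁻)) ⟩
    sumᴺ ν ℕ.+ sumᴺ (λ i → c (i ⁻))      ≡⟨ cong (sumᴺ ν ℕ.+_) (sumᴺ-rotate⁻ c) ⟩
    sumᴺ ν ℕ.+ sumᴺ c                    ∎)
    where open ≡-Reasoning

  f-path : ∀ {ν c N m} i {m₂} → Path ν c N m → f i m ≈₀ just m₂ → ∃Path ν m₂
  f-path {ν} {m = m} i (ground m≈) fm =
    [ (λ (w , fw , m₂≈) → path-cons {m = w} {m′ = Y^ rotate ν} refl
        (closed-f (level ν) i {Yˣ ν} {w} (ν , refl , M.refl {Yˣ ν}) fw) (_ , _ , ground (M.refl {Y^ rotate ν})) m₂≈)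
    -- In the ground state `ε i (Yˣ ν)` and `φ i (Y^ rotate ν)` both equal `+ ν (i ⁺)`, and for `f`
    -- a tie goes to the first factor. So the ground path behind it stays intact.
    , (λ (lt , _) → ⊥-elim (ℤ.<⇒≢ lt (trans (OneRow.ε≡ (Yˣ ν) ν (M.refl {Yˣ ν}) i)
        (sym (Highest.φ≡ {Y^ rotate ν} {rotate ν} (M.refl {Y^ rotate ν}) i)))))
    ]′ (f-·τ⁻ {m} {ν} {Y^ rotate ν} (Y^-split-≈ {m} {ν} m≈) (Y^-from0 (rotate ν)) i fm)
  f-path {ν} {c} {m = m} i (step {m′ = m′} x m≈ xc c′≤c p) fm =
    [ (λ (w , fw , m₂≈) → path-cons {m = w} {m′ = m′} refl
        (closed-f (level ν) i {Yˣ x} {w} (x , step-level x ν c xc , M.refl {Yˣ x}) fw) (_ , _ , p) m₂≈)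
    , (λ (_ , w , fw , m₂≈) → path-cons {m = Yˣ x} {m′ = w} refl
        (x , step-level x ν c xc , M.refl {Yˣ x}) (f-path i p fw) m₂≈)
    ]′ (f-·τ⁻ {m} {x} {m′} m≈ (path-from0 p) i fm)

  module EOnFirst {ν : DominantWeight} {c c′ : I → ℕ} {N : ℕ} {m′ : Monomial} (x : I → ℕ)
    (xc : ∀ i → x i ℕ.+ c i ≡ ν i ℕ.+ c (i ⁻)) (c′≤c : ∀ i → c′ (i ⁻) ≤ c i)
    (p : Path (rotate ν) c′ N m′) (i : I) (φ<ε : φ i m′ ℤ.< ε i (Yˣ x)) {w : Monomial} (ew : e i (Yˣ x) ≈₀ just w) where

    module R = OneRow (Yˣ x) x (M.refl {Yˣ x}) i

    εx≢0 : ε i (Yˣ x) ≢ 0ℤ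
    εx≢0 = proj₁ (MonomialLaws.e-elim i {Yˣ x} {w} ew)

    moved = transfer x i (i ⁺) (λ z → εx≢0 (trans R.ε≡ z))
    x₂ = proj₁ moved

    w≈ : w ≈ Yˣ x₂
    w≈ = M.trans (M.sym (proj₂ (MonomialLaws.e-elim i {Yˣ x} {w} ew)))
      (M.trans (MonomialLaws.·-cong {Yˣ x} {Yˣ x} i {kₑ i (Yˣ x) - 1ℤ} {0ℤ} (M.refl {Yˣ x}) (R.kₑ-1≡0 εx≢0))
        (Yˣ-A x x₂ i (proj₂ (proj₂ moved))))

    -- e i acts on Yˣ x only if x (i ⁺) exceeds φ i m′, hence exceeds exponent m′ i 0ℤ; by the
    -- equations for c and c′ this says c i - c′ (i ⁻) > c (i ⁺) - c′ i, where the right side is ≥ 0.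
    c′i⁻<ci : c′ (i ⁻) ℕ.< c i
    c′i⁻<ci = ℤ.drop‿+<+ (→< (≤-by₂
      {1ℤ + + c′ (i ⁻)} {+ c i} {1ℤ + exponent m′ i 0ℤ} {+ x (i ⁺)} {+ c′ i} {+ c (i ⁺)}
      (<→ y<x) (ℤ.+≤+ (subst (λ k → c′ k ≤ c (i ⁺)) (⁺⁻ i) (c′≤c (i ⁺))))
      (begin
        + c i - (1ℤ + + c′ (i ⁻))
          ≡⟨ lem₁ (+ ν (i ⁺)) (+ c i) (+ c′ (i ⁻)) ⟩
        (+ ν (i ⁺) + + c i) - (+ ν (i ⁺) + + c′ (i ⁻)) - 1ℤ
          ≡⟨ cong₂ (λ u v → u - v - 1ℤ)
               (trans (cong (λ k → + ν (i ⁺) + + c k) (sym (⁺⁻ i))) (cong +_ (sym (xc (i ⁺)))))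
               (sym (path-origin p i)) ⟩
        (+ x (i ⁺) + + c (i ⁺)) - (exponent m′ i 0ℤ + + c′ i) - 1ℤ
          ≡⟨ lem₂ (+ x (i ⁺)) (+ c (i ⁺)) (exponent m′ i 0ℤ) (+ c′ i) ⟩
        + x (i ⁺) - (1ℤ + exponent m′ i 0ℤ) + (+ c (i ⁺) - + c′ i) ∎)))
      where
      open ≡-Reasoning
      y<x : exponent m′ i 0ℤ ℤ.< + x (i ⁺)
      y<x = subst (exponent m′ i 0ℤ ℤ.<_) R.ε≡ (ℤ.≤-<-trans (SupportedFrom0.origin≤φ (path-from0 p) i) φ<ε)
      lem₁ : ∀ a b d → b - (1ℤ + d) ≡ (a + b) - (a + d) - 1ℤ
      lem₁ = solve-∀
      lem₂ : ∀ a b d f → (a + b) - (d + f) - 1ℤ ≡ a - (1ℤ + d) + (b - f)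
      lem₂ = solve-∀

    c₂ : I → ℕ
    c₂ = decrement c i

    0<ci : 0 ℕ.< c i
    0<ci = ℕ.≤-<-trans z≤n c′i⁻<ci

    -- Lowering `c i` affects the equations at `i` and `i ⁺`, exactly the two places where `e i`
    -- changes `x`.
    x₂c₂ : ∀ j → x₂ j ℕ.+ c₂ j ≡ ν j ℕ.+ c₂ (j ⁻)
    x₂c₂ j = ℤ.+-injective (begin
      + x₂ j + + c₂ j
        ≡⟨ cong₂ _+_ (proj₂ (proj₂ moved) j) (pos-decrement c i 0<ci j) ⟩
      + x j + (⟦ i Fin.≟ j ⟧ + - ⟦ i ⁺ Fin.≟ j ⟧) + (+ c j - ⟦ i Fin.≟ j ⟧)
        ≡⟨ lem (+ x j) ⟦ i Fin.≟ j ⟧ ⟦ i ⁺ Fin.≟ j ⟧ (+ c j) ⟩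
      + x j + + c j - ⟦ i ⁺ Fin.≟ j ⟧
        ≡⟨ cong₂ _-_ (cong +_ (xc j)) (⟦⟧-cong (i ⁺ Fin.≟ j) (i Fin.≟ j ⁻)
             (λ i⁺≡j → trans (sym (⁺⁻ i)) (cong _⁻ i⁺≡j)) (λ i≡j⁻ → trans (cong _⁺ i≡j⁻) (⁻⁺ j))) ⟩
      + ν j + + c (j ⁻) - ⟦ i Fin.≟ j ⁻ ⟧
        ≡⟨ ℤ.+-assoc (+ ν j) (+ c (j ⁻)) (- ⟦ i Fin.≟ j ⁻ ⟧) ⟩
      + ν j + (+ c (j ⁻) - ⟦ i Fin.≟ j ⁻ ⟧)
        ≡⟨ cong (λ z → + ν j + z) (pos-decrement c i 0<ci (j ⁻)) ⟨
      + ν j + + c₂ (j ⁻) ∎)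
      where
      open ≡-Reasoning
      lem : ∀ a p q b → a + (p + - q) + (b - p) ≡ a + b - q
      lem = solve-∀

  -- A `ground` path is annihilated. Otherwise `e i` lowers `c i` or acts deeper in the path; in the
  -- latter case the pointwise bound from the recursion preserves the condition linking `c` with the
  -- next potential.
  e-path : ∀ {ν c N m} i {m₂} → Path ν c N m → e i m ≈₀ just m₂ →
    ∃ λ c₂ → ∃ λ N₂ → Path ν c₂ N₂ m₂ × (∀ j → c₂ j ≤ c j) × N₂ ℕ.< N
  e-path {ν} {m = m} i {m₂} (ground m≈) em =
    ⊥-elim (proj₁ (MonomialLaws.e-elim i {m} {m₂} em) (Highest.ε≡0 {m} {ν} m≈ i))
  e-path {ν} {c} {m = m} i {m₂} (step {c′ = c′} {N = N} {m′ = m′} x m≈ xc c′≤c p) em =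
    [ (λ (φ<ε , w , ew , m₂≈) → let open EOnFirst {ν} {c} x xc c′≤c p i φ<ε {w} ew in
        c₂ , sumᴺ c₂ ℕ.+ N ,
        step {m′ = m′} x₂ (M.trans m₂≈ (·τ-cong {w} {Yˣ x₂} {m′} w≈ (M.refl {m′}))) x₂c₂
          (≤-decrement c i c′≤c c′i⁻<ci) p ,
        decrement-≤ c i , ℕ.+-monoˡ-< N (sumᴺ-mono-< (decrement-≤ c i) i (decrement-< c i 0<ci)))
    , (λ (w , ew , m₂≈) → let c₂′ , N₂ , p₂ , c₂′≤c′ , N₂<N = e-path i p ew in
        c , _ , step {m′ = w} x m₂≈ xc (λ j → ℕ.≤-trans (c₂′≤c′ (j ⁻)) (c′≤c j)) p₂ ,
        (λ _ → ℕ.≤-refl) , ℕ.+-monoʳ-< (sumᴺ c) N₂<N)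
    ]′ (e-·τ⁻ {m} {x} {m′} m≈ (path-from0 p) i em)

  -- By the tensor product rule every `ε i m′` vanishes and `x (i ⁺)` is at most `wt m′ i`. By
  -- induction `m′` is `Y^ rotate ν`, so `x` is bounded by `ν`, and equal levels force `x ≗ ν`.
  path-highest : ∀ {ν c N m} → Path ν c N m → (∀ i → ε i m ≡ 0ℤ) → m ≈ Y^ ν
  path-highest (ground m≈) _ = m≈
  path-highest {ν} {c} {m = m} (step {m′ = m′} x m≈ xc _ p) ε≡0 =
    M.trans m≈ (M.trans (·τ-cong {Yˣ x} {Yˣ ν} {m′} {Y^ rotate ν} (Yˣ-cong x≗ν) m′≈) (M.sym (Y^-split ν)))
    where
    ⊔≡0 : ∀ i → ε i m′ ⊔ (ε i (Yˣ x) - wt m′ i) ≡ 0ℤ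
    ⊔≡0 i = trans (sym (TensorRule.ε-·τ {Yˣ x} {x} {m′} (M.refl {Yˣ x}) (path-from0 p) i))
                  (trans (sym (MonomialLaws.ε-cong i {m} {Yˣ x · τ 1ℤ m′} m≈)) (ε≡0 i))

    m′≈ : m′ ≈ Y^ (rotate ν)
    m′≈ = path-highest p (λ i → ℤ.≤-antisym (ℤ.≤-trans (ℤ.i≤i⊔j _ _) (ℤ.≤-reflexive (⊔≡0 i))) (0≤ε (vanishes m′ i)))

    x⁺≤ν⁺ : ∀ i → + x (i ⁺) ℤ.≤ + ν (i ⁺)
    x⁺≤ν⁺ i = subst₂ ℤ._≤_ (OneRow.ε≡ (Yˣ x) x M.refl i) (Highest.wt≡ {m′} {rotate ν} m′≈ i)
      (ℤ.i-j≤0⇒i≤j (ℤ.≤-trans (ℤ.i≤j⊔i (ε i m′) _) (ℤ.≤-reflexive (⊔≡0 i))))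

    x≗ν : x ≗ ν
    x≗ν = ≤-sumᴺ-≡ (λ i → subst (λ k → x k ≤ ν k) (⁻⁺ i) (ℤ.drop‿+≤+ (x⁺≤ν⁺ (i ⁻)))) (step-level x ν c xc)

  -- Paths as the elements of `𝓜[ ν ]`

  ∈𝓜⇒path : ∀ {ν m} → ∈𝓜[ ν ] m → ∃Path ν m
  ∈𝓜⇒path (highest m≈) = _ , _ , ground m≈
  ∈𝓜⇒path (e-closed i m∈ em) =
    let _ , _ , p = ∈𝓜⇒path m∈
        c , N , p₂ , _ = e-path i p em
    in c , N , p₂
  ∈𝓜⇒path (f-closed i m∈ fm) = f-path i (proj₂ (proj₂ (∈𝓜⇒path m∈))) fm

  -- As long as some `ε i m` is nonzero, `e i` leads to a path with smaller `N`, and `f i` leads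
  -- back. The bound `k` on `N` makes this descent structural.
  path⇒∈𝓜 : ∀ {ν c N m} → Path ν c N m → ∈𝓜[ ν ] m
  path⇒∈𝓜 {N = N} = descend (suc N) ℕ.≤-refl
    where
    descend : ∀ k {ν c N m} → N ℕ.< k → Path ν c N m → ∈𝓜[ ν ] m
    descend (suc k) {ν} {m = m} N<k p =
      [ (λ ε≡0 → highest (path-highest {ν} p ε≡0))
      , (λ ε≢0 →
          let i , εi≢0 = Fin.¬∀⟶∃¬ n (λ i → ε i m ≡ 0ℤ) (λ i → ε i m ℤ.≟ 0ℤ) ε≢0
              m₂ = m · A i (kₑ i m - 1ℤ)
              em = MonomialLaws.e-intro i {m} {m₂} εi≢0 (M.refl {m₂})
              _ , _ , p₂ , _ , N₂<N = e-path i p em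
          in f-closed i (descend k (ℕ.<-≤-trans N₂<N (ℕ.≤-pred N<k)) p₂) (MonomialLaws.e⇒f i {m} {m₂} em))
      ]′ (toSum (Fin.all? (λ i → ε i m ℤ.≟ 0ℤ)))

  -- Existence and uniqueness of the factorization

  path-split : ∀ {ν c N m} → Path ν c N m →
    ∃ λ m₁ → ∃ λ m′ → ∈𝓜¹[ level ν ] m₁ × ∃Path (rotate ν) m′ × m ≈ m₁ · τ 1ℤ m′
  path-split {ν} {m = m} (ground m≈) =
    Yˣ ν , Y^ rotate ν , (ν , refl , M.refl {Yˣ ν}) , (_ , _ , ground (M.refl {Y^ rotate ν})) , Y^-split-≈ {m} {ν} m≈
  path-split {ν} {c} (step {m′ = m′} x m≈ xc _ p) =
    Yˣ x , m′ , (x , step-level x ν c xc , M.refl {Yˣ x}) , (_ , _ , p) , m≈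

  module _ {m₁ m₂ : Monomial} {x₁ x₂ : I → ℕ} {m₁′ m₂′ : Monomial}
    (m₁≈ : m₁ ≈ Yˣ x₁) (m₂≈ : m₂ ≈ Yˣ x₂)
    (from0₁ : SupportedFrom0 m₁′) (from0₂ : SupportedFrom0 m₂′) (eq : m₁ · τ 1ℤ m₁′ ≈ m₂ · τ 1ℤ m₂′) where

    -- The exponents of the product at index 0 are those of the first factor alone, and they
    -- determine its `x`.
    ·τ-injectiveˡ : m₁ ≈ m₂
    ·τ-injectiveˡ = M.trans m₁≈ (M.trans (Yˣ-cong x₁≗x₂) (M.sym m₂≈))
      where
      eq₁ : m₁ · τ 1ℤ m₁′ ≈ Yˣ x₁ · τ 1ℤ m₁′
      eq₁ = ·τ-cong {m₁} {Yˣ x₁} {m₁′} m₁≈ (M.refl {m₁′})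
      eq₂ : m₁ · τ 1ℤ m₁′ ≈ Yˣ x₂ · τ 1ℤ m₂′
      eq₂ = M.trans eq (·τ-cong {m₂} {Yˣ x₂} {m₂′} m₂≈ (M.refl {m₂′}))
      x₁≗x₂ : x₁ ≗ x₂
      x₁≗x₂ i = ℤ.+-injective (trans (sym (origin-·τ {m₁ · τ 1ℤ m₁′} {x₁} {m₁′} eq₁ from0₁ i))
                                     (origin-·τ {m₁ · τ 1ℤ m₁′} {x₂} {m₂′} eq₂ from0₂ i))

    ·τ-injectiveʳ : m₁′ ≈ m₂′
    ·τ-injectiveʳ = equal λ i t → subst (λ k → exponent m₁′ i k ≡ exponent m₂′ i k) (lem t)
      (∙-cancelˡ (exponent m₁ i (t + 1ℤ)) _ _
        (trans (at eq i (t + 1ℤ)) (cong (λ z → z + exponent m₂′ i (t + 1ℤ - 1ℤ)) (sym (at ·τ-injectiveˡ i (t + 1ℤ))))))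
      where lem : ∀ t → t + 1ℤ - 1ℤ ≡ t
            lem = solve-∀

  -- Passage to the subcrystals

  ≡just⇒≈₀ : ∀ {z m} → z ≡ just m → z ≈₀ just m
  ≡just⇒≈₀ refl = just M.refl

  𝓜-closed : ∀ ν → IsClosed 𝓜 ∈𝓜[ ν ]
  𝓜-closed ν = record
    { e-closed = λ i {m} m∈ em → e-closed i m∈ (≡just⇒≈₀ {e i m} em)
    ; f-closed = λ i {m} m∈ fm → f-closed i m∈ (≡just⇒≈₀ {f i m} fm) }

  𝓜¹-closed : ∀ s → IsClosed 𝓜 ∈𝓜¹[ s ]
  𝓜¹-closed s = record
    { e-closed = λ i {m} {m′} m∈ em → closed-e s i {m} {m′} m∈ (≡just⇒≈₀ {e i m} em)
    ; f-closed = λ i {m} {m′} m∈ fm → closed-f s i {m} {m′} m∈ (≡just⇒≈₀ {f i m} fm) }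

  -- Equality in a subcrystal ignores membership proofs, so the rule for monomials suffices. The
  -- decision `d` is arbitrary in order to cover both the strict comparison for `e` and the weak one
  -- for `f`.
  tensor-corestrict : ∀ {P₂ P₁ Q : Monomial → Set}
    (closed₂ : IsClosed 𝓜 P₂) (closed₁ : IsClosed 𝓜 P₁) (closed : IsClosed 𝓜 Q)
    (F : Σ Monomial P₂ × Σ Monomial P₁ → Σ Monomial Q) → (∀ b → proj₁ (F b) ≡ proj₁ (proj₁ b) · τ 1ℤ (proj₁ (proj₂ b))) →
    ∀ b₂ b₁ {D : Set} (d : Dec D) {y z₂ z₁}
      (y∈ : ∀ {c} → y ≡ just c → Q c) (z₂∈ : ∀ {c} → z₂ ≡ just c → P₂ c) (z₁∈ : ∀ {c} → z₁ ≡ just c → P₁ c) →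
    (D → y ≈₀ map (_· τ 1ℤ (proj₁ b₁)) z₂) → (¬ D → y ≈₀ map (λ z → proj₁ b₂ · τ 1ℤ z) z₁) →
    Pointwise (λ b c → proj₁ b ≈ proj₁ c) (corestrict 𝓜 Q closed y y∈)
      (map F (if does d then map (_, b₁) (corestrict 𝓜 P₂ closed₂ z₂ z₂∈) else map (b₂ ,_) (corestrict 𝓜 P₁ closed₁ z₁ z₁∈)))
  tensor-corestrict _ _ _ F F≡ b₂ b₁ (yes p) {y} {z₂} _ z₂∈ _ left _ with y | z₂ | left p
  ... | just y | just z | just y≈ = just (subst (y ≈_) (sym (F≡ ((z , z₂∈ refl) , b₁))) y≈)
  ... | nothing | nothing | nothing = nothing
  tensor-corestrict _ _ _ F F≡ b₂ b₁ (no ¬p) {y} {z₁ = z₁} _ _ z₁∈ _ right with y | z₁ | right ¬p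
  ... | just y | just z | just y≈ = just (subst (y ≈_) (sym (F≡ (b₂ , (z , z₁∈ refl)))) y≈)
  ... | nothing | nothing | nothing = nothing

  -- The factorization in terms of the crystals

  ·τ-closed : ∀ {s lam m m′} → level lam ≡ s → ∈𝓜¹[ s ] m → ∈𝓜[ rotate lam ] m′ → ∈𝓜[ lam ] (m · τ 1ℤ m′)
  ·τ-closed {m = m} {m′} level≡s m∈ m′∈ =
    path⇒∈𝓜 (proj₂ (proj₂ (path-cons {m = m} {m′ = m′} level≡s m∈ (∈𝓜⇒path m′∈) (M.refl {m · τ 1ℤ m′}))))

  ∈𝓜-from0 : ∀ {ν m} → ∈𝓜[ ν ] m → SupportedFrom0 m
  ∈𝓜-from0 m∈ = path-from0 (proj₂ (proj₂ (∈𝓜⇒path m∈)))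

  ∈𝓜-split : ∀ {s lam m} → level lam ≡ s → ∈𝓜[ lam ] m →
    ∃ λ m₁ → ∃ λ m′ → ∈𝓜¹[ s ] m₁ × ∈𝓜[ rotate lam ] m′ × m ≈ m₁ · τ 1ℤ m′
  ∈𝓜-split refl m∈ =
    let m₁ , m′ , m₁∈ , (_ , _ , p) , m≈ = path-split (proj₂ (proj₂ (∈𝓜⇒path m∈)))
    in m₁ , m′ , m₁∈ , path⇒∈𝓜 p , m≈

theorem4p5 : (n : ℕ) (3≤n : 3 ≤ n) →
    let open Affine n 3≤n in
    (s : ℕ) → 1 ≤ s →
    (lam : DominantWeight) → level lam ≡ s →
    let mu = rotate lam in
    Σ[ well-defined ∈ (∀ {m m′} → ∈𝓜¹[ s ] m → ∈𝓜[ mu ] m′ → ∈𝓜[ lam ] (m · τ 1ℤ m′)) ]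
    IsIsomorphism (𝓜¹[ s ] ⊗ 𝓜[ mu ]) 𝓜[ lam ] (Φ s mu lam well-defined)
theorem4p5 n 3≤n s _ lam level≡s =
  (λ {m} {m′} → ·τ-closed {s} {lam} {m} {m′} level≡s) , record
    { isBijection = record
      { isInjection = record
        { isCongruent = record
          { cong = λ { {(m₁ , _) , (m₁′ , _)} {(m₂ , _) , (m₂′ , _)} (p , q) → ·τ-cong {m₁} {m₂} {m₁′} {m₂′} p q }
          ; isEquivalence₁ = record
            { refl = λ { {(m , _) , (m′ , _)} → M.refl {m} , M.refl {m′} }
            ; sym = λ { (p , q) → M.sym p , M.sym q }
            ; trans = λ { (p , q) (p′ , q′) → M.trans p p′ , M.trans q q′ } }
          ; isEquivalence₂ = record
            { refl = λ { {m , _} → M.refl {m} } ; sym = λ p → M.sym p ; trans = λ p q → M.trans p q } }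
        ; injective = λ { {(m₁ , x₁ , _ , m₁≈) , (m₁′ , m₁′∈)} {(m₂ , x₂ , _ , m₂≈) , (m₂′ , m₂′∈)} eq →
            ·τ-injectiveˡ {m₁} {m₂} {x₁} {x₂} {m₁′} {m₂′} m₁≈ m₂≈ (∈𝓜-from0 m₁′∈) (∈𝓜-from0 m₂′∈) eq ,
            ·τ-injectiveʳ {m₁} {m₂} {x₁} {x₂} {m₁′} {m₂′} m₁≈ m₂≈ (∈𝓜-from0 m₁′∈) (∈𝓜-from0 m₂′∈) eq } }
      ; surjective = λ { (m , m∈) →
          let m₁ , m′ , m₁∈ , m′∈ , m≈ = ∈𝓜-split level≡s m∈
          in ((m₁ , m₁∈) , (m′ , m′∈)) ,
             λ { {(m₂ , _) , (m₂′ , _)} (p , q) → M.trans (·τ-cong {m₂} {m₁} {m₂′} {m′} p q) (M.sym m≈) } } }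
    ; wt-preserved = λ { ((m , x , _ , m≈) , (m′ , m′∈)) i → TensorRule.wt-·τ {m} {x} {m′} m≈ (∈𝓜-from0 m′∈) i }
    ; ε-preserved = λ { i ((m , x , _ , m≈) , (m′ , m′∈)) → TensorRule.ε-·τ {m} {x} {m′} m≈ (∈𝓜-from0 m′∈) i }
    ; φ-preserved = λ { i ((m , x , _ , m≈) , (m′ , m′∈)) → TensorRule.φ-·τ {m} {x} {m′} m≈ (∈𝓜-from0 m′∈) i }
    ; e-commutes = λ { i ((m , m∈@(x , _ , m≈)) , (m′ , m′∈)) →
        let open TensorRule {m} {x} {m′} m≈ (∈𝓜-from0 m′∈) i in
        tensor-corestrict (𝓜¹-closed s) (𝓜-closed (rotate lam)) (𝓜-closed lam) _ (λ _ → refl)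
          (m , m∈) (m′ , m′∈) (φ i m′ ℤ.<? ε i m) {e i (m · τ 1ℤ m′)} {e i m} {e i m′} _ _ _
          e-left (λ φ≮ε → e-right (ℤ.≮⇒≥ φ≮ε)) }
    ; f-commutes = λ { i ((m , m∈@(x , _ , m≈)) , (m′ , m′∈)) →
        let open TensorRule {m} {x} {m′} m≈ (∈𝓜-from0 m′∈) i in
        tensor-corestrict (𝓜¹-closed s) (𝓜-closed (rotate lam)) (𝓜-closed lam) _ (λ _ → refl)
          (m , m∈) (m′ , m′∈) (φ i m′ ℤ.≤? ε i m) {f i (m · τ 1ℤ m′)} {f i m} {f i m′} _ _ _
          f-left (λ φ≰ε → f-right (ℤ.≰⇒> φ≰ε)) } }
  where
  open Affine n 3≤n
  open Decomposition n 3≤n
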